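{- For all complex numbers $\alpha$, $\lambda$ and all non-negative integers $\ell$, $n$, $r$, $s$, the following identity holds in $\mathbb{C}[x]$: $$\sum_{k=0}^{n+r}\lambda^{n+r-k}\binom{n+r}{k}\binom{\ell+k+r}{r}E_{\ell+k}^{(\alpha)}(x)+(-1)^{\ell+n+r+s+1}\sum_{k=0}^{\ell+r}\lambda^{\ell+r-k}\binom{\ell+r}{k}\binom{n+k+r}{r}E_{n+k}^{(\alpha)}(\alpha-s-\lambda-x)$$ $$=2\,\Psi_{\alpha-1}\left(\frac{D^{r}}{r!}\sum_{k=0}^{s-1}(-1)^{k}(x+k)^{\ell+r}(x+\lambda+k)^{n+r}\right).$$
   Context: For $\alpha\in\mathbb{C}$, the generalized Euler polynomials $E_n^{(\alpha)}(x)\in\mathbb{C}[x]$, $n\ge 0$, are defined by $\sum_{n=0}^{\infty}E_n^{(\alpha)}(x)\frac{t^n}{n!}=\left(\frac{2}{e^t+1}\right)^{\alpha}e^{tx}$, where the $\alpha$-th power denotes the formal power series in $t$ with constant term $1$. $\Psi_\alpha$ denotes the $\mathbb{C}$-linear automorphism of $\mathbb{C}[x]$ with $\Psi_\alpha(x^n)=E_n^{(\alpha)}(x)$ for all integers $n\ge 0$. $D$ denotes the derivation operator $d/dx$ on $\mathbb{C}[x]$, and $D^r$ its $r$-th iterate. An empty sum (the case $s=0$) is $0$, and $0^0=1$. -}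

module Defs where

open import Level using (Level; 0ℓ; _⊔_)
open import Algebra.Bundles using (RawRing; CommutativeRing)
import Algebra.Definitions.RawSemiring
open import Algebra.Morphism.Structures using (module RingMorphisms)
open import Data.Fin.Base using (toℕ)
open import Data.Integer.Base using (+_)
open import Data.List.Base using (List; []; _∷_; length; map)
open import Data.Nat.Base as ℕ using (ℕ; zero; suc; _∸_; _!)
import Data.Nat.Properties as ℕ
open import Data.Product.Base using (Σ; _,_; ∃)
open import Data.Rational.Base as ℚ using (ℚ; 0ℚ; 1ℚ; ½; ∣_∣)
import Data.Rational.Properties as ℚ
open import Data.Rational.Solver using (module +-*-Solver)
open import Function.Base using (_∘_)
open import Relation.Binary.PropositionalEquality
  using (_≡_; refl; sym; trans; cong; subst)

private
  variable
    a ℓ : Level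

module Reals where

  -- x ~ x says that x is a Cauchy sequence of rationals, and for Cauchy
  -- sequences x ~ y is equivalent to x n - y n → 0.
  infix 4 _~_
  record _~_ (x y : ℕ → ℚ) : Set where
    constructor mk~
    field
      within : ∀ ε → 0ℚ ℚ.< ε →
               ∃ λ N → ∀ m n → N ℕ.≤ m → N ℕ.≤ n → ∣ x m ℚ.- y n ∣ ℚ.< ε

  open _~_ public

  record ℝ : Set where
    no-eta-equality
    field
      seq    : ℕ → ℚ
      cauchy : seq ~ seq

  open ℝ public

  infix 4 _≈_
  record _≈_ (x y : ℝ) : Set where
    constructor mk≈
    field
      close : seq x ~ seq y

  open _≈_ public

  private
    half : ∀ ε → 0ℚ ℚ.< ε → 0ℚ ℚ.< ε ℚ.* ½
    half ε 0<ε = subst (ℚ._< ε ℚ.* ½) (ℚ.*-zeroˡ ½) (ℚ.*-monoˡ-<-pos ½ 0<ε)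

    halves : ∀ ε → ε ℚ.* ½ ℚ.+ ε ℚ.* ½ ≡ ε
    halves ε = trans (sym (ℚ.*-distribˡ-+ ε ½ ½)) (ℚ.*-identityʳ ε)

    sum-< : ∀ p q ε → ∣ p ∣ ℚ.< ε ℚ.* ½ → ∣ q ∣ ℚ.< ε ℚ.* ½ → ∣ p ℚ.+ q ∣ ℚ.< ε
    sum-< p q ε p< q< = subst (∣ p ℚ.+ q ∣ ℚ.<_) (halves ε)
      (ℚ.≤-<-trans (ℚ.∣p+q∣≤∣p∣+∣q∣ p q) (ℚ.+-mono-< p< q<))

    ⊔ˡ : ∀ {k} m n → m ℕ.⊔ n ℕ.≤ k → m ℕ.≤ k
    ⊔ˡ m n = ℕ.≤-trans (ℕ.m≤m⊔n m n)

    ⊔ʳ : ∀ {k} m n → m ℕ.⊔ n ℕ.≤ k → n ℕ.≤ k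
    ⊔ʳ m n = ℕ.≤-trans (ℕ.m≤n⊔m m n)

    ~-sym : ∀ {x y} → x ~ y → y ~ x
    ~-sym {x} {y} x~y .within ε 0<ε with N , f ← within x~y ε 0<ε = N , λ m n N≤m N≤n →
      subst (ℚ._< ε) (eq m n) (f n m N≤n N≤m)
      where
      open +-*-Solver
      eq : ∀ m n → ∣ x n ℚ.- y m ∣ ≡ ∣ y m ℚ.- x n ∣
      eq m n = trans
        (cong ∣_∣ (solve 2 (λ p q → p :- q := :- (q :- p)) refl (x n) (y m)))
        (ℚ.∣-p∣≡∣p∣ (y m ℚ.- x n))

    ~-trans : ∀ {x y z} → x ~ y → y ~ z → x ~ z
    ~-trans {x} {y} {z} x~y y~z .within ε 0<ε
      with M , f ← within x~y (ε ℚ.* ½) (half ε 0<ε)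
         | N , g ← within y~z (ε ℚ.* ½) (half ε 0<ε) = M ℕ.⊔ N , λ m n ≤m ≤n →
      subst (ℚ._< ε) (cong ∣_∣ (eq m n))
        (sum-< (x m ℚ.- y n) (y n ℚ.- z n) ε
          (f m n (⊔ˡ M N ≤m) (⊔ˡ M N ≤n)) (g n n (⊔ʳ M N ≤n) (⊔ʳ M N ≤n)))
      where
      open +-*-Solver
      eq : ∀ m n → (x m ℚ.- y n) ℚ.+ (y n ℚ.- z n) ≡ x m ℚ.- z n
      eq m n = solve 3 (λ p q r → (p :- q) :+ (q :- r) := p :- r) refl
        (x m) (y n) (z n)

    ~-+ : ∀ {x x′ y y′} → x ~ x′ → y ~ y′ →
          (λ n → x n ℚ.+ y n) ~ (λ n → x′ n ℚ.+ y′ n)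
    ~-+ {x} {x′} {y} {y′} x~ y~ .within ε 0<ε
      with M , f ← within x~ (ε ℚ.* ½) (half ε 0<ε)
         | N , g ← within y~ (ε ℚ.* ½) (half ε 0<ε) = M ℕ.⊔ N , λ m n ≤m ≤n →
      subst (ℚ._< ε) (cong ∣_∣ (eq m n))
        (sum-< (x m ℚ.- x′ n) (y m ℚ.- y′ n) ε
          (f m n (⊔ˡ M N ≤m) (⊔ˡ M N ≤n)) (g m n (⊔ʳ M N ≤m) (⊔ʳ M N ≤n)))
      where
      open +-*-Solver
      eq : ∀ m n → (x m ℚ.- x′ n) ℚ.+ (y m ℚ.- y′ n)
                 ≡ (x m ℚ.+ y m) ℚ.- (x′ n ℚ.+ y′ n)
      eq m n = solve 4
        (λ p p′ q q′ → (p :- p′) :+ (q :- q′) := (p :+ q) :- (p′ :+ q′)) refl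
        (x m) (x′ n) (y m) (y′ n)

    ~-neg : ∀ {x y} → x ~ y → (λ n → ℚ.- x n) ~ (λ n → ℚ.- y n)
    ~-neg {x} {y} x~y .within ε 0<ε with N , f ← within x~y ε 0<ε = N , λ m n N≤m N≤n →
      subst (ℚ._< ε) (eq m n) (f m n N≤m N≤n)
      where
      open +-*-Solver
      eq : ∀ m n → ∣ x m ℚ.- y n ∣ ≡ ∣ (ℚ.- x m) ℚ.- (ℚ.- y n) ∣
      eq m n = trans (sym (ℚ.∣-p∣≡∣p∣ (x m ℚ.- y n)))
        (cong ∣_∣ (solve 2 (λ p q → :- (p :- q) := (:- p) :- (:- q)) refl
          (x m) (y n)))

    bounded : ∀ {x} → x ~ x → ∃ λ B → Σ (ℚ.Positive B) λ _ →
              ∃ λ N → ∀ n → N ℕ.≤ n → ∣ x n ∣ ℚ.≤ B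
    bounded {x} x~x with N , f ← within x~x 1ℚ (ℚ.positive⁻¹ 1ℚ) =
      1ℚ ℚ.+ ∣ x N ∣ ,
      ℚ.positive (ℚ.+-mono-<-≤ (ℚ.positive⁻¹ 1ℚ) (ℚ.0≤∣p∣ (x N))) ,
      N , λ n N≤n → subst (ℚ._≤ 1ℚ ℚ.+ ∣ x N ∣) (cong ∣_∣ (eq n))
        (ℚ.≤-trans (ℚ.∣p+q∣≤∣p∣+∣q∣ (x n ℚ.- x N) (x N))
          (ℚ.+-monoˡ-≤ ∣ x N ∣ (ℚ.<⇒≤ (f n N N≤n ℕ.≤-refl))))
      where
      open +-*-Solver
      eq : ∀ {N} n → (x n ℚ.- x N) ℚ.+ x N ≡ x n
      eq {N} n = solve 2 (λ p q → (p :- q) :+ q := p) refl (x n) (x N)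

    scale : ∀ B → ℚ.Positive B → ∀ ε → 0ℚ ℚ.< ε →
            ∃ λ δ → Σ (0ℚ ℚ.< δ) λ _ →
            ∀ p q → ∣ p ∣ ℚ.≤ B → ∣ q ∣ ℚ.< δ → ∣ p ℚ.* q ∣ ℚ.< ε ℚ.* ½
    scale B B>0 ε 0<ε = δ , 0<δ , bound
      where
      instance
        _ = B>0
        _ = ℚ.pos⇒nonZero B

      δ : ℚ
      δ = ε ℚ.* ½ ℚ.* ℚ.1/ B

      0<δ : 0ℚ ℚ.< δ
      0<δ = subst (ℚ._< δ) (ℚ.*-zeroˡ (ℚ.1/ B))
        (ℚ.*-monoˡ-<-pos (ℚ.1/ B) {{ℚ.1/pos⇒pos B}} (half ε 0<ε))

      bound : ∀ p q → ∣ p ∣ ℚ.≤ B → ∣ q ∣ ℚ.< δ → ∣ p ℚ.* q ∣ ℚ.< ε ℚ.* ½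
      bound p q p≤B q<δ = begin-strict
        ∣ p ℚ.* q ∣                  ≡⟨ ℚ.∣p*q∣≡∣p∣*∣q∣ p q ⟩
        ∣ p ∣ ℚ.* ∣ q ∣              ≤⟨ ℚ.*-monoʳ-≤-nonNeg ∣ q ∣ {{ℚ.∣-∣-nonNeg q}} p≤B ⟩
        B ℚ.* ∣ q ∣                  <⟨ ℚ.*-monoʳ-<-pos B q<δ ⟩
        B ℚ.* (ε ℚ.* ½ ℚ.* ℚ.1/ B)   ≡⟨ ℚ.*-comm B δ ⟩
        ε ℚ.* ½ ℚ.* ℚ.1/ B ℚ.* B     ≡⟨ ℚ.*-assoc (ε ℚ.* ½) (ℚ.1/ B) B ⟩
        ε ℚ.* ½ ℚ.* (ℚ.1/ B ℚ.* B)   ≡⟨ cong (ε ℚ.* ½ ℚ.*_) (ℚ.*-inverseˡ B) ⟩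
        ε ℚ.* ½ ℚ.* 1ℚ               ≡⟨ ℚ.*-identityʳ (ε ℚ.* ½) ⟩
        ε ℚ.* ½                      ∎
        where open ℚ.≤-Reasoning

    *-difference : ∀ p p′ q q′ →
      p ℚ.* (q ℚ.- q′) ℚ.+ q′ ℚ.* (p ℚ.- p′) ≡ p ℚ.* q ℚ.- p′ ℚ.* q′
    *-difference = solve 4
      (λ p p′ q q′ → p :* (q :- q′) :+ q′ :* (p :- p′) := p :* q :- p′ :* q′) refl
      where open +-*-Solver

    ~-* : ∀ {x x′ y y′} → x ~ x → y′ ~ y′ → x ~ x′ → y ~ y′ →
          (λ n → x n ℚ.* y n) ~ (λ n → x′ n ℚ.* y′ n)
    ~-* {x} {x′} {y} {y′} cx cy′ x~ y~ .within ε 0<ε =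
      let B , B>0 , K , bx = bounded {x} cx
          C , C>0 , L , by = bounded {y′} cy′
          γ , 0<γ , cγ = scale C C>0 ε 0<ε
          δ , 0<δ , cδ = scale B B>0 ε 0<ε
          M , f = within x~ γ 0<γ
          N , g = within y~ δ 0<δ
      in (K ℕ.⊔ L) ℕ.⊔ (M ℕ.⊔ N) , λ m n ≤m ≤n →
      subst (ℚ._< ε) (cong ∣_∣ (*-difference (x m) (x′ n) (y m) (y′ n)))
        (sum-< (x m ℚ.* (y m ℚ.- y′ n)) (y′ n ℚ.* (x m ℚ.- x′ n)) ε
          (cδ (x m) (y m ℚ.- y′ n)
            (bx m (⊔ˡ K L (⊔ˡ (K ℕ.⊔ L) (M ℕ.⊔ N) ≤m)))
            (g m n (⊔ʳ M N (⊔ʳ (K ℕ.⊔ L) (M ℕ.⊔ N) ≤m))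
                   (⊔ʳ M N (⊔ʳ (K ℕ.⊔ L) (M ℕ.⊔ N) ≤n))))
          (cγ (y′ n) (x m ℚ.- x′ n)
            (by n (⊔ʳ K L (⊔ˡ (K ℕ.⊔ L) (M ℕ.⊔ N) ≤n)))
            (f m n (⊔ˡ M N (⊔ʳ (K ℕ.⊔ L) (M ℕ.⊔ N) ≤m))
                   (⊔ˡ M N (⊔ʳ (K ℕ.⊔ L) (M ℕ.⊔ N) ≤n)))))

  infixl 6 _+_
  infixl 7 _*_
  infix  8 -_

  _+_ _*_ : ℝ → ℝ → ℝ
  (x + y) .seq    = λ n → seq x n ℚ.+ seq y n
  (x + y) .cauchy = ~-+ (cauchy x) (cauchy y)
  (x * y) .seq    = λ n → seq x n ℚ.* seq y n
  (x * y) .cauchy = ~-* (cauchy x) (cauchy y) (cauchy x) (cauchy y)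

  -_ : ℝ → ℝ
  (- x) .seq    = λ n → ℚ.- seq x n
  (- x) .cauchy = ~-neg (cauchy x)

  fromℚ : ℚ → ℝ
  fromℚ q .seq    = λ _ → q
  fromℚ q .cauchy = mk~ λ ε 0<ε → 0 , λ _ _ _ _ →
    subst (λ p → ∣ p ∣ ℚ.< ε) (sym (ℚ.+-inverseʳ q)) 0<ε

  0ℝ 1ℝ : ℝ
  0ℝ = fromℚ 0ℚ
  1ℝ = fromℚ 1ℚ

  pointwise : ∀ {x y} → (∀ n → seq x n ≡ seq y n) → x ≈ y
  pointwise {x} eq = mk≈ (mk~ λ ε 0<ε → let N , f = within (cauchy x) ε 0<ε in
    N , λ m n N≤m N≤n →
      subst (λ q → ∣ seq x m ℚ.- q ∣ ℚ.< ε) (eq n) (f m n N≤m N≤n))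

  commutativeRing : CommutativeRing 0ℓ 0ℓ
  commutativeRing = record
    { Carrier = ℝ
    ; _≈_ = _≈_
    ; _+_ = _+_
    ; _*_ = _*_
    ; -_  = -_
    ; 0#  = 0ℝ
    ; 1#  = 1ℝ
    ; isCommutativeRing = record
      { isRing = record
        { +-isAbelianGroup = record
          { isGroup = record
            { isMonoid = record
              { isSemigroup = record
                { isMagma = record
                  { isEquivalence = record
                    { refl  = λ {x} → mk≈ (cauchy x)
                    ; sym   = λ p → mk≈ (~-sym (close p))
                    ; trans = λ p q → mk≈ (~-trans (close p) (close q))
                    }
                  ; ∙-cong = λ p q → mk≈ (~-+ (close p) (close q))
                  }
                ; assoc = λ x y z → pointwise λ n →
                    ℚ.+-assoc (seq x n) (seq y n) (seq z n)
                }
              ; identity = (λ x → pointwise λ n → ℚ.+-identityˡ (seq x n))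
                         , (λ x → pointwise λ n → ℚ.+-identityʳ (seq x n))
              }
            ; inverse = (λ x → pointwise λ n → ℚ.+-inverseˡ (seq x n))
                      , (λ x → pointwise λ n → ℚ.+-inverseʳ (seq x n))
            ; ⁻¹-cong = λ p → mk≈ (~-neg (close p))
            }
          ; comm = λ x y → pointwise λ n → ℚ.+-comm (seq x n) (seq y n)
          }
        ; *-cong = λ {x} {_} {_} {y′} p q →
            mk≈ (~-* (cauchy x) (cauchy y′) (close p) (close q))
        ; *-assoc = λ x y z → pointwise λ n →
            ℚ.*-assoc (seq x n) (seq y n) (seq z n)
        ; *-identity = (λ x → pointwise λ n → ℚ.*-identityˡ (seq x n))
                     , (λ x → pointwise λ n → ℚ.*-identityʳ (seq x n))
        ; distrib = (λ x y z → pointwise λ n →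
                      ℚ.*-distribˡ-+ (seq x n) (seq y n) (seq z n))
                  , (λ x y z → pointwise λ n →
                      ℚ.*-distribʳ-+ (seq x n) (seq y n) (seq z n))
        }
      ; *-comm = λ x y → pointwise λ n → ℚ.*-comm (seq x n) (seq y n)
      }
    }

open Reals public using (ℝ)

private
  module Identities where
    open import Data.Rational.Base using (_+_; _*_; _-_)
    open +-*-Solver

    assoc-re : ∀ x y u v s t →
      (x * u - y * v) * s - (x * v + y * u) * t ≡
      x * (u * s - v * t) - y * (u * t + v * s)
    assoc-re = solve 6 (λ x y u v s t →
      (x :* u :- y :* v) :* s :- (x :* v :+ y :* u) :* t :=
      x :* (u :* s :- v :* t) :- y :* (u :* t :+ v :* s)) refl

    assoc-im : ∀ x y u v s t →
      (x * u - y * v) * t + (x * v + y * u) * s ≡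
      x * (u * t + v * s) + y * (u * s - v * t)
    assoc-im = solve 6 (λ x y u v s t →
      (x :* u :- y :* v) :* t :+ (x :* v :+ y :* u) :* s :=
      x :* (u :* t :+ v :* s) :+ y :* (u :* s :- v :* t)) refl

    distrib-re : ∀ x y u v s t →
      x * (u + s) - y * (v + t) ≡ (x * u - y * v) + (x * s - y * t)
    distrib-re = solve 6 (λ x y u v s t →
      x :* (u :+ s) :- y :* (v :+ t) :=
      (x :* u :- y :* v) :+ (x :* s :- y :* t)) refl

    distrib-im : ∀ x y u v s t →
      x * (v + t) + y * (u + s) ≡ (x * v + y * u) + (x * t + y * s)
    distrib-im = solve 6 (λ x y u v s t →
      x :* (v :+ t) :+ y :* (u :+ s) :=
      (x :* v :+ y :* u) :+ (x :* t :+ y :* s)) refl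

    identity-re : ∀ x y → x * 1ℚ - y * 0ℚ ≡ x
    identity-re = solve 2 (λ x y → x :* con 1ℚ :- y :* con 0ℚ := x) refl

    identity-im : ∀ x y → x * 0ℚ + y * 1ℚ ≡ y
    identity-im = solve 2 (λ x y → x :* con 0ℚ :+ y :* con 1ℚ := y) refl

    homo-re : ∀ p q → p * q ≡ p * q - 0ℚ * 0ℚ
    homo-re = solve 2 (λ p q → p :* q := p :* q :- con 0ℚ :* con 0ℚ) refl

    homo-im : ∀ p q → 0ℚ ≡ p * 0ℚ + 0ℚ * q
    homo-im = solve 2 (λ p q → con 0ℚ := p :* con 0ℚ :+ con 0ℚ :* q) refl

module Complexes where

  private
    module R where
      open CommutativeRing Reals.commutativeRing public
      open Reals public using (fromℚ; seq; pointwise)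

  record ℂ : Set where
    no-eta-equality
    field
      re im : ℝ

  open ℂ public

  infix 4 _≈_
  record _≈_ (z w : ℂ) : Set where
    constructor mk≈
    field
      re≈ : re z R.≈ re w
      im≈ : im z R.≈ im w

  infixl 6 _+_
  infixl 7 _*_
  infix  8 -_

  _+_ _*_ : ℂ → ℂ → ℂ
  (z + w) .re = re z R.+ re w
  (z + w) .im = im z R.+ im w
  (z * w) .re = re z R.* re w R.- im z R.* im w
  (z * w) .im = re z R.* im w R.+ im z R.* re w

  -_ : ℂ → ℂ
  (- z) .re = R.- re z
  (- z) .im = R.- im z

  fromℚ : ℚ → ℂ
  fromℚ q .re = R.fromℚ q
  fromℚ q .im = R.0#

  pointwise : ∀ {z w} →
              (∀ n → R.seq (re z) n ≡ R.seq (re w) n) →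
              (∀ n → R.seq (im z) n ≡ R.seq (im w) n) → z ≈ w
  pointwise p q = mk≈ (R.pointwise p) (R.pointwise q)

  private
    1ℂ : ℂ
    1ℂ = fromℚ 1ℚ

    ≈-trans : ∀ {x y z} → x ≈ y → y ≈ z → x ≈ z
    ≈-trans (mk≈ p q) (mk≈ p′ q′) = mk≈ (R.trans p p′) (R.trans q q′)

    +-cong : ∀ {x y u v} → x ≈ y → u ≈ v → x + u ≈ y + v
    +-cong (mk≈ p q) (mk≈ p′ q′) = mk≈ (R.+-cong p p′) (R.+-cong q q′)

    *-cong : ∀ {x y u v} → x ≈ y → u ≈ v → x * u ≈ y * v
    *-cong (mk≈ p q) (mk≈ p′ q′) = mk≈
      (R.+-cong (R.*-cong p p′) (R.-‿cong (R.*-cong q q′)))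
      (R.+-cong (R.*-cong p q′) (R.*-cong q p′))

    *-comm : ∀ x y → x * y ≈ y * x
    *-comm x y = mk≈
      (R.+-cong (R.*-comm (re x) (re y)) (R.-‿cong (R.*-comm (im x) (im y))))
      (R.trans (R.+-comm (re x R.* im y) (im x R.* re y))
        (R.+-cong (R.*-comm (im x) (re y)) (R.*-comm (re x) (im y))))

    *-assoc : ∀ x y z → (x * y) * z ≈ x * (y * z)
    *-assoc x y z = pointwise
      (λ n → Identities.assoc-re (x₁ n) (x₂ n) (y₁ n) (y₂ n) (z₁ n) (z₂ n))
      (λ n → Identities.assoc-im (x₁ n) (x₂ n) (y₁ n) (y₂ n) (z₁ n) (z₂ n))
      where
      x₁ = R.seq (re x); x₂ = R.seq (im x)
      y₁ = R.seq (re y); y₂ = R.seq (im y)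
      z₁ = R.seq (re z); z₂ = R.seq (im z)

    *-distribˡ : ∀ x y z → x * (y + z) ≈ x * y + x * z
    *-distribˡ x y z = pointwise
      (λ n → Identities.distrib-re (x₁ n) (x₂ n) (y₁ n) (y₂ n) (z₁ n) (z₂ n))
      (λ n → Identities.distrib-im (x₁ n) (x₂ n) (y₁ n) (y₂ n) (z₁ n) (z₂ n))
      where
      x₁ = R.seq (re x); x₂ = R.seq (im x)
      y₁ = R.seq (re y); y₂ = R.seq (im y)
      z₁ = R.seq (re z); z₂ = R.seq (im z)

    *-identityʳ : ∀ z → z * 1ℂ ≈ z
    *-identityʳ z = pointwise
      (λ n → Identities.identity-re (R.seq (re z) n) (R.seq (im z) n))
      (λ n → Identities.identity-im (R.seq (re z) n) (R.seq (im z) n))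

  commutativeRing : CommutativeRing 0ℓ 0ℓ
  commutativeRing = record
    { Carrier = ℂ
    ; _≈_ = _≈_
    ; _+_ = _+_
    ; _*_ = _*_
    ; -_  = -_
    ; 0#  = fromℚ 0ℚ
    ; 1#  = 1ℂ
    ; isCommutativeRing = record
      { isRing = record
        { +-isAbelianGroup = record
          { isGroup = record
            { isMonoid = record
              { isSemigroup = record
                { isMagma = record
                  { isEquivalence = record
                    { refl  = mk≈ R.refl R.refl
                    ; sym   = λ (mk≈ p q) → mk≈ (R.sym p) (R.sym q)
                    ; trans = ≈-trans
                    }
                  ; ∙-cong = +-cong
                  }
                ; assoc = λ x y z → mk≈ (R.+-assoc (re x) (re y) (re z))
                                        (R.+-assoc (im x) (im y) (im z))
                }
              ; identity =
                  (λ z → mk≈ (R.+-identityˡ (re z)) (R.+-identityˡ (im z)))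
                , (λ z → mk≈ (R.+-identityʳ (re z)) (R.+-identityʳ (im z)))
              }
            ; inverse =
                (λ z → mk≈ (R.-‿inverseˡ (re z)) (R.-‿inverseˡ (im z)))
              , (λ z → mk≈ (R.-‿inverseʳ (re z)) (R.-‿inverseʳ (im z)))
            ; ⁻¹-cong = λ (mk≈ p q) → mk≈ (R.-‿cong p) (R.-‿cong q)
            }
          ; comm = λ z w →
              mk≈ (R.+-comm (re z) (re w)) (R.+-comm (im z) (im w))
          }
        ; *-cong = *-cong
        ; *-assoc = *-assoc
        ; *-identity =
            (λ z → ≈-trans (*-comm 1ℂ z) (*-identityʳ z)) , *-identityʳ
        ; distrib = *-distribˡ , λ x y z →
            ≈-trans (*-comm (y + z) x)
              (≈-trans (*-distribˡ x y z) (+-cong (*-comm x y) (*-comm x z)))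
        }
      ; *-comm = *-comm
      }
    }

  fromℚ-isRingHomomorphism :
    RingMorphisms.IsRingHomomorphism
      (CommutativeRing.rawRing ℚ.+-*-commutativeRing)
      (CommutativeRing.rawRing commutativeRing)
      fromℚ
  fromℚ-isRingHomomorphism = record
    { isSemiringHomomorphism = record
      { isNearSemiringHomomorphism = record
        { +-isMonoidHomomorphism = record
          { isMagmaHomomorphism = record
            { isRelHomomorphism = record
              { cong = λ where refl → mk≈ R.refl R.refl }
            ; homo = λ p q → pointwise (λ _ → refl) (λ _ → refl)
            }
          ; ε-homo = mk≈ R.refl R.refl
          }
        ; *-homo = λ p q → pointwise
            (λ _ → Identities.homo-re p q) (λ _ → Identities.homo-im p q)
        }
      ; 1#-homo = mk≈ R.refl R.refl
      }
    ; -‿homo = λ p → pointwise (λ _ → refl) (λ _ → refl)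
    }

open Complexes public using (ℂ)

-- The operations of a ring extended by n × x, x ^ n (so x ^ 0 is 1# for every
-- x) and finite sums.
module RingOps (R : RawRing a ℓ) where
  open RawRing R public
  open Algebra.Definitions.RawSemiring rawSemiring public using (_×_; _^_; sum)

  infixl 6 _-_
  _-_ : Carrier → Carrier → Carrier
  x - y = x + - y

  ∑< : ℕ → (ℕ → Carrier) → Carrier
  ∑< n f = sum {n} (f ∘ toℕ)

  infixl 5 ∑<
  syntax ∑< n (λ k → e) = ∑[ k < n ] e

1/_! : ℕ → ℚ
1/ n ! = (+ 1 ℚ./ n !) {{n ℕ.!≢0}}

-- R⟦t⟧, a series being its sequence of coefficients.
module PowerSeries (R : RawRing a ℓ) (fromℚ : ℚ → RawRing.Carrier R) where
  private
    module R = RingOps R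
    open R using (Carrier; sum; ∑<)

  rawRing : RawRing a ℓ
  rawRing = record
    { Carrier = ℕ → Carrier
    ; _≈_ = λ f g → ∀ n → f n R.≈ g n
    ; _+_ = λ f g n → f n R.+ g n
    ; _*_ = λ f g n → ∑[ k < suc n ] f k R.* g (n ∸ k)
    ; -_  = λ f n → R.- f n
    ; 0#  = λ _ → R.0#
    ; 1#  = λ { zero → R.1# ; (suc _) → R.0# }
    }

  open RingOps rawRing public using (_+_; _*_; -_; _-_; 1#; _^_)

  Series : Set a
  Series = ℕ → Carrier

  infixr 7 _•_
  _•_ : Carrier → Series → Series
  (c • f) n = c R.* f n

  -- e^{ct}
  exp : Carrier → Series
  exp c n = fromℚ 1/ n ! R.* c R.^ n

  -- α (α - 1) ⋯ (α - k + 1)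
  falling : Carrier → ℕ → Carrier
  falling α zero    = R.1#
  falling α (suc k) = falling α k R.* (α R.- k R.× R.1#)

  binomial : Carrier → ℕ → Carrier
  binomial α k = fromℚ 1/ k ! R.* falling α k

  -- The next two are only meant for series with constant term 1: then f - 1
  -- is divisible by t, so the terms with k > n of the geometric and binomial
  -- series do not contribute to the coefficient of t^n.

  infix 8 _⁻¹
  _⁻¹ : Series → Series
  (f ⁻¹) n = ∑[ k < suc n ] ((1# - f) ^ k) n

  infixr 8 _^^_
  _^^_ : Series → Carrier → Series
  (f ^^ α) n = ∑[ k < suc n ] binomial α k R.* ((f - 1#) ^ k) n

  -- 2 / (e^t + 1), as the inverse of (e^t + 1) / 2
  2/[e^t+1] : Series
  2/[e^t+1] = (fromℚ ½ • (exp R.1# + 1#)) ⁻¹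

-- R[x], a polynomial being the list of its coefficients, constant term first;
-- trailing zeros are allowed and ignored by _≈_.
module Polynomials (R : RawRing a ℓ) where
  private
    module R = RingOps R
    open R using (Carrier)

  Poly : Set a
  Poly = List Carrier

  coeff : Poly → ℕ → Carrier
  coeff []      _       = R.0#
  coeff (a ∷ p) zero    = a
  coeff (a ∷ p) (suc n) = coeff p n

  const : Carrier → Poly
  const a = a ∷ []

  X : Poly
  X = R.0# ∷ R.1# ∷ []

  infixr 7 _•_
  _•_ : Carrier → Poly → Poly
  c • p = map (c R.*_) p

  private
    add : Poly → Poly → Poly
    add []      q       = q
    add (a ∷ p) []      = a ∷ p
    add (a ∷ p) (b ∷ q) = (a R.+ b) ∷ add p q

    mul : Poly → Poly → Poly
    mul []      q = []
    mul (a ∷ p) q = add (a • q) (R.0# ∷ mul p q)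

  rawRing : RawRing a ℓ
  rawRing = record
    { Carrier = Poly
    ; _≈_ = λ p q → ∀ n → coeff p n R.≈ coeff q n
    ; _+_ = add
    ; _*_ = mul
    ; -_  = map (λ a → R.- a)
    ; 0#  = []
    ; 1#  = const R.1#
    }

  open RingOps rawRing public
    using (_≈_; _+_; _*_; -_; _-_; 0#; 1#; _×_; _^_; sum; ∑<)

  -- (a + x p)′ = p + x p′
  D : Poly → Poly
  D []      = []
  D (a ∷ p) = p + (R.0# ∷ D p)

  D^ : ℕ → Poly → Poly
  D^ zero    p = p
  D^ (suc r) p = D (D^ r p)

  infixl 9 _[_]
  _[_] : Poly → Poly → Poly
  []      [ q ] = []
  (a ∷ p) [ q ] = const a + q * p [ q ]

module GeneralizedEuler (R : RawRing a ℓ) (fromℚ : ℚ → RawRing.Carrier R) where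
  open RawRing R using (Carrier)
  open Polynomials R public

  private
    module R⟦t⟧    = PowerSeries R fromℚ
    module R[x]⟦t⟧ = PowerSeries rawRing (const ∘ fromℚ)

  F^ : Carrier → R[x]⟦t⟧.Series
  F^ α = const ∘ (R⟦t⟧.2/[e^t+1] R⟦t⟧.^^ α)

  E : Carrier → ℕ → Poly
  E α n = (n !) × (F^ α R[x]⟦t⟧.* R[x]⟦t⟧.exp X) n

  Ψ : Carrier → Poly → Poly
  Ψ α p = ∑[ n < length p ] coeff p n • E α n

module ℂ[x] where
  open RingOps (CommutativeRing.rawRing Complexes.commutativeRing) public
    using () renaming (_+_ to _+ᶜ_; _-_ to _-ᶜ_; -_ to -ᶜ_; 1# to 1ᶜ; _×_ to _×ᶜ_; _^_ to _^ᶜ_)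
  open GeneralizedEuler
    (CommutativeRing.rawRing Complexes.commutativeRing) Complexes.fromℚ public

{-# OPTIONS --safe #-}

-- Let a power series f(t) act on R[x] as the differential operator f(d/dx). Then
-- Ψ_α is the action of F^α with F = 2 / (e^t + 1), and e^{ct} acts as x ↦ x + c.
-- The power h = f^α is the only series with constant term 1 and f h′ = α f′ h, whence
--   (e^t + 1) F^α = 2 F^{α - 1}   and   F(-t)^α = e^{αt} F(t)^α,
-- that is, 2 Ψ_{α-1}(p) = Ψ_α(p(x + 1) + p(x)) and the reflection formula for E_n.
-- Put W = Ψ_α D^r / r! and q_k = (x + k)^{ℓ+r} (x + λ + k)^{n+r}. By the binomial
-- theorem the first sum is W(q_0), by reflection the second term is -(-1)^s W(q_s),
-- and the right-hand side telescopes to W(q_0 - (-1)^s q_s).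

module Submission where

open import Defs
open import Data.Nat.Base as ℕ using (ℕ; zero; suc; _∸_; _!; z≤n; s≤s; _≤_; _<_; NonZero)
open import Data.Nat.Combinatorics using (_C_; k![n∸k]!∣n!)
open import Level using (_⊔_)
open import Algebra.Bundles using (RawRing; CommutativeRing)
import Algebra.Morphism.RingMonomorphism
open import Algebra.Morphism.Structures using (IsRingMonomorphism; module RingMorphisms)
import Algebra.Properties.CommutativeMonoid.Mult
import Algebra.Properties.CommutativeSemigroup
import Algebra.Properties.CommutativeSemiring.Binomial
import Algebra.Properties.CommutativeSemiring.Exp
import Algebra.Properties.Ring
import Algebra.Properties.Semiring.Exp
import Algebra.Properties.Semiring.Mult
import Algebra.Solver.Ring.NaturalCoefficients.Default
open import Algebra.Structures using (IsCommutativeRing)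
open import Data.Integer.Base using (+_)
import Data.Integer.Properties as ℤ
import Data.Integer.Solver
open import Data.List.Base using ([]; _∷_; length)
open import Data.Nat.Combinatorics.Specification using (nCk≡n!/k![n-k]!)
import Data.Nat.DivMod as ℕ
import Data.Nat.Properties as ℕ
import Data.Nat.Solver
open import Data.Product.Base using (_,_)
open import Data.Rational.Base as ℚ using (ℚ; 1ℚ; ½; toℚᵘ)
import Data.Rational.Properties as ℚ
import Data.Rational.Unnormalised.Base as ℚᵘ
import Data.Rational.Unnormalised.Properties as ℚᵘ
open import Function.Base using (_∘_)
open import Relation.Binary.PropositionalEquality as ≡ using (_≡_)

-- Two steps of the overview hide their reason. The sum over k telescopes because q_k(x + 1) =
-- q_{k+1}(x) and x ↦ x + 1 commutes with D^r / r!. Reflection brings in q_s because, once moved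
-- inside F^α(D), the substitution x ↦ α - s - λ - x becomes x ↦ -(x + λ + s). This sends x to -(x +
-- λ + s) and x + λ to -(x + s), so up to sign the two linear factors trade places; hence ℓ and n
-- are exchanged in the second sum. The obstacle is that α is arbitrary: F^α is given by a binomial
-- series, with no exponent laws at hand. Each such law is obtained from a linear differential
-- equation that both sides satisfy. For this the ring needs only inverses of factorials, the
-- hypothesis `inverse-!`, so that the same calculus applies over R[x], where the generating
-- function of the E_n lives.

module Sums {a ℓ} (R : CommutativeRing a ℓ) where
  open CommutativeRing R
  open RingOps rawRing using (∑<)
  open Algebra.Properties.CommutativeSemigroup +-commutativeSemigroup using (interchange)

  ∑-cong : ∀ n (s t : ℕ → Carrier) → (∀ k → s k ≈ t k) → ∑< n s ≈ ∑< n t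
  ∑-cong zero    s t p = refl
  ∑-cong (suc n) s t p = +-cong (p 0) (∑-cong n (s ∘ suc) (t ∘ suc) (p ∘ suc))

  ∑-zero : ∀ n {t : ℕ → Carrier} → (∀ k → t k ≈ 0#) → ∑< n t ≈ 0#
  ∑-zero zero    p = refl
  ∑-zero (suc n) p = trans (+-cong (p 0) (∑-zero n (p ∘ suc))) (+-identityˡ 0#)

  ∑-+ : ∀ n (s t : ℕ → Carrier) → ∑[ k < n ] (s k + t k) ≈ ∑< n s + ∑< n t
  ∑-+ zero    s t = sym (+-identityˡ 0#)
  ∑-+ (suc n) s t = trans (+-congˡ (∑-+ n (s ∘ suc) (t ∘ suc))) (interchange _ _ _ _)

  *-∑ : ∀ n x (t : ℕ → Carrier) → x * ∑< n t ≈ ∑[ k < n ] x * t k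
  *-∑ zero    x t = zeroʳ x
  *-∑ (suc n) x t = trans (distribˡ x (t 0) _) (+-congˡ (*-∑ n x (t ∘ suc)))

  ∑-truncate : ∀ {m n} → m ≤ n → (t : ℕ → Carrier) → (∀ k → m ≤ k → t k ≈ 0#) →
               ∑< n t ≈ ∑< m t
  ∑-truncate {n = n} z≤n t p = ∑-zero n (λ k → p k z≤n)
  ∑-truncate (s≤s m≤n)   t p = +-congˡ (∑-truncate m≤n (t ∘ suc) (λ k m≤k → p (suc k) (s≤s m≤k)))

-- The ring of formal power series.

module SeriesRing {a ℓ} (R : CommutativeRing a ℓ) (fromℚ : ℚ → CommutativeRing.Carrier R) where
  open CommutativeRing R
  open Algebra.Properties.CommutativeSemigroup +-commutativeSemigroup using (x∙yz≈y∙xz; interchange)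
  open Algebra.Solver.Ring.NaturalCoefficients.Default commutativeSemiring
  private module P = PowerSeries rawRing fromℚ
  open P using (Series)
  open import Relation.Binary.Reasoning.Setoid setoid

  private
    *-cong′ : ∀ n {f f′ g g′ : Series} → (∀ k → f k ≈ f′ k) → (∀ k → g k ≈ g′ k) →
              (f P.* g) n ≈ (f′ P.* g′) n
    *-cong′ zero    p q = +-congʳ (*-cong (p 0) (q 0))
    *-cong′ (suc n) p q = +-cong (*-cong (p 0) (q (suc n))) (*-cong′ n (p ∘ suc) q)

    -- Peeling off the first term of the convolution is a computation; peeling off the last one
    -- takes this induction. Commutativity matches the two against each other.
    *-sucʳ : ∀ n (f g : Series) → (f P.* g) (suc n) ≈ f (suc n) * g 0 + (f P.* (g ∘ suc)) n
    *-sucʳ zero    f g = x∙yz≈y∙xz (f 0 * g 1) (f 1 * g 0) 0#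
    *-sucʳ (suc n) f g = trans (+-congˡ (*-sucʳ n (f ∘ suc) g))
      (x∙yz≈y∙xz (f 0 * g (2 ℕ.+ n)) (f (2 ℕ.+ n) * g 0) _)

    *-comm′ : ∀ n (f g : Series) → (f P.* g) n ≈ (g P.* f) n
    *-comm′ zero    f g = +-congʳ (*-comm (f 0) (g 0))
    *-comm′ (suc n) f g = trans
      (+-cong (*-comm (f 0) (g (suc n))) (*-comm′ n (f ∘ suc) g))
      (sym (*-sucʳ n g f))

    *-distribʳ′ : ∀ n (h f g : Series) → ((f P.+ g) P.* h) n ≈ (f P.* h) n + (g P.* h) n
    *-distribʳ′ zero    h f g = trans
      (+-congʳ (distribʳ (h 0) (f 0) (g 0)))
      (trans (+-congˡ (sym (+-identityʳ 0#))) (interchange _ _ _ _))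
    *-distribʳ′ (suc n) h f g = trans
      (+-cong (distribʳ (h (suc n)) (f 0) (g 0)) (*-distribʳ′ n h (f ∘ suc) (g ∘ suc)))
      (interchange _ _ _ _)

    •-* : ∀ n c (f g : Series) → ((c P.• f) P.* g) n ≈ c * (f P.* g) n
    •-* zero    c f g = solve 3 (λ c x y → (c :* x) :* y :+ con 0 := c :* (x :* y :+ con 0)) refl c (f 0) (g 0)
    •-* (suc n) c f g = trans (+-congˡ (•-* n c (f ∘ suc) g))
      (solve 4 (λ c x y z → (c :* x) :* y :+ c :* z := c :* (x :* y :+ z)) refl c (f 0) (g (suc n)) _)

    *-assoc′ : ∀ n (f g h : Series) → ((f P.* g) P.* h) n ≈ (f P.* (g P.* h)) n
    *-assoc′ zero    f g h = solve 3
      (λ x y z → (x :* y :+ con 0) :* z :+ con 0 := x :* (y :* z :+ con 0) :+ con 0) refl (f 0) (g 0) (h 0)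
    *-assoc′ (suc n) f g h = begin
      -- By computation, the tail of `f * g` is `f 0 • (g ∘ suc) + (f ∘ suc) * g`.
      (f P.* g) 0 * h (suc n) + (((f 0 P.• (g ∘ suc)) P.+ ((f ∘ suc) P.* g)) P.* h) n
        ≈⟨ +-congˡ (*-distribʳ′ n h (f 0 P.• (g ∘ suc)) ((f ∘ suc) P.* g)) ⟩
      (f P.* g) 0 * h (suc n) + (((f 0 P.• (g ∘ suc)) P.* h) n + (((f ∘ suc) P.* g) P.* h) n)
        ≈⟨ +-congˡ (+-cong (•-* n (f 0) (g ∘ suc) h) (*-assoc′ n (f ∘ suc) g h)) ⟩
      (f 0 * g 0 + 0#) * h (suc n) + (f 0 * ((g ∘ suc) P.* h) n + ((f ∘ suc) P.* (g P.* h)) n)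
        ≈⟨ solve 5 (λ x y z v w → (x :* y :+ con 0) :* z :+ (x :* v :+ w) := x :* (y :* z :+ v) :+ w) refl
             (f 0) (g 0) (h (suc n)) _ _ ⟩
      f 0 * (g 0 * h (suc n) + ((g ∘ suc) P.* h) n) + ((f ∘ suc) P.* (g P.* h)) n ∎

    0-*′ : ∀ n (g : Series) → ((λ _ → 0#) P.* g) n ≈ 0#
    0-*′ zero    g = trans (+-identityʳ _) (zeroˡ (g 0))
    0-*′ (suc n) g = trans (+-cong (zeroˡ (g (suc n))) (0-*′ n g)) (+-identityʳ 0#)

    *-identityˡ′ : ∀ n (g : Series) → (P.1# P.* g) n ≈ g n
    *-identityˡ′ zero    g = trans (+-identityʳ _) (*-identityˡ (g 0))
    *-identityˡ′ (suc n) g = trans (+-cong (*-identityˡ (g (suc n))) (0-*′ n g)) (+-identityʳ _)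

  -- Opaque, so that unification can decompose products of series.
  opaque
    infixl 7 _⊗_
    _⊗_ : Series → Series → Series
    _⊗_ = P._*_

  opaque
    unfolding _⊗_

    ⊗-isCommutativeRing : IsCommutativeRing (λ (f g : Series) → ∀ n → f n ≈ g n)
                                            P._+_ _⊗_ P.-_ (λ _ → 0#) P.1#
    ⊗-isCommutativeRing = record
      { isRing = record
        { +-isAbelianGroup = record
          { isGroup = record
            { isMonoid = record
              { isSemigroup = record
                { isMagma = record
                  { isEquivalence = record
                    { refl  = λ n → refl
                    ; sym   = λ p n → sym (p n)
                    ; trans = λ p q n → trans (p n) (q n)
                    }
                  ; ∙-cong = λ p q n → +-cong (p n) (q n)
                  }
                ; assoc = λ f g h n → +-assoc (f n) (g n) (h n)
                }
              ; identity = (λ f n → +-identityˡ (f n)) , λ f n → +-identityʳ (f n)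
              }
            ; inverse = (λ f n → -‿inverseˡ (f n)) , λ f n → -‿inverseʳ (f n)
            ; ⁻¹-cong = λ p n → -‿cong (p n)
            }
          ; comm = λ f g n → +-comm (f n) (g n)
          }
        ; *-cong = λ p q n → *-cong′ n p q
        ; *-assoc = λ f g h n → *-assoc′ n f g h
        ; *-identity = (λ g n → *-identityˡ′ n g)
                     , (λ g n → trans (*-comm′ n g P.1#) (*-identityˡ′ n g))
        ; distrib = (λ h f g n → trans (*-comm′ n h (f P.+ g))
                      (trans (*-distribʳ′ n h f g) (+-cong (*-comm′ n f h) (*-comm′ n g h))))
                  , λ h f g n → *-distribʳ′ n h f g
        }
      ; *-comm = λ f g n → *-comm′ n f g
      }

    ⊗-zero : ∀ f g → (f ⊗ g) 0 ≈ f 0 * g 0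
    ⊗-zero f g = +-identityʳ (f 0 * g 0)

    ⊗-sucˡ : ∀ f g n → (f ⊗ g) (suc n) ≈ f 0 * g (suc n) + ((f ∘ suc) ⊗ g) n
    ⊗-sucˡ f g n = refl

    ⊗-sucʳ : ∀ f g n → (f ⊗ g) (suc n) ≈ f (suc n) * g 0 + (f ⊗ (g ∘ suc)) n
    ⊗-sucʳ f g n = *-sucʳ n f g

  seriesRing : CommutativeRing a ℓ
  seriesRing = record { isCommutativeRing = ⊗-isCommutativeRing }

-- Differential calculus of formal power series.

module Calculus {a ℓ} (R : CommutativeRing a ℓ) (fromℚ : ℚ → CommutativeRing.Carrier R)
  (inverse-! : ∀ n → CommutativeRing._≈_ R
    (RingOps._×_ (CommutativeRing.rawRing R) (n !) (fromℚ (1/ n !))) (CommutativeRing.1# R)) where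

  private
    module R where
      open CommutativeRing R public
      open RingOps rawRing public using (_×_; _^_; ∑<)
      open Sums R public
      open Algebra.Properties.Semiring.Mult semiring public
        using (×-congʳ; ×-congˡ; ×-assocˡ; ×-assoc-*; ×-comm-*)
      open Algebra.Properties.CommutativeMonoid.Mult +-commutativeMonoid public using (×-distrib-+)
      open Algebra.Properties.Semiring.Exp semiring public using (^-congˡ)
      open Algebra.Properties.CommutativeSemiring.Exp commutativeSemiring public using (^-distrib-*)
      open Algebra.Properties.Ring ring public using (+-cancelʳ; -1*x≈-x; -0#≈0#)
      open Algebra.Solver.Ring.NaturalCoefficients.Default commutativeSemiring public
        using (solve; con; _:+_; _:*_; _:=_)
      open import Relation.Binary.Reasoning.Setoid setoid public
    open R using (_×_; _^_; ∑<)
    module P = PowerSeries R.rawRing fromℚ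

  open P public using (Series; exp; _⁻¹; _^^_; falling; binomial; 2/[e^t+1])
  open SeriesRing R fromℚ public

  private
    module S where
      open CommutativeRing seriesRing public
      open RingOps rawRing public using (_^_)
      open Algebra.Properties.Ring ring public using (+-cancelʳ)
      open Algebra.Properties.CommutativeSemigroup +-commutativeSemigroup public using (x∙yz≈y∙xz)
      open Algebra.Solver.Ring.NaturalCoefficients.Default commutativeSemiring public
        using (solve; con; _:+_; _:*_; _:=_)
  open S using (_≈_; refl; sym; trans; +-cong; +-congˡ; +-congʳ; *-cong; *-congˡ; *-congʳ;
                *-identityˡ; *-comm; *-assoc)
  open S public using (1#) renaming (_+_ to infixl 6 _⊕_; -_ to infix 8 ⊖_; _^_ to infixr 8 _^ˢ_)
  open import Relation.Binary.Reasoning.Setoid S.setoid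

  private
    -- Only factorials have given inverses, so division by `suc n` goes through (n + 1)! = n! (n +
    -- 1): multiply by n!, then by 1 / (n + 1)!.
    recover : ∀ n x → x R.≈ fromℚ (1/ suc n !) R.* ((n !) × (suc n × x))
    recover n x = let c = fromℚ (1/ suc n !) in R.begin
      x                                  R.≈⟨ R.sym (R.*-identityˡ x) ⟩
      R.1# R.* x                         R.≈⟨ R.*-congʳ (R.sym (inverse-! (suc n))) ⟩
      ((suc n !) × c) R.* x              R.≈⟨ R.×-assoc-* (suc n !) c x ⟩
      (suc n !) × (c R.* x)              R.≈⟨ R.sym (R.×-comm-* (suc n !) c x) ⟩
      c R.* ((suc n !) × x)              R.≈⟨ R.*-congˡ (R.×-congˡ (ℕ.*-comm (suc n) (n !))) ⟩
      c R.* (((n !) ℕ.* suc n) × x)      R.≈⟨ R.*-congˡ (R.sym (R.×-assocˡ x (n !) (suc n))) ⟩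
      c R.* ((n !) × (suc n × x))        R.∎

  ×-cancel : ∀ n x y → suc n × x R.≈ suc n × y → x R.≈ y
  ×-cancel n x y p = R.trans (recover n x)
    (R.trans (R.*-congˡ (R.×-congʳ (n !) p)) (R.sym (recover n y)))

  -- Both sides are inverses of `n !`; the proof is the uniqueness of inverses.
  suc-×-1/! : ∀ n → suc n × fromℚ (1/ suc n !) R.≈ fromℚ (1/ n !)
  suc-×-1/! n = let c = fromℚ (1/ n !); d = suc n × fromℚ (1/ suc n !) in R.begin
    d                                 R.≈⟨ R.sym (R.*-identityˡ d) ⟩
    R.1# R.* d                        R.≈⟨ R.*-congʳ (R.sym (inverse-! n)) ⟩
    ((n !) × c) R.* d                 R.≈⟨ R.×-assoc-* (n !) c d ⟩
    (n !) × (c R.* d)                 R.≈⟨ R.sym (R.×-comm-* (n !) c d) ⟩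
    c R.* ((n !) × d)                 R.≈⟨ R.*-congˡ (R.×-assocˡ _ (n !) (suc n)) ⟩
    c R.* (((n !) ℕ.* suc n) × fromℚ (1/ suc n !))
                                      R.≈⟨ R.*-congˡ (R.×-congˡ (ℕ.*-comm (n !) (suc n))) ⟩
    c R.* ((suc n !) × fromℚ (1/ suc n !))
                                      R.≈⟨ R.*-congˡ (inverse-! (suc n)) ⟩
    c R.* R.1#                        R.≈⟨ R.*-identityʳ c ⟩
    c                                 R.∎

  -- Scalars enter as constant series, so that scaling is a product and falls under the ring laws of
  -- series.
  K : R.Carrier → Series
  K c zero    = c
  K c (suc n) = R.0#

  0-⊗ : ∀ {f} → (∀ n → f n R.≈ R.0#) → ∀ g n → (f ⊗ g) n R.≈ R.0#
  0-⊗ p g n = R.trans (*-congʳ p n) (S.zeroˡ g n)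

  K-⊗ : ∀ c f n → (K c ⊗ f) n R.≈ c R.* f n
  K-⊗ c f zero    = ⊗-zero (K c) f
  K-⊗ c f (suc n) = R.trans (⊗-sucˡ (K c) f n)
    (R.trans (R.+-congˡ (0-⊗ (λ _ → R.refl) f n)) (R.+-identityʳ _))

  K-cong : ∀ {c d} → c R.≈ d → K c ≈ K d
  K-cong p zero    = p
  K-cong p (suc n) = R.refl

  K-+ : ∀ c d → K (c R.+ d) ≈ K c ⊕ K d
  K-+ c d zero    = R.refl
  K-+ c d (suc n) = R.sym (R.+-identityˡ R.0#)

  K-0 : K R.0# ≈ S.0#
  K-0 zero    = R.refl
  K-0 (suc n) = R.refl

  K-1 : K R.1# ≈ 1#
  K-1 zero    = R.refl
  K-1 (suc n) = R.refl

  ⊗-local : ∀ n f {g g′} → (∀ k → k ≤ n → g k R.≈ g′ k) → (f ⊗ g) n R.≈ (f ⊗ g′) n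
  ⊗-local zero    f p = R.trans (⊗-zero f _) (R.trans (R.*-congˡ (p 0 z≤n)) (R.sym (⊗-zero f _)))
  ⊗-local (suc n) f p = R.trans (⊗-sucˡ f _ n) (R.trans
    (R.+-cong (R.*-congˡ (p (suc n) ℕ.≤-refl)) (⊗-local n (f ∘ suc) (λ k k≤n → p k (ℕ.m≤n⇒m≤1+n k≤n))))
    (R.sym (⊗-sucˡ f _ n)))

  private
    0*+ : ∀ {x} y z → x R.≈ R.0# → x R.* y R.+ z R.≈ z
    0*+ y z p = R.trans (R.+-congʳ (R.trans (R.*-congʳ p) (R.zeroˡ y))) (R.+-identityˡ z)

    ⊗-suc-tail : ∀ u g n → u 0 R.≈ R.0# → (u ⊗ g) (suc n) R.≈ ((u ∘ suc) ⊗ g) n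
    ⊗-suc-tail u g n u₀ = R.trans (⊗-sucˡ u g n) (0*+ _ _ u₀)

    ⊗-zero-tail : ∀ u g → u 0 R.≈ R.0# → (u ⊗ g) 0 R.≈ R.0#
    ⊗-zero-tail u g u₀ = R.trans (⊗-zero u g) (R.trans (R.*-congʳ u₀) (R.zeroˡ (g 0)))

  -- A factor divisible by t lets only the coefficients below n through. This makes the inductions
  -- on coefficients in `vanish` and `chain-rule` descend.
  ⊗-local-< : ∀ n u {g g′} → u 0 R.≈ R.0# → (∀ k → k < n → g k R.≈ g′ k) →
              (u ⊗ g) n R.≈ (u ⊗ g′) n
  ⊗-local-< zero    u u₀ p = R.trans (⊗-zero-tail u _ u₀) (R.sym (⊗-zero-tail u _ u₀))
  ⊗-local-< (suc n) u u₀ p = R.trans (⊗-suc-tail u _ n u₀)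
    (R.trans (⊗-local n (u ∘ suc) (λ k k≤n → p k (s≤s k≤n))) (R.sym (⊗-suc-tail u _ n u₀)))

  ⊗-∑ : ∀ m f (c : ℕ → R.Carrier) (g : ℕ → Series) n →
        (f ⊗ (λ j → ∑[ k < m ] c k R.* g k j)) n R.≈ ∑[ k < m ] c k R.* (f ⊗ g k) n
  ⊗-∑ zero    f c g n = S.zeroʳ f n
  ⊗-∑ (suc m) f c g n = R.trans
    (S.distribˡ f (λ j → c 0 R.* g 0 j) (λ j → ∑[ k < m ] c (suc k) R.* g (suc k) j) n)
    (R.+-cong (scalar n) (⊗-∑ m f (c ∘ suc) (g ∘ suc) n))
    where
    scalar : ∀ n → (f ⊗ (λ j → c 0 R.* g 0 j)) n R.≈ c 0 R.* (f ⊗ g 0) n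
    scalar n = R.trans (*-congˡ (λ j → R.sym (K-⊗ (c 0) (g 0) j)) n)
      (R.trans (S.solve 3 (λ x y z → x S.:* (y S.:* z) S.:= y S.:* (x S.:* z)) refl f (K (c 0)) (g 0) n)
        (K-⊗ (c 0) (f ⊗ g 0) n))

  -- t d/dt, next to `δ` = d/dt. It keeps the index in place, so its Leibniz rule goes by induction
  -- on the coefficient; the rule for `δ` is the same one read one place higher.
  θ : Series → Series
  θ f n = n × f n

  δ : Series → Series
  δ f n = suc n × f (suc n)

  private
    θ-⊗ : ∀ n f g → n × (f ⊗ g) n R.≈ (θ f ⊗ g) n R.+ (f ⊗ θ g) n
    θ-⊗ zero    f g = R.sym (R.trans
      (R.+-cong (R.trans (⊗-zero (θ f) g) (R.zeroˡ (g 0))) (R.trans (⊗-zero f (θ g)) (R.zeroʳ (f 0))))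
      (R.+-identityˡ R.0#))
    θ-⊗ (suc n) f g = let f′ = f ∘ suc in R.begin
      suc n × (f ⊗ g) (suc n)
        R.≈⟨ R.×-congʳ (suc n) (⊗-sucˡ f g n) ⟩
      suc n × (f 0 R.* g (suc n) R.+ (f′ ⊗ g) n)
        R.≈⟨ R.×-distrib-+ _ _ (suc n) ⟩
      suc n × (f 0 R.* g (suc n)) R.+ ((f′ ⊗ g) n R.+ n × (f′ ⊗ g) n)
        R.≈⟨ R.+-cong (R.sym (R.×-comm-* (suc n) (f 0) (g (suc n)))) (R.+-congˡ (θ-⊗ n f′ g)) ⟩
      f 0 R.* θ g (suc n) R.+ ((f′ ⊗ g) n R.+ ((θ f′ ⊗ g) n R.+ (f′ ⊗ θ g) n))
        R.≈⟨ R.solve 4 (λ w x y z → w R.:+ (x R.:+ (y R.:+ z))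
                                 R.:= (x R.:+ y) R.:+ (w R.:+ z)) R.refl _ _ _ _ ⟩
      ((f′ ⊗ g) n R.+ (θ f′ ⊗ g) n) R.+ (f 0 R.* θ g (suc n) R.+ (f′ ⊗ θ g) n)
        -- Since `suc k × f′ k = f′ k + k × f′ k`, the tail of `θ f` is `f′ ⊕ θ f′`.
        R.≈⟨ R.+-cong (R.sym (S.distribʳ g f′ (θ f′) n)) (R.sym (⊗-sucˡ f (θ g) n)) ⟩
      ((θ f ∘ suc) ⊗ g) n R.+ (f ⊗ θ g) (suc n)
        R.≈⟨ R.+-congʳ (R.sym (⊗-suc-tail (θ f) g n R.refl)) ⟩
      (θ f ⊗ g) (suc n) R.+ (f ⊗ θ g) (suc n) R.∎

  δ-⊗ : ∀ f g → δ (f ⊗ g) ≈ δ f ⊗ g ⊕ f ⊗ δ g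
  δ-⊗ f g n = R.trans (θ-⊗ (suc n) f g) (R.+-cong (⊗-suc-tail (θ f) g n R.refl)
    (R.trans (⊗-sucʳ f (θ g) n) (R.trans (R.+-congʳ (R.zeroʳ (f (suc n)))) (R.+-identityˡ _))))

  δ-cong : ∀ {f g} → f ≈ g → δ f ≈ δ g
  δ-cong p n = R.×-congʳ (suc n) (p (suc n))

  δ-⊕ : ∀ f g → δ (f ⊕ g) ≈ δ f ⊕ δ g
  δ-⊕ f g n = R.×-distrib-+ (f (suc n)) (g (suc n)) (suc n)

  private
    ×-0 : ∀ n → n × R.0# R.≈ R.0#
    ×-0 zero    = R.refl
    ×-0 (suc n) = R.trans (R.+-identityˡ _) (×-0 n)

  δ-K : ∀ c n → δ (K c) n R.≈ R.0#
  δ-K c n = ×-0 (suc n)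

  -- As `f 0 ≈ 1`, the coefficient of t^n in the equation expresses `suc n × h (suc n)` through the
  -- coefficients of h up to n, and `×-cancel` divides by `suc n`. So the equation is a recursion
  -- that starts from `h 0`.
  ode-unique : ∀ f g {h h′} → f 0 R.≈ R.1# → h 0 R.≈ h′ 0 →
               f ⊗ δ h ≈ g ⊗ h → f ⊗ δ h′ ≈ g ⊗ h′ → h ≈ h′
  ode-unique f g {h} {h′} f₀ h₀ p p′ n = below (suc n) n ℕ.≤-refl
    where
    cancel : ∀ n → (∀ k → k < n → δ h k R.≈ δ h′ k) → (f ⊗ δ h) n R.≈ (f ⊗ δ h′) n → δ h n R.≈ δ h′ n
    cancel zero    q e = R.trans (unit h) (R.trans e (R.sym (unit h′)))
      where
      unit : ∀ h → δ h 0 R.≈ (f ⊗ δ h) 0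
      unit h = R.sym (R.trans (⊗-zero f (δ h)) (R.trans (R.*-congʳ f₀) (R.*-identityˡ _)))
    cancel (suc n) q e = R.trans (R.sym (unit h)) (R.trans
      (R.+-cancelʳ (((f ∘ suc) ⊗ δ h) n) _ _ (R.trans (R.sym (⊗-sucˡ f (δ h) n)) (R.trans e
        (R.trans (⊗-sucˡ f (δ h′) n) (R.+-congˡ (R.sym (⊗-local n (f ∘ suc) (λ k k≤n → q k (s≤s k≤n)))))))))
      (unit h′))
      where
      unit : ∀ h → f 0 R.* δ h (suc n) R.≈ δ h (suc n)
      unit h = R.trans (R.*-congʳ f₀) (R.*-identityˡ _)

    below : ∀ n k → k < n → h k R.≈ h′ k
    below (suc n) zero    _         = h₀
    below (suc n) (suc k) (s≤s k<n) = ×-cancel k _ _ (cancel k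
      (λ j j<k → R.×-congʳ (suc j) (below n (suc j) (ℕ.≤-<-trans j<k k<n)))
      (R.trans (p k) (R.trans (⊗-local k g (λ j j≤k → below n j (ℕ.≤-<-trans j≤k k<n))) (R.sym (p′ k)))))

  -- Composition of power series

  private
    term : (ℕ → R.Carrier) → Series → ℕ → ℕ → R.Carrier
    term c u n k = c k R.* (u ^ˢ k) n

  -- c(u) for `u` without constant term: u^k then starts at t^k or later, and cutting the sum off at
  -- k = n loses nothing. Inverses and powers are the cases of the geometric and the binomial
  -- series.
  comp : (ℕ → R.Carrier) → Series → Series
  comp c u n = ∑< (suc n) (term c u n)

  private
    vanish : ∀ {u} → u 0 R.≈ R.0# → ∀ k j → j < k → (u ^ˢ k) j R.≈ R.0#
    vanish {u} u₀ (suc k) j (s≤s j≤k) = R.trans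
      (⊗-local-< j u u₀ (λ i i<j → vanish u₀ k i (ℕ.<-≤-trans i<j j≤k)))
      (S.zeroʳ u j)

  -- Horner's step. On the right, coefficient j of the inner series is a sum cut off at j, while the
  -- left needs all its terms up to n; the additional ones are zero by `vanish`.
  comp-step : ∀ c {u} → u 0 R.≈ R.0# → comp c u ≈ K (c 0) ⊕ u ⊗ comp (c ∘ suc) u
  comp-step c {u} u₀ n = R.+-cong (head n) (R.sym (R.trans
    (⊗-local-< n u u₀ (λ j j<n → R.sym (R.∑-truncate j<n (λ k → c (suc k) R.* (u ^ˢ k) j) (λ k j<k →
      R.trans (R.*-congˡ (vanish u₀ k j j<k)) (R.zeroʳ _)))))
    (⊗-∑ n u (c ∘ suc) (u ^ˢ_) n)))
    where
    head : ∀ n → c 0 R.* 1# n R.≈ K (c 0) n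
    head zero    = R.*-identityʳ (c 0)
    head (suc n) = R.zeroʳ (c 0)

  comp-cong : ∀ c d u → (∀ k → c k R.≈ d k) → comp c u ≈ comp d u
  comp-cong c d u p n = R.∑-cong (suc n) (term c u n) (term d u n) (λ k → R.*-congʳ (p k))

  comp-+ : ∀ c d u → comp (λ k → c k R.+ d k) u ≈ comp c u ⊕ comp d u
  comp-+ c d u n = R.trans
    (R.∑-cong (suc n) (term (λ k → c k R.+ d k) u n) (λ k → term c u n k R.+ term d u n k)
      (λ k → R.distribʳ _ (c k) (d k)))
    (R.∑-+ (suc n) (term c u n) (term d u n))

  comp-* : ∀ a c u → comp (λ k → a R.* c k) u ≈ K a ⊗ comp c u
  comp-* a c u n = R.trans
    (R.∑-cong (suc n) (term (λ k → a R.* c k) u n) (λ k → a R.* term c u n k) (λ k → R.*-assoc a (c k) _))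
    (R.trans (R.sym (R.*-∑ (suc n) a (term c u n))) (R.sym (K-⊗ a (comp c u) n)))

  -- `θ c` is t c′(t): its head is 0 and its tail is `δ c`.
  comp-θ : ∀ c {u} → u 0 R.≈ R.0# → comp (θ c) u ≈ u ⊗ comp (δ c) u
  comp-θ c {u} u₀ = trans (comp-step (θ c) u₀) (trans (+-congʳ K-0) (S.+-identityˡ _))

  -- Differentiate Horner's step c(u) = c_0 + u d(u), d being the tail of c. In u (d(u))′ the factor
  -- u lowers the index, so the claim for d is needed only below the current coefficient.
  chain-rule : ∀ c {u} → u 0 R.≈ R.0# → δ (comp c u) ≈ comp (δ c) u ⊗ δ u
  chain-rule c {u} u₀ n = below (suc n) c n ℕ.≤-refl
    where
    below : ∀ n c k → k < n → δ (comp c u) k R.≈ (comp (δ c) u ⊗ δ u) k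
    below (suc n) c k (s≤s k≤n) = let c′ = c ∘ suc in R.begin
      δ (comp c u) k
        R.≈⟨ δ-cong (comp-step c u₀) k ⟩
      δ (K (c 0) ⊕ u ⊗ comp c′ u) k
        R.≈⟨ δ-⊕ (K (c 0)) (u ⊗ comp c′ u) k ⟩
      δ (K (c 0)) k R.+ δ (u ⊗ comp c′ u) k
        R.≈⟨ R.trans (R.+-congʳ (δ-K (c 0) k)) (R.+-identityˡ _) ⟩
      δ (u ⊗ comp c′ u) k
        R.≈⟨ δ-⊗ u (comp c′ u) k ⟩
      (δ u ⊗ comp c′ u) k R.+ (u ⊗ δ (comp c′ u)) k
        R.≈⟨ R.+-congˡ (⊗-local-< k u u₀ (λ j j<k → below n c′ j (ℕ.<-≤-trans j<k k≤n))) ⟩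
      (δ u ⊗ comp c′ u ⊕ u ⊗ (comp (δ c′) u ⊗ δ u)) k
        R.≈⟨ S.solve 4 (λ v x u y → v S.:* x S.:+ u S.:* (y S.:* v) S.:= (x S.:+ u S.:* y) S.:* v)
               refl (δ u) (comp c′ u) u (comp (δ c′) u) k ⟩
      ((comp c′ u ⊕ u ⊗ comp (δ c′) u) ⊗ δ u) k
        -- By computation, `δ c k` is `c′ k + θ c′ k`.
        R.≈⟨ *-congʳ (sym (trans (comp-+ c′ (θ c′) u) (+-congˡ (comp-θ c′ u₀)))) k ⟩
      (comp (δ c) u ⊗ δ u) k R.∎

  opaque
    unfolding _⊗_

    ^^≈comp : ∀ f α → f ^^ α ≈ comp (binomial α) (f ⊕ ⊖ 1#)
    ^^≈comp f α n = R.refl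

    ⁻¹≈comp : ∀ f → f ⁻¹ ≈ comp (λ _ → R.1#) (1# ⊕ ⊖ f)
    ⁻¹≈comp f n = R.∑-cong (suc n) (λ k → ((1# ⊕ ⊖ f) ^ˢ k) n) (term (λ _ → R.1#) (1# ⊕ ⊖ f) n) (λ k → R.sym (R.*-identityˡ _))

  private
    minus-one : ∀ f → f 0 R.≈ R.1# → (f ⊕ ⊖ 1#) 0 R.≈ R.0#
    minus-one f f₀ = R.trans (R.+-congʳ f₀) (R.-‿inverseʳ R.1#)

    one-minus : ∀ f → f 0 R.≈ R.1# → (1# ⊕ ⊖ f) 0 R.≈ R.0#
    one-minus f f₀ = R.trans (R.+-congˡ (R.-‿cong f₀)) (R.-‿inverseʳ R.1#)

  -- With u = 1 - f, Horner's step for the geometric series reads 1/f = 1 + u (1/f), and f + u = 1;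
  -- cancel u (1/f).
  ⁻¹-inverse : ∀ f → f 0 R.≈ R.1# → f ⊗ f ⁻¹ ≈ 1#
  ⁻¹-inverse f f₀ = S.+-cancelʳ ((1# ⊕ ⊖ f) ⊗ f ⁻¹) _ _ (begin
    f ⊗ f ⁻¹ ⊕ (1# ⊕ ⊖ f) ⊗ f ⁻¹   ≈⟨ sym (S.distribʳ (f ⁻¹) f (1# ⊕ ⊖ f)) ⟩
    (f ⊕ (1# ⊕ ⊖ f)) ⊗ f ⁻¹        ≈⟨ *-congʳ (trans (S.x∙yz≈y∙xz f 1# (⊖ f)) (trans (+-congˡ (S.-‿inverseʳ f)) (S.+-identityʳ 1#))) ⟩
    1# ⊗ f ⁻¹                      ≈⟨ S.*-identityˡ (f ⁻¹) ⟩
    f ⁻¹                           ≈⟨ ⁻¹≈comp f ⟩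
    comp (λ _ → R.1#) u            ≈⟨ comp-step (λ _ → R.1#) (one-minus f f₀) ⟩
    K R.1# ⊕ u ⊗ comp (λ _ → R.1#) u ≈⟨ +-cong K-1 (*-congˡ (sym (⁻¹≈comp f))) ⟩
    1# ⊕ (1# ⊕ ⊖ f) ⊗ f ⁻¹         ∎)
    where u = 1# ⊕ ⊖ f

  ⁻¹-zero : ∀ f → (f ⁻¹) 0 R.≈ R.1#
  ⁻¹-zero f = R.+-identityʳ R.1#

  -- The equation (1 + t) b′ = α b of the binomial series b, at t^k.
  binomial-rec : ∀ α k → δ (binomial α) k R.+ θ (binomial α) k R.≈ α R.* binomial α k
  binomial-rec α k = let q = fromℚ (1/ k !); x = falling α k; m = k × R.1# in R.begin
    suc k × (fromℚ (1/ suc k !) R.* (x R.* (α R.- m))) R.+ k × (q R.* x)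
      R.≈⟨ R.+-cong (R.sym (R.×-assoc-* (suc k) _ _)) (R.×-congʳ k (R.sym (R.*-identityˡ _))) ⟩
    (suc k × fromℚ (1/ suc k !)) R.* (x R.* (α R.- m)) R.+ k × (R.1# R.* (q R.* x))
      R.≈⟨ R.+-cong (R.*-congʳ (suc-×-1/! k)) (R.sym (R.×-assoc-* k R.1# _)) ⟩
    q R.* (x R.* (α R.- m)) R.+ m R.* (q R.* x)
      R.≈⟨ R.solve 5 (λ q x α m m⁻ → q R.:* (x R.:* (α R.:+ m⁻)) R.:+ m R.:* (q R.:* x)
                       R.:= (α R.:+ (m⁻ R.:+ m)) R.:* (q R.:* x)) R.refl q x α m (R.- m) ⟩
    (α R.+ (R.- m R.+ m)) R.* (q R.* x)
      R.≈⟨ R.*-congʳ (R.trans (R.+-congˡ (R.-‿inverseˡ m)) (R.+-identityʳ α)) ⟩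
    α R.* (q R.* x) R.∎

  ^^-zero : ∀ f α → (f ^^ α) 0 R.≈ R.1#
  ^^-zero f α = R.trans (R.+-identityʳ _) (R.trans (R.*-identityʳ _) (R.trans (R.*-identityʳ _)
    (R.trans (R.sym (R.+-identityʳ _)) (inverse-! 0))))

  -- For f = 1 + u and h = b(u) the chain rule gives f h′ = (1 + u) b′(u) u′, and (1 + u) b′(u) = α
  -- b(u) by `binomial-rec`.
  ^^-ode : ∀ f α → f 0 R.≈ R.1# → f ⊗ δ (f ^^ α) ≈ (K α ⊗ δ f) ⊗ f ^^ α
  ^^-ode f α f₀ = begin
    f ⊗ δ (f ^^ α)                        ≈⟨ *-cong f≈ (trans (δ-cong (^^≈comp f α)) (chain-rule b u₀)) ⟩
    (1# ⊕ u) ⊗ (comp (δ b) u ⊗ δ u)       ≈⟨ S.solve 3 (λ u v w → (S.con 1 S.:+ u) S.:* (v S.:* w) S.:= w S.:* (v S.:+ u S.:* v))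
                                              refl u (comp (δ b) u) (δ u) ⟩
    δ u ⊗ (comp (δ b) u ⊕ u ⊗ comp (δ b) u) ≈⟨ *-cong δu (+-congˡ (sym (comp-θ b u₀))) ⟩
    δ f ⊗ (comp (δ b) u ⊕ comp (θ b) u)   ≈⟨ *-congˡ (sym (comp-+ (δ b) (θ b) u)) ⟩
    δ f ⊗ comp (λ k → δ b k R.+ θ b k) u  ≈⟨ *-congˡ (comp-cong _ (λ k → α R.* b k) u (binomial-rec α)) ⟩
    δ f ⊗ comp (λ k → α R.* b k) u        ≈⟨ *-congˡ (trans (comp-* α b u) (*-congˡ (sym (^^≈comp f α)))) ⟩
    δ f ⊗ (K α ⊗ f ^^ α)                  ≈⟨ S.solve 3 (λ x y z → x S.:* (y S.:* z) S.:= (y S.:* x) S.:* z) refl (δ f) (K α) (f ^^ α) ⟩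
    (K α ⊗ δ f) ⊗ f ^^ α                  ∎
    where
    b = binomial α
    u = f ⊕ ⊖ 1#
    u₀ = minus-one f f₀

    f≈ : f ≈ 1# ⊕ u
    f≈ = sym (trans (S.x∙yz≈y∙xz 1# f (⊖ 1#)) (trans (+-congˡ (S.-‿inverseʳ 1#)) (S.+-identityʳ f)))

    δu : δ u ≈ δ f
    δu n = R.×-congʳ (suc n) (R.trans (R.+-congˡ R.-0#≈0#) (R.+-identityʳ (f (suc n))))

  -- The exponential series

  exp-zero : ∀ c → exp c 0 R.≈ R.1#
  exp-zero c = R.trans (R.*-identityʳ _) (R.trans (R.sym (R.+-identityʳ _)) (inverse-! 0))

  δ-exp : ∀ c → δ (exp c) ≈ K c ⊗ exp c
  δ-exp c n = R.begin
    suc n × (fromℚ (1/ suc n !) R.* (c R.* c ^ n))    R.≈⟨ R.sym (R.×-assoc-* (suc n) _ _) ⟩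
    (suc n × fromℚ (1/ suc n !)) R.* (c R.* c ^ n)    R.≈⟨ R.*-congʳ (suc-×-1/! n) ⟩
    fromℚ (1/ n !) R.* (c R.* c ^ n)                  R.≈⟨ R.solve 3 (λ x y z → x R.:* (y R.:* z) R.:= y R.:* (x R.:* z)) R.refl _ c _ ⟩
    c R.* exp c n                                     R.≈⟨ R.sym (K-⊗ c (exp c) n) ⟩
    (K c ⊗ exp c) n                                   R.∎

  exp-cong : ∀ {c d} → c R.≈ d → exp c ≈ exp d
  exp-cong p n = R.*-congˡ (R.^-congˡ n p)

  exp-0 : exp R.0# ≈ 1#
  exp-0 zero    = exp-zero R.0#
  exp-0 (suc n) = R.trans (R.*-congˡ (R.zeroˡ _)) (R.zeroʳ _)

  -- Both sides solve h′ = (c + d) h with constant term 1.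
  exp-+ : ∀ c d → exp c ⊗ exp d ≈ exp (c R.+ d)
  exp-+ c d = ode-unique 1# (K (c R.+ d)) R.refl
    (R.trans (⊗-zero (exp c) (exp d)) (R.trans (R.*-cong (exp-zero c) (exp-zero d))
      (R.trans (R.*-identityˡ R.1#) (R.sym (exp-zero (c R.+ d))))))
    (begin
      1# ⊗ δ (exp c ⊗ exp d)                              ≈⟨ trans (*-identityˡ _) (δ-⊗ (exp c) (exp d)) ⟩
      δ (exp c) ⊗ exp d ⊕ exp c ⊗ δ (exp d)               ≈⟨ +-cong (*-congʳ (δ-exp c)) (*-congˡ (δ-exp d)) ⟩
      (K c ⊗ exp c) ⊗ exp d ⊕ exp c ⊗ (K d ⊗ exp d)       ≈⟨ S.solve 4 (λ w x y z → (w S.:* x) S.:* y S.:+ x S.:* (z S.:* y)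
                                                                S.:= (w S.:+ z) S.:* (x S.:* y)) refl (K c) (exp c) (exp d) (K d) ⟩
      (K c ⊕ K d) ⊗ (exp c ⊗ exp d)                       ≈⟨ *-congʳ (sym (K-+ c d)) ⟩
      K (c R.+ d) ⊗ (exp c ⊗ exp d)                       ∎)
    (trans (*-identityˡ _) (δ-exp (c R.+ d)))

  -- The substitution t ↦ - t

  ν : Series → Series
  ν f n = (R.- R.1#) ^ n R.* f n

  ν-cong : ∀ {f g} → f ≈ g → ν f ≈ ν g
  ν-cong p n = R.*-congˡ (p n)

  ν-⊕ : ∀ f g → ν (f ⊕ g) ≈ ν f ⊕ ν g
  ν-⊕ f g n = R.distribˡ _ (f n) (g n)

  ν-⊗ : ∀ f g → ν (f ⊗ g) ≈ ν f ⊗ ν g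
  ν-⊗ f g n = go n f g
    where
    go : ∀ n f g → ν (f ⊗ g) n R.≈ (ν f ⊗ ν g) n
    go zero    f g = R.trans (R.*-congˡ (⊗-zero f g)) (R.trans
      (R.solve 2 (λ x y → R.con 1 R.:* (x R.:* y) R.:= (R.con 1 R.:* x) R.:* (R.con 1 R.:* y)) R.refl (f 0) (g 0))
      (R.sym (⊗-zero (ν f) (ν g))))
    go (suc n) f g = let m = R.- R.1#; f′ = f ∘ suc in R.begin
      (m R.* m ^ n) R.* (f ⊗ g) (suc n)
        R.≈⟨ R.*-congˡ (⊗-sucˡ f g n) ⟩
      (m R.* m ^ n) R.* (f 0 R.* g (suc n) R.+ (f′ ⊗ g) n)
        R.≈⟨ R.solve 5 (λ m s x y z → (m R.:* s) R.:* (x R.:* y R.:+ z) R.:= (R.con 1 R.:* x) R.:* ((m R.:* s) R.:* y) R.:+ m R.:* (s R.:* z))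
               R.refl m (m ^ n) (f 0) (g (suc n)) _ ⟩
      (R.1# R.* f 0) R.* ν g (suc n) R.+ m R.* ν (f′ ⊗ g) n
        R.≈⟨ R.+-congˡ (R.*-congˡ (go n f′ g)) ⟩
      (R.1# R.* f 0) R.* ν g (suc n) R.+ m R.* (ν f′ ⊗ ν g) n
        R.≈⟨ R.+-congˡ (R.sym (K-⊗ m _ n)) ⟩
      (R.1# R.* f 0) R.* ν g (suc n) R.+ (K m ⊗ (ν f′ ⊗ ν g)) n
        R.≈⟨ R.+-congˡ (trans (sym (*-assoc (K m) (ν f′) (ν g)))
               (*-congʳ (λ k → R.trans (K-⊗ m (ν f′) k) (R.sym (R.*-assoc m _ _)))) n) ⟩
      (R.1# R.* f 0) R.* ν g (suc n) R.+ ((ν f ∘ suc) ⊗ ν g) n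
        R.≈⟨ R.sym (⊗-sucˡ (ν f) (ν g) n) ⟩
      (ν f ⊗ ν g) (suc n) R.∎

  ν-K : ∀ c → ν (K c) ≈ K c
  ν-K c zero    = R.*-identityˡ c
  ν-K c (suc n) = R.zeroʳ _

  ν-1 : ν 1# ≈ 1#
  ν-1 zero    = R.*-identityˡ R.1#
  ν-1 (suc n) = R.zeroʳ _

  δ-ν : ∀ f → δ (ν f) ≈ K (R.- R.1#) ⊗ ν (δ f)
  δ-ν f n = let m = R.- R.1# in R.sym (R.begin
    (K m ⊗ ν (δ f)) n                                R.≈⟨ K-⊗ m (ν (δ f)) n ⟩
    m R.* (m ^ n R.* (suc n × f (suc n)))            R.≈⟨ R.sym (R.*-assoc m (m ^ n) _) ⟩
    (m R.* m ^ n) R.* (suc n × f (suc n))            R.≈⟨ R.×-comm-* (suc n) _ _ ⟩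
    suc n × ((m R.* m ^ n) R.* f (suc n))            R.∎)

  ν-exp : ∀ c → ν (exp c) ≈ exp (R.- c)
  ν-exp c n = R.begin
    (R.- R.1#) ^ n R.* (fromℚ (1/ n !) R.* c ^ n)    R.≈⟨ R.solve 3 (λ x y z → x R.:* (y R.:* z) R.:= y R.:* (x R.:* z)) R.refl _ _ _ ⟩
    fromℚ (1/ n !) R.* ((R.- R.1#) ^ n R.* c ^ n)    R.≈⟨ R.*-congˡ (R.sym (R.^-distrib-* (R.- R.1#) c n)) ⟩
    fromℚ (1/ n !) R.* ((R.- R.1# R.* c) ^ n)        R.≈⟨ R.*-congˡ (R.^-congˡ n (R.-1*x≈-x c)) ⟩
    exp (R.- c) n                                    R.∎

  -- The powers of 2 / (e^t + 1)

  private
    F G E⁺ : Series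
    F = 2/[e^t+1]
    E⁺ = exp R.1# ⊕ 1#
    G = fromℚ ½ P.• E⁺

    halves : fromℚ ½ R.+ fromℚ ½ R.≈ R.1#
    -- ½ is 1 / 2!, and `2 × x` unfolds to x + (x + 0).
    halves = R.trans (R.+-congˡ (R.sym (R.+-identityʳ _))) (inverse-! 2)

    G≈ : G ≈ K (fromℚ ½) ⊗ E⁺
    G≈ n = R.sym (K-⊗ (fromℚ ½) E⁺ n)

    G₀ : G 0 R.≈ R.1#
    G₀ = R.trans (R.*-congˡ (R.+-congʳ (exp-zero R.1#))) (R.trans (R.distribˡ _ _ _)
      (R.trans (R.+-cong (R.*-identityʳ _) (R.*-identityʳ _)) halves))

    F₀ : F 0 R.≈ R.1#
    F₀ = ⁻¹-zero G

    G⊗F : G ⊗ F ≈ 1#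
    G⊗F = ⁻¹-inverse G G₀

    νG : exp R.1# ⊗ ν G ≈ G
    νG = begin
      exp R.1# ⊗ ν G
        ≈⟨ *-congˡ (trans (ν-cong G≈) (trans (ν-⊗ (K (fromℚ ½)) E⁺) (*-cong (ν-K (fromℚ ½))
             (trans (ν-⊕ (exp R.1#) 1#) (+-cong (ν-exp R.1#) ν-1))))) ⟩
      exp R.1# ⊗ (K (fromℚ ½) ⊗ (exp (R.- R.1#) ⊕ 1#))
        ≈⟨ S.solve 3 (λ x y z → x S.:* (y S.:* (z S.:+ S.con 1)) S.:= y S.:* (x S.:* z S.:+ x)) refl _ _ _ ⟩
      K (fromℚ ½) ⊗ (exp R.1# ⊗ exp (R.- R.1#) ⊕ exp R.1#)
        ≈⟨ *-congˡ (trans (+-congʳ (trans (exp-+ R.1# (R.- R.1#)) (trans (exp-cong (R.-‿inverseʳ R.1#)) exp-0)))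
             (S.+-comm 1# (exp R.1#))) ⟩
      K (fromℚ ½) ⊗ E⁺
        ≈⟨ sym G≈ ⟩
      G ∎

    -- `ν F` is an inverse of `ν G`, and by `νG` so is e^t F.
    νF : ν F ≈ exp R.1# ⊗ F
    νF = begin
      ν F                                ≈⟨ sym (trans (*-congˡ (trans (*-comm F G) G⊗F)) (S.*-identityʳ (ν F))) ⟩
      ν F ⊗ (F ⊗ G)                      ≈⟨ *-congˡ (*-congˡ (sym νG)) ⟩
      ν F ⊗ (F ⊗ (exp R.1# ⊗ ν G))       ≈⟨ S.solve 4 (λ w x y z → w S.:* (x S.:* (y S.:* z)) S.:= (z S.:* w) S.:* (y S.:* x)) refl (ν F) F (exp R.1#) (ν G) ⟩
      (ν G ⊗ ν F) ⊗ (exp R.1# ⊗ F)       ≈⟨ *-congʳ (trans (sym (ν-⊗ G F)) (trans (ν-cong G⊗F) ν-1)) ⟩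
      1# ⊗ (exp R.1# ⊗ F)                ≈⟨ *-identityˡ _ ⟩
      exp R.1# ⊗ F                       ∎

    -- G is 1/F, so this is an exponent law. Both sides solve F h′ = (α - 1) F′ h: for h = F^α G the
    -- derivative of G lowers α by one, because (GF)′ = 0.
    F^^⊗G : ∀ α → F ^^ α ⊗ G ≈ F ^^ (α R.- R.1#)
    F^^⊗G α = ode-unique F (K (α R.- R.1#) ⊗ δ F) F₀
      (R.trans (⊗-zero H G) (R.trans (R.*-cong (^^-zero F α) G₀) (R.trans (R.*-identityˡ R.1#) (R.sym (^^-zero F (α R.- R.1#))))))
      (begin
        F ⊗ δ (H ⊗ G)                                ≈⟨ *-congˡ (δ-⊗ H G) ⟩
        F ⊗ (δ H ⊗ G ⊕ H ⊗ δ G)                      ≈⟨ S.solve 5 (λ F H′ G H G′ → F S.:* (H′ S.:* G S.:+ H S.:* G′) S.:= (F S.:* H′) S.:* G S.:+ H S.:* (G′ S.:* F))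
                                                          refl F (δ H) G H (δ G) ⟩
        -- Split α as (α - 1) + 1: the additional F′ H G joins H G′ F to form H (GF)′, which
        -- vanishes.
        (F ⊗ δ H) ⊗ G ⊕ H ⊗ (δ G ⊗ F)                ≈⟨ +-congʳ (*-congʳ (trans (^^-ode F α F₀) (*-congʳ (*-congʳ split)))) ⟩
        (((K (α R.- R.1#) ⊕ 1#) ⊗ δ F) ⊗ H) ⊗ G ⊕ H ⊗ (δ G ⊗ F)
                                                     ≈⟨ S.solve 6 (λ c F′ H G G′ F → (((c S.:+ S.con 1) S.:* F′) S.:* H) S.:* G S.:+ H S.:* (G′ S.:* F)
                                                          S.:= (c S.:* F′) S.:* (H S.:* G) S.:+ H S.:* (G′ S.:* F S.:+ G S.:* F′))
                                                          refl (K (α R.- R.1#)) (δ F) H G (δ G) F ⟩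
        (K (α R.- R.1#) ⊗ δ F) ⊗ (H ⊗ G) ⊕ H ⊗ (δ G ⊗ F ⊕ G ⊗ δ F)
                                                     ≈⟨ +-congˡ (trans (*-congˡ (trans (sym (δ-⊗ G F)) δ[G⊗F])) (S.zeroʳ H)) ⟩
        (K (α R.- R.1#) ⊗ δ F) ⊗ (H ⊗ G) ⊕ S.0#      ≈⟨ S.+-identityʳ _ ⟩
        (K (α R.- R.1#) ⊗ δ F) ⊗ (H ⊗ G)             ∎)
      (^^-ode F (α R.- R.1#) F₀)
      where
      H = F ^^ α

      split : K α ≈ K (α R.- R.1#) ⊕ 1#
      split = trans (K-cong (R.sym (R.trans (R.+-assoc α _ _) (R.trans (R.+-congˡ (R.-‿inverseˡ R.1#)) (R.+-identityʳ α)))))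
        (trans (K-+ (α R.- R.1#) R.1#) (+-congˡ K-1))

      δ[G⊗F] : δ (G ⊗ F) ≈ S.0#
      δ[G⊗F] n = R.trans (δ-cong (trans G⊗F (sym K-1)) n) (δ-K R.1# n)

  F^^-shift : ∀ α → F ^^ α ⊗ (exp R.1# ⊕ 1#) ≈ F ^^ (α R.- R.1#) ⊕ F ^^ (α R.- R.1#)
  F^^-shift α = sym (begin
    F ^^ (α R.- R.1#) ⊕ F ^^ (α R.- R.1#)      ≈⟨ +-cong H≈ H≈ ⟩
    H ⊗ (K ½′ ⊗ E⁺) ⊕ H ⊗ (K ½′ ⊗ E⁺)          ≈⟨ S.solve 3 (λ h c e → h S.:* (c S.:* e) S.:+ h S.:* (c S.:* e) S.:= (c S.:+ c) S.:* (h S.:* e)) refl H (K ½′) E⁺ ⟩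
    (K ½′ ⊕ K ½′) ⊗ (H ⊗ E⁺)                   ≈⟨ *-congʳ (trans (sym (K-+ ½′ ½′)) (trans (K-cong halves) K-1)) ⟩
    1# ⊗ (H ⊗ E⁺)                              ≈⟨ *-identityˡ _ ⟩
    H ⊗ E⁺                                     ∎)
    where
    H = F ^^ α
    ½′ = fromℚ ½

    H≈ : F ^^ (α R.- R.1#) ≈ H ⊗ (K ½′ ⊗ E⁺)
    H≈ = trans (sym (F^^⊗G α)) (*-congˡ G≈)

  -- Both sides solve F(-t) h′ = α (F(-t))′ h. For F(-t)^α this is the equation of F^α after t ↦ -t,
  -- where each derivative brings one sign. For e^{αt} F^α it follows from F(-t) = e^t F, whose
  -- derivative is e^t F + e^t F′.
  ν-F^^ : ∀ α → ν (F ^^ α) ≈ exp α ⊗ F ^^ α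
  ν-F^^ α = ode-unique (ν F) (K α ⊗ δ (ν F)) (R.trans (R.*-identityˡ _) F₀)
    (R.trans (R.*-identityˡ _) (R.sym (R.trans (⊗-zero (exp α) H)
      (R.trans (R.*-congʳ (exp-zero α)) (R.*-identityˡ _)))))
    (begin
      ν F ⊗ δ (ν H)                  ≈⟨ *-congˡ (δ-ν H) ⟩
      ν F ⊗ (K m ⊗ ν (δ H))          ≈⟨ S.solve 3 (λ x y z → x S.:* (y S.:* z) S.:= y S.:* (x S.:* z)) refl (ν F) (K m) (ν (δ H)) ⟩
      K m ⊗ (ν F ⊗ ν (δ H))          ≈⟨ *-congˡ (trans (sym (ν-⊗ F (δ H))) (ν-cong (^^-ode F α F₀))) ⟩
      K m ⊗ ν ((K α ⊗ δ F) ⊗ H)      ≈⟨ *-congˡ (trans (ν-⊗ (K α ⊗ δ F) H) (*-congʳ (trans (ν-⊗ (K α) (δ F)) (*-congʳ (ν-K α))))) ⟩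
      K m ⊗ ((K α ⊗ ν (δ F)) ⊗ ν H)  ≈⟨ S.solve 4 (λ w x y z → w S.:* ((x S.:* y) S.:* z) S.:= (x S.:* (w S.:* y)) S.:* z) refl (K m) (K α) (ν (δ F)) (ν H) ⟩
      (K α ⊗ (K m ⊗ ν (δ F))) ⊗ ν H  ≈⟨ *-congʳ (*-congˡ (sym (δ-ν F))) ⟩
      (K α ⊗ δ (ν F)) ⊗ ν H          ∎)
    (begin
      ν F ⊗ δ (exp α ⊗ H)
        ≈⟨ *-cong νF (δ-⊗ (exp α) H) ⟩
      (e ⊗ F) ⊗ (δ (exp α) ⊗ H ⊕ exp α ⊗ δ H)
        ≈⟨ *-congˡ (+-congʳ (*-congʳ (δ-exp α))) ⟩
      (e ⊗ F) ⊗ ((K α ⊗ exp α) ⊗ H ⊕ exp α ⊗ δ H)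
        ≈⟨ S.solve 6 (λ e F c a H H′ → (e S.:* F) S.:* ((c S.:* a) S.:* H S.:+ a S.:* H′)
             S.:= (c S.:* (e S.:* F)) S.:* (a S.:* H) S.:+ (e S.:* a) S.:* (F S.:* H′)) refl e F (K α) (exp α) H (δ H) ⟩
      (K α ⊗ (e ⊗ F)) ⊗ (exp α ⊗ H) ⊕ (e ⊗ exp α) ⊗ (F ⊗ δ H)
        ≈⟨ +-congˡ (*-congˡ (^^-ode F α F₀)) ⟩
      (K α ⊗ (e ⊗ F)) ⊗ (exp α ⊗ H) ⊕ (e ⊗ exp α) ⊗ ((K α ⊗ δ F) ⊗ H)
        ≈⟨ S.solve 6 (λ e F c a H F′ → (c S.:* (e S.:* F)) S.:* (a S.:* H) S.:+ (e S.:* a) S.:* ((c S.:* F′) S.:* H)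
             S.:= (c S.:* (e S.:* F S.:+ e S.:* F′)) S.:* (a S.:* H)) refl e F (K α) (exp α) H (δ F) ⟩
      (K α ⊗ (e ⊗ F ⊕ e ⊗ δ F)) ⊗ (exp α ⊗ H)
        ≈⟨ *-congʳ (*-congˡ (sym (trans (δ-cong νF) (trans (δ-⊗ e F) (+-congʳ (*-congʳ δe)))))) ⟩
      (K α ⊗ δ (ν F)) ⊗ (exp α ⊗ H) ∎)
    where
    H = F ^^ α
    m = R.- R.1#
    e = exp R.1#

    δe : δ e ≈ e
    δe = trans (δ-exp R.1#) (trans (*-congʳ K-1) (*-identityˡ e))

-- The polynomial ring.

module PolynomialRing {a ℓ} (R : CommutativeRing a ℓ) (fromℚ : ℚ → CommutativeRing.Carrier R)
  (inverse-! : ∀ n → CommutativeRing._≈_ R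
    (RingOps._×_ (CommutativeRing.rawRing R) (n !) (fromℚ (1/ n !))) (CommutativeRing.1# R)) where

  open Calculus R fromℚ inverse-! public
  private
    module R where
      open CommutativeRing R public
      open Algebra.Properties.Ring ring public using (-0#≈0#)
    module S = CommutativeRing seriesRing
    module Q = Polynomials R.rawRing
  open Q public using (Poly; coeff; const; X; _•_)

  private
    coeff-+ : ∀ p q n → coeff (p Q.+ q) n R.≈ coeff p n R.+ coeff q n
    coeff-+ []      q       n       = R.sym (R.+-identityˡ _)
    coeff-+ (a ∷ p) []      n       = R.sym (R.+-identityʳ _)
    coeff-+ (a ∷ p) (b ∷ q) zero    = R.refl
    coeff-+ (a ∷ p) (b ∷ q) (suc n) = coeff-+ p q n

    coeff-• : ∀ c p n → coeff (c • p) n R.≈ c R.* coeff p n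
    coeff-• c []      n       = R.sym (R.zeroʳ c)
    coeff-• c (a ∷ p) zero    = R.refl
    coeff-• c (a ∷ p) (suc n) = coeff-• c p n

    coeff-neg : ∀ p n → coeff (Q.- p) n R.≈ R.- coeff p n
    coeff-neg []      n       = R.sym R.-0#≈0#
    coeff-neg (a ∷ p) zero    = R.refl
    coeff-neg (a ∷ p) (suc n) = coeff-neg p n

    coeff-* : ∀ p q n → coeff (p Q.* q) n R.≈ (coeff p ⊗ coeff q) n
    coeff-* []      q n       = R.sym (S.zeroˡ (coeff q) n)
    coeff-* (a ∷ p) q zero    = R.trans (coeff-+ (a • q) (R.0# ∷ (p Q.* q)) 0)
      (R.trans (R.+-identityʳ _) (R.trans (coeff-• a q 0) (R.sym (⊗-zero (coeff (a ∷ p)) (coeff q)))))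
    coeff-* (a ∷ p) q (suc n) = R.trans (coeff-+ (a • q) (R.0# ∷ (p Q.* q)) (suc n))
      (R.trans (R.+-cong (coeff-• a q (suc n)) (coeff-* p q n)) (R.sym (⊗-sucˡ (coeff (a ∷ p)) (coeff q) n)))

    coeff-1 : ∀ n → coeff Q.1# n R.≈ 1# n
    coeff-1 zero    = R.refl
    coeff-1 (suc n) = R.refl

    coeff-D : ∀ p n → coeff (Q.D p) n R.≈ δ (coeff p) n
    coeff-D []      n       = R.sym (δ-K R.0# n)
    coeff-D (a ∷ p) zero    = coeff-+ p (R.0# ∷ Q.D p) 0
    coeff-D (a ∷ p) (suc n) = R.trans (coeff-+ p (R.0# ∷ Q.D p) (suc n)) (R.+-congˡ (coeff-D p n))

    act : Series → Poly → Poly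
    act f []      = []
    act f (a ∷ p) = (f 0 R.* a ∷ act f p) Q.+ act (δ f) p

  infix  4 _≋_
  infixl 6 _⊞_
  infixl 7 _⊠_
  infix  8 ⊟_
  infixl 9 _⟨_⟩
  infixr 7 _▹_
  opaque
    _≋_ : Poly → Poly → Set ℓ
    p ≋ q = ∀ n → coeff p n R.≈ coeff q n

    _⊞_ _⊠_ : Poly → Poly → Poly
    _⊞_ = Q._+_
    _⊠_ = Q._*_

    ⊟_ D : Poly → Poly
    ⊟_ = Q.-_
    D = Q.D

    _⟨_⟩ : Poly → Poly → Poly
    _⟨_⟩ = Q._[_]

    -- The action of a power series in t as the differential operator t = d/dx,
    -- defined through the commutation relation f(D) x = x f(D) + f′(D).
    _▹_ : Series → Poly → Poly
    _▹_ = act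

  opaque
    unfolding _≋_

    -- Equality of polynomials is equality of coefficient sequences, so `coeff` embeds them in the
    -- ring of series and the ring laws are inherited.
    ⊞-⊠-isCommutativeRing : IsCommutativeRing _≋_ _⊞_ _⊠_ ⊟_ [] (const R.1#)
    ⊞-⊠-isCommutativeRing = Algebra.Morphism.RingMonomorphism.isCommutativeRing
      {R₁ = Q.rawRing} {R₂ = S.rawRing} {⟦_⟧ = coeff} monomorphism S.isCommutativeRing
      where
      monomorphism : IsRingMonomorphism Q.rawRing S.rawRing coeff
      monomorphism = record
        { isRingHomomorphism = record
          { isSemiringHomomorphism = record
            { isNearSemiringHomomorphism = record
              { +-isMonoidHomomorphism = record
                { isMagmaHomomorphism = record
                  { isRelHomomorphism = record { cong = λ p → p }
                  ; homo = coeff-+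
                  }
                ; ε-homo = λ n → R.refl
                }
              ; *-homo = coeff-*
              }
            ; 1#-homo = coeff-1
            }
          ; -‿homo = coeff-neg
          }
        ; injective = λ p → p
        }

  polynomialRing : CommutativeRing a ℓ
  polynomialRing = record { isCommutativeRing = ⊞-⊠-isCommutativeRing }

  module P where
    open CommutativeRing polynomialRing public
    open RingOps rawRing public using (_×_; _^_; ∑<)
    open Sums polynomialRing public
    open Algebra.Properties.Ring ring public using (-1*x≈-x; -‿involutive; -‿+-comm)
    open Algebra.Properties.CommutativeMonoid.Mult +-commutativeMonoid public using (×-distrib-+)
    open Algebra.Properties.Semiring.Mult semiring public
      using (×-congʳ; ×-congˡ; ×-assocˡ; ×-assoc-*; ×-comm-*)
    open Algebra.Properties.Semiring.Exp semiring public using (^-congˡ; ^-homo-*)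
    open Algebra.Properties.CommutativeSemiring.Exp commutativeSemiring public using (^-distrib-*)
    open Algebra.Solver.Ring.NaturalCoefficients.Default commutativeSemiring public
      using (solve; con; _:+_; _:*_; _:=_)

  open import Relation.Binary.Reasoning.Setoid P.setoid

  opaque
    unfolding _≋_

    ∷-cong : ∀ {a b p q} → a R.≈ b → p ≋ q → a ∷ p ≋ b ∷ q
    ∷-cong a≈b p≋q zero    = a≈b
    ∷-cong a≈b p≋q (suc n) = p≋q n

    ≋-head : ∀ a b p q → a ∷ p ≋ b ∷ q → a R.≈ b
    ≋-head a b p q e = e 0

    ≋-tail : ∀ a b p q → a ∷ p ≋ b ∷ q → p ≋ q
    ≋-tail a b p q e n = e (suc n)

    ∷≋[]-head : ∀ a p → a ∷ p ≋ [] → a R.≈ R.0#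
    ∷≋[]-head a p e = e 0

    ∷≋[]-tail : ∀ a p → a ∷ p ≋ [] → p ≋ []
    ∷≋[]-tail a p e n = e (suc n)

    const-0 : const R.0# ≋ []
    const-0 zero    = R.refl
    const-0 (suc n) = R.refl

    const-+ : ∀ a b → const (a R.+ b) ≋ const a ⊞ const b
    const-+ a b n = R.refl

    const-neg : ∀ a → const (R.- a) ≋ ⊟ const a
    const-neg a n = R.refl

    const-* : ∀ a b → const (a R.* b) ≋ const a ⊠ const b
    const-* a b zero    = R.sym (R.+-identityʳ _)
    const-* a b (suc n) = R.refl

    •≋const : ∀ c p → c • p ≋ const c ⊠ p
    •≋const c p n = R.sym (R.trans (coeff-+ (c • p) (const R.0#) n)
      (R.trans (R.+-congˡ (const-0 n)) (R.+-identityʳ _)))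

    -- Turns a list cell into a ring expression, so that inductions on lists can be closed by ring
    -- identities.
    ∷≋ : ∀ a p → a ∷ p ≋ const a ⊞ X ⊠ p
    ∷≋ a p n = R.sym (R.trans (coeff-+ (const a) (X Q.* p) n)
      (R.trans (R.+-congˡ (X*≋∷ n)) (split n)))
      where
      X*≋∷ : ∀ n → coeff (X Q.* p) n R.≈ coeff (R.0# ∷ p) n
      X*≋∷ n = R.trans (coeff-+ (R.0# • p) _ n) (R.trans (R.+-congʳ (R.trans (coeff-• R.0# p n) (R.zeroˡ _)))
        (R.trans (R.+-identityˡ _) (∷-cong {q = p} R.refl (P.*-identityˡ p) n)))
      split : ∀ n → coeff (const a) n R.+ coeff (R.0# ∷ p) n R.≈ coeff (a ∷ p) n
      split zero    = R.+-identityʳ a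
      split (suc n) = R.+-identityˡ _

    [∷]⊞[∷] : ∀ a b p q → (a ∷ p) ⊞ (b ∷ q) ≡ (a R.+ b) ∷ (p ⊞ q)
    [∷]⊞[∷] a b p q = ≡.refl

    []⟨⟩ : ∀ q → [] ⟨ q ⟩ ≡ []
    []⟨⟩ q = ≡.refl

    ∷⟨⟩ : ∀ a p q → (a ∷ p) ⟨ q ⟩ ≡ const a ⊞ q ⊠ p ⟨ q ⟩
    ∷⟨⟩ a p q = ≡.refl

    ▹[] : ∀ f → f ▹ [] ≡ []
    ▹[] f = ≡.refl

    ▹∷-raw : ∀ f a p → f ▹ (a ∷ p) ≡ (f 0 R.* a ∷ f ▹ p) ⊞ δ f ▹ p
    ▹∷-raw f a p = ≡.refl

    D-cong : ∀ {p q} → p ≋ q → D p ≋ D q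
    D-cong {p} {q} e n = R.trans (coeff-D p n) (R.trans (δ-cong e n) (R.sym (coeff-D q n)))

    D-⊞ : ∀ p q → D (p ⊞ q) ≋ D p ⊞ D q
    D-⊞ p q n = R.trans (coeff-D (p Q.+ q) n) (R.trans (δ-cong (coeff-+ p q) n)
      (R.trans (δ-⊕ (coeff p) (coeff q) n) (R.trans (R.sym (R.+-cong (coeff-D p n) (coeff-D q n)))
      (R.sym (coeff-+ (Q.D p) (Q.D q) n)))))

    D-⊠ : ∀ p q → D (p ⊠ q) ≋ D p ⊠ q ⊞ p ⊠ D q
    D-⊠ p q n = R.trans (coeff-D (p Q.* q) n) (R.trans (δ-cong (coeff-* p q) n)
      (R.trans (δ-⊗ (coeff p) (coeff q) n) (R.sym (R.trans (coeff-+ (Q.D p Q.* q) (p Q.* Q.D q) n)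
        (R.+-cong (R.trans (coeff-* (Q.D p) q n) (S.*-congʳ (coeff-D p) n))
                  (R.trans (coeff-* p (Q.D q) n) (S.*-congˡ (coeff-D q) n)))))))

    D-const : ∀ c → D (const c) ≋ []
    D-const c = const-0

    D-X : D X ≋ const R.1#
    D-X zero = R.+-identityʳ R.1#
    D-X (suc zero) = R.refl
    D-X (suc (suc n)) = R.refl

  -- Power series acting as differential operators.

  ▹∷ : ∀ f a p → f ▹ (a ∷ p) ≋ const (f 0 R.* a) ⊞ X ⊠ (f ▹ p) ⊞ δ f ▹ p
  ▹∷ f a p = P.trans (P.reflexive (▹∷-raw f a p)) (P.+-congʳ (∷≋ (f 0 R.* a) (f ▹ p)))

  ▹-congʳ : ∀ {f g} p → f S.≈ g → f ▹ p ≋ g ▹ p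
  ▹-congʳ {f} {g} []      e = P.reflexive (≡.trans (▹[] f) (≡.sym (▹[] g)))
  ▹-congʳ {f} {g} (a ∷ p) e = P.trans (▹∷ f a p) (P.trans
    (P.+-cong (P.+-cong (∷-cong (R.*-congʳ (e 0)) P.refl) (P.*-congˡ (▹-congʳ p e))) (▹-congʳ p (δ-cong e)))
    (P.sym (▹∷ g a p)))

  -- Trailing zeros are allowed, so a zero polynomial need not be the empty list; `▹-cong` meets
  -- this case when the lists differ in length.
  ▹-zero : ∀ f p → p ≋ [] → f ▹ p ≋ []
  ▹-zero f []      e = P.reflexive (▹[] f)
  ▹-zero f (a ∷ p) e = let p≋0 = ∷≋[]-tail a p e in P.trans (▹∷ f a p) (P.trans
    (P.+-cong (P.+-cong (P.trans (∷-cong (R.trans (R.*-congˡ (∷≋[]-head a p e)) (R.zeroʳ (f 0))) P.refl) const-0)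
      (P.trans (P.*-congˡ (▹-zero f p p≋0)) (P.zeroʳ X))) (▹-zero (δ f) p p≋0))
    (P.trans (P.+-identityʳ _) (P.+-identityʳ [])))

  ▹-cong : ∀ f {p q} → p ≋ q → f ▹ p ≋ f ▹ q
  ▹-cong f {[]}    {q}     e = P.trans (P.reflexive (▹[] f)) (P.sym (▹-zero f q (P.sym e)))
  ▹-cong f {a ∷ p} {[]}    e = P.trans (▹-zero f (a ∷ p) e) (P.sym (P.reflexive (▹[] f)))
  ▹-cong f {a ∷ p} {b ∷ q} e = let p≋q = ≋-tail a b p q e in P.trans (▹∷ f a p) (P.trans
    (P.+-cong (P.+-cong (∷-cong (R.*-congˡ (≋-head a b p q e)) P.refl) (P.*-congˡ (▹-cong f p≋q))) (▹-cong (δ f) p≋q))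
    (P.sym (▹∷ f b q)))

  ▹-⊞ : ∀ f p q → f ▹ (p ⊞ q) ≋ f ▹ p ⊞ f ▹ q
  ▹-⊞ f []      q       = P.trans (▹-cong f (P.+-identityˡ q))
    (P.sym (P.trans (P.+-congʳ (P.reflexive (▹[] f))) (P.+-identityˡ (f ▹ q))))
  ▹-⊞ f (a ∷ p) []      = P.trans (▹-cong f (P.+-identityʳ (a ∷ p)))
    (P.sym (P.trans (P.+-congˡ (P.reflexive (▹[] f))) (P.+-identityʳ (f ▹ (a ∷ p)))))
  ▹-⊞ f (a ∷ p) (b ∷ q) = begin
    f ▹ ((a ∷ p) ⊞ (b ∷ q))
      ≈⟨ P.reflexive (≡.cong (f ▹_) ([∷]⊞[∷] a b p q)) ⟩
    f ▹ (a R.+ b ∷ p ⊞ q)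
      ≈⟨ ▹∷ f (a R.+ b) (p ⊞ q) ⟩
    const (f 0 R.* (a R.+ b)) ⊞ X ⊠ (f ▹ (p ⊞ q)) ⊞ δ f ▹ (p ⊞ q)
      ≈⟨ P.+-cong (P.+-cong (P.trans (∷-cong (R.distribˡ (f 0) a b) P.refl) (const-+ (f 0 R.* a) (f 0 R.* b)))
                    (P.*-congˡ (▹-⊞ f p q))) (▹-⊞ (δ f) p q) ⟩
    (const (f 0 R.* a) ⊞ const (f 0 R.* b)) ⊞ X ⊠ (f ▹ p ⊞ f ▹ q) ⊞ (δ f ▹ p ⊞ δ f ▹ q)
      ≈⟨ P.solve 7 (λ a b x u v w z → (a P.:+ b) P.:+ x P.:* (u P.:+ v) P.:+ (w P.:+ z)
           P.:= (a P.:+ x P.:* u P.:+ w) P.:+ (b P.:+ x P.:* v P.:+ z)) P.refl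
           (const (f 0 R.* a)) (const (f 0 R.* b)) X (f ▹ p) (f ▹ q) (δ f ▹ p) (δ f ▹ q) ⟩
    (const (f 0 R.* a) ⊞ X ⊠ (f ▹ p) ⊞ δ f ▹ p) ⊞ (const (f 0 R.* b) ⊞ X ⊠ (f ▹ q) ⊞ δ f ▹ q)
      ≈⟨ P.sym (P.+-cong (▹∷ f a p) (▹∷ f b q)) ⟩
    f ▹ (a ∷ p) ⊞ f ▹ (b ∷ q) ∎

  ▹-X : ∀ f p → f ▹ (X ⊠ p) ≋ X ⊠ (f ▹ p) ⊞ δ f ▹ p
  ▹-X f p = P.trans (▹-cong f (P.sym (P.trans (∷≋ R.0# p) (P.trans (P.+-congʳ const-0) (P.+-identityˡ (X ⊠ p))))))
    (P.trans (▹∷ f R.0# p) (P.+-congʳ (P.trans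
      (P.+-congʳ (P.trans (∷-cong (R.zeroʳ (f 0)) P.refl) const-0)) (P.+-identityˡ (X ⊠ (f ▹ p))))))

  ▹-const : ∀ f a → f ▹ const a ≋ const (f 0 R.* a)
  ▹-const f a = P.trans (▹∷ f a []) (P.trans
    (P.+-cong (P.+-congˡ (P.trans (P.*-congˡ (P.reflexive (▹[] f))) (P.zeroʳ X))) (P.reflexive (▹[] (δ f))))
    (P.trans (P.+-identityʳ _) (P.+-identityʳ _)))

  ⊕-▹ : ∀ f g p → (f ⊕ g) ▹ p ≋ f ▹ p ⊞ g ▹ p
  ⊕-▹ f g []      = P.trans (P.reflexive (▹[] (f ⊕ g)))
    (P.sym (P.trans (P.+-cong (P.reflexive (▹[] f)) (P.reflexive (▹[] g))) (P.+-identityˡ [])))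
  ⊕-▹ f g (a ∷ p) = begin
    (f ⊕ g) ▹ (a ∷ p)
      ≈⟨ ▹∷ (f ⊕ g) a p ⟩
    const ((f 0 R.+ g 0) R.* a) ⊞ X ⊠ ((f ⊕ g) ▹ p) ⊞ δ (f ⊕ g) ▹ p
      ≈⟨ P.+-cong (P.+-cong (P.trans (∷-cong (R.distribʳ a (f 0) (g 0)) P.refl) (const-+ (f 0 R.* a) (g 0 R.* a)))
           (P.*-congˡ (⊕-▹ f g p))) (P.trans (▹-congʳ p (δ-⊕ f g)) (⊕-▹ (δ f) (δ g) p)) ⟩
    (const (f 0 R.* a) ⊞ const (g 0 R.* a)) ⊞ X ⊠ (f ▹ p ⊞ g ▹ p) ⊞ (δ f ▹ p ⊞ δ g ▹ p)
      ≈⟨ P.solve 7 (λ a b x u v w z → (a P.:+ b) P.:+ x P.:* (u P.:+ v) P.:+ (w P.:+ z)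
           P.:= (a P.:+ x P.:* u P.:+ w) P.:+ (b P.:+ x P.:* v P.:+ z)) P.refl
           (const (f 0 R.* a)) (const (g 0 R.* a)) X (f ▹ p) (g ▹ p) (δ f ▹ p) (δ g ▹ p) ⟩
    (const (f 0 R.* a) ⊞ X ⊠ (f ▹ p) ⊞ δ f ▹ p) ⊞ (const (g 0 R.* a) ⊞ X ⊠ (g ▹ p) ⊞ δ g ▹ p)
      ≈⟨ P.sym (P.+-cong (▹∷ f a p) (▹∷ g a p)) ⟩
    f ▹ (a ∷ p) ⊞ g ▹ (a ∷ p) ∎

  -- The Leibniz rule (fg)′ = f′g + fg′ is exactly what moving x first past g(D) and then past f(D)
  -- produces.
  ⊗-▹ : ∀ f g p → (f ⊗ g) ▹ p ≋ f ▹ g ▹ p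
  ⊗-▹ f g []      = P.trans (P.reflexive (▹[] (f ⊗ g)))
    (P.sym (▹-zero f (g ▹ []) (P.reflexive (▹[] g))))
  ⊗-▹ f g (a ∷ p) = begin
    (f ⊗ g) ▹ (a ∷ p)
      ≈⟨ ▹∷ (f ⊗ g) a p ⟩
    const ((f ⊗ g) 0 R.* a) ⊞ X ⊠ ((f ⊗ g) ▹ p) ⊞ δ (f ⊗ g) ▹ p
      ≈⟨ P.+-cong (P.+-cong (∷-cong (R.trans (R.*-congʳ (⊗-zero f g)) (R.*-assoc (f 0) (g 0) a)) P.refl) (P.*-congˡ (⊗-▹ f g p)))
           (P.trans (▹-congʳ p (δ-⊗ f g)) (P.trans (⊕-▹ (δ f ⊗ g) (f ⊗ δ g) p) (P.+-cong (⊗-▹ (δ f) g p) (⊗-▹ f (δ g) p)))) ⟩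
    const (f 0 R.* (g 0 R.* a)) ⊞ X ⊠ (f ▹ g ▹ p) ⊞ (δ f ▹ g ▹ p ⊞ f ▹ δ g ▹ p)
      ≈⟨ P.trans (P.sym (P.+-assoc _ _ _)) (P.+-congʳ (P.+-assoc _ _ _)) ⟩
    const (f 0 R.* (g 0 R.* a)) ⊞ (X ⊠ (f ▹ g ▹ p) ⊞ δ f ▹ g ▹ p) ⊞ f ▹ δ g ▹ p
      ≈⟨ P.sym (P.+-congʳ (P.+-cong (▹-const f (g 0 R.* a)) (▹-X f (g ▹ p)))) ⟩
    f ▹ const (g 0 R.* a) ⊞ f ▹ (X ⊠ (g ▹ p)) ⊞ f ▹ δ g ▹ p
      ≈⟨ P.sym (P.trans (▹-⊞ f _ _) (P.+-congʳ (▹-⊞ f _ _))) ⟩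
    f ▹ (const (g 0 R.* a) ⊞ X ⊠ (g ▹ p) ⊞ δ g ▹ p)
      ≈⟨ P.sym (▹-cong f (▹∷ g a p)) ⟩
    f ▹ g ▹ (a ∷ p) ∎

  0-▹ : ∀ {f} → (∀ n → f n R.≈ R.0#) → ∀ p → f ▹ p ≋ []
  0-▹ {f} e []      = P.reflexive (▹[] f)
  0-▹ {f} e (a ∷ p) = P.trans (▹∷ f a p) (P.trans
    (P.+-cong (P.+-cong (P.trans (∷-cong (R.trans (R.*-congʳ (e 0)) (R.zeroˡ a)) P.refl) const-0)
      (P.trans (P.*-congˡ (0-▹ e p)) (P.zeroʳ X)))
      (0-▹ (λ n → R.trans (δ-cong {g = K R.0#} (λ n → R.trans (e n) (R.sym (K-0 n))) n) (δ-K R.0# n)) p))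
    (P.trans (P.+-identityʳ _) (P.+-identityʳ [])))

  K-▹ : ∀ c p → K c ▹ p ≋ const c ⊠ p
  K-▹ c []      = P.trans (P.reflexive (▹[] (K c))) (P.sym (P.zeroʳ (const c)))
  K-▹ c (a ∷ p) = begin
    K c ▹ (a ∷ p)
      ≈⟨ ▹∷ (K c) a p ⟩
    const (c R.* a) ⊞ X ⊠ (K c ▹ p) ⊞ δ (K c) ▹ p
      ≈⟨ P.+-cong (P.+-cong (const-* c a) (P.*-congˡ (K-▹ c p))) (0-▹ (δ-K c) p) ⟩
    const c ⊠ const a ⊞ X ⊠ (const c ⊠ p) ⊞ []
      ≈⟨ P.+-identityʳ _ ⟩
    const c ⊠ const a ⊞ X ⊠ (const c ⊠ p)
      ≈⟨ P.solve 4 (λ c a x p → c P.:* a P.:+ x P.:* (c P.:* p) P.:= c P.:* (a P.:+ x P.:* p)) P.refl (const c) (const a) X p ⟩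
    const c ⊠ (const a ⊞ X ⊠ p)
      ≈⟨ P.sym (P.*-congˡ (∷≋ a p)) ⟩
    const c ⊠ (a ∷ p) ∎

  1-▹ : ∀ p → 1# ▹ p ≋ p
  1-▹ p = P.trans (▹-congʳ p (S.sym K-1)) (P.trans (K-▹ R.1# p) (P.*-identityˡ p))

  -- Multiplication by c is the action of `K c`, and series commute.
  ▹-const⊠ : ∀ f c p → f ▹ (const c ⊠ p) ≋ const c ⊠ (f ▹ p)
  ▹-const⊠ f c p = P.trans (▹-cong f (P.sym (K-▹ c p))) (P.trans (P.sym (⊗-▹ f (K c) p))
    (P.trans (▹-congʳ p (S.*-comm f (K c))) (P.trans (⊗-▹ (K c) f p) (K-▹ c (f ▹ p)))))

  D-[] : D [] ≋ []
  D-[] = P.trans (D-cong (P.sym const-0)) (D-const R.0#)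

  D-const⊠ : ∀ c p → D (const c ⊠ p) ≋ const c ⊠ D p
  D-const⊠ c p = P.trans (D-⊠ (const c) p) (P.trans
    (P.+-congʳ (P.trans (P.*-congʳ (D-const c)) (P.zeroˡ p))) (P.+-identityˡ _))

  D-X⊠ : ∀ p → D (X ⊠ p) ≋ p ⊞ X ⊠ D p
  D-X⊠ p = P.trans (D-⊠ X p) (P.+-congʳ (P.trans (P.*-congʳ D-X) (P.*-identityˡ p)))

  D∷ : ∀ a p → D (a ∷ p) ≋ p ⊞ X ⊠ D p
  D∷ a p = P.trans (D-cong (∷≋ a p)) (P.trans (D-⊞ (const a) (X ⊠ p))
    (P.trans (P.+-cong (D-const a) (D-X⊠ p)) (P.+-identityˡ _)))

  -- D(x f(D) p) yields the new term f(D) p, which f(D) applied to D(x p) = p + x D p yields as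
  -- well; the remaining terms agree by induction on `p` for all `f`.
  ▹-D : ∀ f p → D (f ▹ p) ≋ f ▹ D p
  ▹-D f []      = P.trans (D-cong (▹-zero f [] P.refl)) (P.trans D-[] (P.sym (▹-zero f (D []) D-[])))
  ▹-D f (a ∷ p) = begin
    D (f ▹ (a ∷ p))
      ≈⟨ D-cong (▹∷ f a p) ⟩
    D (const (f 0 R.* a) ⊞ X ⊠ (f ▹ p) ⊞ δ f ▹ p)
      ≈⟨ P.trans (D-⊞ _ _) (P.+-congʳ (D-⊞ _ _)) ⟩
    D (const (f 0 R.* a)) ⊞ D (X ⊠ (f ▹ p)) ⊞ D (δ f ▹ p)
      ≈⟨ P.+-cong (P.trans (P.+-cong (D-const _) (D-X⊠ (f ▹ p))) (P.+-identityˡ _)) (▹-D (δ f) p) ⟩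
    f ▹ p ⊞ X ⊠ D (f ▹ p) ⊞ δ f ▹ D p
      ≈⟨ P.trans (P.+-congʳ (P.+-congˡ (P.*-congˡ (▹-D f p)))) (P.+-assoc _ _ _) ⟩
    f ▹ p ⊞ (X ⊠ (f ▹ D p) ⊞ δ f ▹ D p)
      ≈⟨ P.sym (P.+-congˡ (▹-X f (D p))) ⟩
    f ▹ p ⊞ f ▹ (X ⊠ D p)
      ≈⟨ P.sym (▹-⊞ f p (X ⊠ D p)) ⟩
    f ▹ (p ⊞ X ⊠ D p)
      ≈⟨ P.sym (▹-cong f (D∷ a p)) ⟩
    f ▹ D (a ∷ p) ∎

  -- Composition of polynomials

  ∷⟨⟩≋ : ∀ a p q → (a ∷ p) ⟨ q ⟩ ≋ const a ⊞ q ⊠ p ⟨ q ⟩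
  ∷⟨⟩≋ a p q = P.reflexive (∷⟨⟩ a p q)

  ⟨⟩-zero : ∀ p q → p ≋ [] → p ⟨ q ⟩ ≋ []
  ⟨⟩-zero []      q e = P.reflexive ([]⟨⟩ q)
  ⟨⟩-zero (a ∷ p) q e = P.trans (∷⟨⟩≋ a p q) (P.trans
    (P.+-cong (P.trans (∷-cong (∷≋[]-head a p e) P.refl) const-0)
      (P.trans (P.*-congˡ (⟨⟩-zero p q (∷≋[]-tail a p e))) (P.zeroʳ q)))
    (P.+-identityʳ []))

  ⟨⟩-congʳ : ∀ {p p′} q → p ≋ p′ → p ⟨ q ⟩ ≋ p′ ⟨ q ⟩
  ⟨⟩-congʳ {[]}    {p′}     q e = P.trans (P.reflexive ([]⟨⟩ q)) (P.sym (⟨⟩-zero p′ q (P.sym e)))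
  ⟨⟩-congʳ {a ∷ p} {[]}     q e = P.trans (⟨⟩-zero (a ∷ p) q e) (P.sym (P.reflexive ([]⟨⟩ q)))
  ⟨⟩-congʳ {a ∷ p} {b ∷ p′} q e = P.trans (∷⟨⟩≋ a p q) (P.trans
    (P.+-cong (∷-cong (≋-head a b p p′ e) P.refl) (P.*-congˡ (⟨⟩-congʳ q (≋-tail a b p p′ e))))
    (P.sym (∷⟨⟩≋ b p′ q)))

  ⟨⟩-congˡ : ∀ p {q q′} → q ≋ q′ → p ⟨ q ⟩ ≋ p ⟨ q′ ⟩
  ⟨⟩-congˡ []      {q} {q′} e = P.reflexive (≡.trans ([]⟨⟩ q) (≡.sym ([]⟨⟩ q′)))
  ⟨⟩-congˡ (a ∷ p) {q} {q′} e = P.trans (∷⟨⟩≋ a p q)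
    (P.trans (P.+-congˡ (P.*-cong e (⟨⟩-congˡ p e))) (P.sym (∷⟨⟩≋ a p q′)))

  ⟨⟩-⊞ : ∀ p p′ q → (p ⊞ p′) ⟨ q ⟩ ≋ p ⟨ q ⟩ ⊞ p′ ⟨ q ⟩
  ⟨⟩-⊞ []      p′       q = P.trans (⟨⟩-congʳ q (P.+-identityˡ p′))
    (P.sym (P.trans (P.+-congʳ (⟨⟩-zero [] q P.refl)) (P.+-identityˡ _)))
  ⟨⟩-⊞ (a ∷ p) []       q = P.trans (⟨⟩-congʳ q (P.+-identityʳ (a ∷ p)))
    (P.sym (P.trans (P.+-congˡ (⟨⟩-zero [] q P.refl)) (P.+-identityʳ _)))
  ⟨⟩-⊞ (a ∷ p) (b ∷ p′) q = begin
    ((a ∷ p) ⊞ (b ∷ p′)) ⟨ q ⟩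
      ≈⟨ P.reflexive (≡.cong (_⟨ q ⟩) ([∷]⊞[∷] a b p p′)) ⟩
    (a R.+ b ∷ p ⊞ p′) ⟨ q ⟩
      ≈⟨ ∷⟨⟩≋ (a R.+ b) (p ⊞ p′) q ⟩
    const (a R.+ b) ⊞ q ⊠ (p ⊞ p′) ⟨ q ⟩
      ≈⟨ P.+-cong (const-+ a b) (P.*-congˡ (⟨⟩-⊞ p p′ q)) ⟩
    (const a ⊞ const b) ⊞ q ⊠ (p ⟨ q ⟩ ⊞ p′ ⟨ q ⟩)
      ≈⟨ P.solve 5 (λ a b q x y → (a P.:+ b) P.:+ q P.:* (x P.:+ y) P.:= (a P.:+ q P.:* x) P.:+ (b P.:+ q P.:* y))
           P.refl (const a) (const b) q (p ⟨ q ⟩) (p′ ⟨ q ⟩) ⟩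
    (const a ⊞ q ⊠ p ⟨ q ⟩) ⊞ (const b ⊞ q ⊠ p′ ⟨ q ⟩)
      ≈⟨ P.sym (P.+-cong (∷⟨⟩≋ a p q) (∷⟨⟩≋ b p′ q)) ⟩
    (a ∷ p) ⟨ q ⟩ ⊞ (b ∷ p′) ⟨ q ⟩ ∎

  ⟨⟩-const : ∀ c q → const c ⟨ q ⟩ ≋ const c
  ⟨⟩-const c q = P.trans (∷⟨⟩≋ c [] q) (P.trans
    (P.+-congˡ (P.trans (P.*-congˡ (⟨⟩-zero [] q P.refl)) (P.zeroʳ q))) (P.+-identityʳ _))

  ⟨⟩-X⊠ : ∀ p q → (X ⊠ p) ⟨ q ⟩ ≋ q ⊠ p ⟨ q ⟩
  ⟨⟩-X⊠ p q = P.trans (⟨⟩-congʳ q (P.sym (P.trans (∷≋ R.0# p) (P.trans (P.+-congʳ const-0) (P.+-identityˡ (X ⊠ p))))))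
    (P.trans (∷⟨⟩≋ R.0# p q) (P.trans (P.+-congʳ const-0) (P.+-identityˡ _)))

  ⟨⟩-const⊠ : ∀ c p q → (const c ⊠ p) ⟨ q ⟩ ≋ const c ⊠ p ⟨ q ⟩
  ⟨⟩-const⊠ c []      q = P.trans (⟨⟩-zero (const c ⊠ []) q (P.zeroʳ (const c)))
    (P.sym (P.trans (P.*-congˡ (⟨⟩-zero [] q P.refl)) (P.zeroʳ (const c))))
  ⟨⟩-const⊠ c (a ∷ p) q = begin
    (const c ⊠ (a ∷ p)) ⟨ q ⟩
      ≈⟨ ⟨⟩-congʳ q (P.trans (P.*-congˡ (∷≋ a p)) (P.solve 4 (λ c a x p → c P.:* (a P.:+ x P.:* p)
           P.:= c P.:* a P.:+ x P.:* (c P.:* p)) P.refl (const c) (const a) X p)) ⟩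
    (const c ⊠ const a ⊞ X ⊠ (const c ⊠ p)) ⟨ q ⟩
      ≈⟨ ⟨⟩-⊞ (const c ⊠ const a) (X ⊠ (const c ⊠ p)) q ⟩
    (const c ⊠ const a) ⟨ q ⟩ ⊞ (X ⊠ (const c ⊠ p)) ⟨ q ⟩
      ≈⟨ P.+-cong (P.trans (⟨⟩-congʳ q (P.sym (const-* c a))) (P.trans (⟨⟩-const (c R.* a) q) (const-* c a)))
           (P.trans (⟨⟩-X⊠ (const c ⊠ p) q) (P.*-congˡ (⟨⟩-const⊠ c p q))) ⟩
    const c ⊠ const a ⊞ q ⊠ (const c ⊠ p ⟨ q ⟩)
      ≈⟨ P.solve 4 (λ c a x p → c P.:* a P.:+ x P.:* (c P.:* p) P.:= c P.:* (a P.:+ x P.:* p)) P.refl (const c) (const a) q (p ⟨ q ⟩) ⟩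
    const c ⊠ (const a ⊞ q ⊠ p ⟨ q ⟩)
      ≈⟨ P.sym (P.*-congˡ (∷⟨⟩≋ a p q)) ⟩
    const c ⊠ (a ∷ p) ⟨ q ⟩ ∎

  ⟨⟩-⊠ : ∀ p p′ q → (p ⊠ p′) ⟨ q ⟩ ≋ p ⟨ q ⟩ ⊠ p′ ⟨ q ⟩
  ⟨⟩-⊠ []      p′ q = P.trans (⟨⟩-zero ([] ⊠ p′) q (P.zeroˡ p′))
    (P.sym (P.trans (P.*-congʳ (⟨⟩-zero [] q P.refl)) (P.zeroˡ (p′ ⟨ q ⟩))))
  ⟨⟩-⊠ (a ∷ p) p′ q = begin
    ((a ∷ p) ⊠ p′) ⟨ q ⟩
      ≈⟨ ⟨⟩-congʳ q (P.trans (P.*-congʳ (∷≋ a p)) (P.solve 4 (λ a x p r → (a P.:+ x P.:* p) P.:* r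
           P.:= a P.:* r P.:+ x P.:* (p P.:* r)) P.refl (const a) X p p′)) ⟩
    (const a ⊠ p′ ⊞ X ⊠ (p ⊠ p′)) ⟨ q ⟩
      ≈⟨ ⟨⟩-⊞ (const a ⊠ p′) (X ⊠ (p ⊠ p′)) q ⟩
    (const a ⊠ p′) ⟨ q ⟩ ⊞ (X ⊠ (p ⊠ p′)) ⟨ q ⟩
      ≈⟨ P.+-cong (⟨⟩-const⊠ a p′ q) (P.trans (⟨⟩-X⊠ (p ⊠ p′) q) (P.*-congˡ (⟨⟩-⊠ p p′ q))) ⟩
    const a ⊠ p′ ⟨ q ⟩ ⊞ q ⊠ (p ⟨ q ⟩ ⊠ p′ ⟨ q ⟩)
      ≈⟨ P.solve 4 (λ a x p r → a P.:* r P.:+ x P.:* (p P.:* r) P.:= (a P.:+ x P.:* p) P.:* r) P.refl (const a) q (p ⟨ q ⟩) (p′ ⟨ q ⟩) ⟩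
    (const a ⊞ q ⊠ p ⟨ q ⟩) ⊠ p′ ⟨ q ⟩
      ≈⟨ P.sym (P.*-congʳ (∷⟨⟩≋ a p q)) ⟩
    (a ∷ p) ⟨ q ⟩ ⊠ p′ ⟨ q ⟩ ∎

  ⟨⟩-X : ∀ q → X ⟨ q ⟩ ≋ q
  ⟨⟩-X q = P.trans (⟨⟩-congʳ q (P.sym (P.*-identityʳ X))) (P.trans (⟨⟩-X⊠ (const R.1#) q)
    (P.trans (P.*-congˡ (⟨⟩-const R.1# q)) (P.*-identityʳ q)))

  ⟨⟩-assoc : ∀ p q q′ → p ⟨ q ⟩ ⟨ q′ ⟩ ≋ p ⟨ q ⟨ q′ ⟩ ⟩
  ⟨⟩-assoc []      q q′ = P.trans (⟨⟩-zero ([] ⟨ q ⟩) q′ (⟨⟩-zero [] q P.refl)) (P.sym (⟨⟩-zero [] (q ⟨ q′ ⟩) P.refl))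
  ⟨⟩-assoc (a ∷ p) q q′ = P.trans (⟨⟩-congʳ q′ (∷⟨⟩≋ a p q)) (P.trans (⟨⟩-⊞ (const a) (q ⊠ p ⟨ q ⟩) q′)
    (P.trans (P.+-cong (⟨⟩-const a q′) (P.trans (⟨⟩-⊠ q (p ⟨ q ⟩) q′) (P.*-congˡ (⟨⟩-assoc p q q′))))
      (P.sym (∷⟨⟩≋ a p (q ⟨ q′ ⟩)))))

  D-⟨⟩ : ∀ p q → D (p ⟨ q ⟩) ≋ D p ⟨ q ⟩ ⊠ D q
  D-⟨⟩ []      q = P.trans (D-cong (⟨⟩-zero [] q P.refl)) (P.trans D-[]
    (P.sym (P.trans (P.*-congʳ (⟨⟩-zero (D []) q D-[])) (P.zeroˡ (D q)))))
  D-⟨⟩ (a ∷ p) q = begin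
    D ((a ∷ p) ⟨ q ⟩)
      ≈⟨ P.trans (D-cong (∷⟨⟩≋ a p q)) (D-⊞ (const a) (q ⊠ p ⟨ q ⟩)) ⟩
    D (const a) ⊞ D (q ⊠ p ⟨ q ⟩)
      ≈⟨ P.trans (P.+-cong (D-const a) (D-⊠ q (p ⟨ q ⟩))) (P.+-identityˡ _) ⟩
    D q ⊠ p ⟨ q ⟩ ⊞ q ⊠ D (p ⟨ q ⟩)
      ≈⟨ P.+-congˡ (P.*-congˡ (D-⟨⟩ p q)) ⟩
    D q ⊠ p ⟨ q ⟩ ⊞ q ⊠ (D p ⟨ q ⟩ ⊠ D q)
      ≈⟨ P.solve 4 (λ d p q e → d P.:* p P.:+ q P.:* (e P.:* d) P.:= (p P.:+ q P.:* e) P.:* d) P.refl (D q) (p ⟨ q ⟩) q (D p ⟨ q ⟩) ⟩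
    (p ⟨ q ⟩ ⊞ q ⊠ D p ⟨ q ⟩) ⊠ D q
      ≈⟨ P.sym (P.*-congʳ (P.trans (⟨⟩-⊞ p (X ⊠ D p) q) (P.+-congˡ (⟨⟩-X⊠ (D p) q)))) ⟩
    (p ⊞ X ⊠ D p) ⟨ q ⟩ ⊠ D q
      ≈⟨ P.sym (P.*-congʳ (⟨⟩-congʳ q (D∷ a p))) ⟩
    D (a ∷ p) ⟨ q ⟩ ⊠ D q ∎

  -- As e^{ct} has derivative c e^{ct}, the commutation relation becomes e^{cD} x = (x + c) e^{cD},
  -- which is Horner's recursion for substituting x + c.
  exp-▹ : ∀ c p → exp c ▹ p ≋ p ⟨ X ⊞ const c ⟩
  exp-▹ c []      = P.trans (▹-zero (exp c) [] P.refl) (P.sym (⟨⟩-zero [] (X ⊞ const c) P.refl))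
  exp-▹ c (a ∷ p) = begin
    exp c ▹ (a ∷ p)
      ≈⟨ ▹∷ (exp c) a p ⟩
    const (exp c 0 R.* a) ⊞ X ⊠ (exp c ▹ p) ⊞ δ (exp c) ▹ p
      ≈⟨ P.+-cong (P.+-congʳ (∷-cong (R.trans (R.*-congʳ (exp-zero c)) (R.*-identityˡ a)) P.refl))
           (P.trans (▹-congʳ p (δ-exp c)) (P.trans (⊗-▹ (K c) (exp c) p) (K-▹ c (exp c ▹ p)))) ⟩
    const a ⊞ X ⊠ (exp c ▹ p) ⊞ const c ⊠ (exp c ▹ p)
      ≈⟨ P.solve 4 (λ a x c p → a P.:+ x P.:* p P.:+ c P.:* p P.:= a P.:+ (x P.:+ c) P.:* p) P.refl (const a) X (const c) (exp c ▹ p) ⟩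
    const a ⊞ (X ⊞ const c) ⊠ (exp c ▹ p)
      ≈⟨ P.+-congˡ (P.*-congˡ (exp-▹ c p)) ⟩
    const a ⊞ (X ⊞ const c) ⊠ p ⟨ X ⊞ const c ⟩
      ≈⟨ P.sym (∷⟨⟩≋ a p (X ⊞ const c)) ⟩
    (a ∷ p) ⟨ X ⊞ const c ⟩ ∎

  -- Substituting -x for x conjugates D into -D.
  ▹-⟨-X⟩ : ∀ f p → (f ▹ p) ⟨ ⊟ X ⟩ ≋ ν f ▹ p ⟨ ⊟ X ⟩
  ▹-⟨-X⟩ f []      = P.trans (⟨⟩-zero (f ▹ []) (⊟ X) (▹-zero f [] P.refl))
    (P.sym (▹-zero (ν f) ([] ⟨ ⊟ X ⟩) (⟨⟩-zero [] (⊟ X) P.refl)))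
  ▹-⟨-X⟩ f (a ∷ p) = begin
    (f ▹ (a ∷ p)) ⟨ ⊟ X ⟩
      ≈⟨ ⟨⟩-congʳ (⊟ X) (▹∷ f a p) ⟩
    (const (f 0 R.* a) ⊞ X ⊠ (f ▹ p) ⊞ δ f ▹ p) ⟨ ⊟ X ⟩
      ≈⟨ P.trans (⟨⟩-⊞ _ (δ f ▹ p) (⊟ X)) (P.+-congʳ (⟨⟩-⊞ (const (f 0 R.* a)) (X ⊠ (f ▹ p)) (⊟ X))) ⟩
    const (f 0 R.* a) ⟨ ⊟ X ⟩ ⊞ (X ⊠ (f ▹ p)) ⟨ ⊟ X ⟩ ⊞ (δ f ▹ p) ⟨ ⊟ X ⟩
      ≈⟨ P.+-cong (P.+-cong (⟨⟩-const (f 0 R.* a) (⊟ X)) (P.trans (⟨⟩-X⊠ (f ▹ p) (⊟ X)) (P.*-cong (P.sym (P.-1*x≈-x X)) (▹-⟨-X⟩ f p))))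
           (▹-⟨-X⟩ (δ f) p) ⟩
    const (f 0 R.* a) ⊞ (m ⊠ X) ⊠ (ν f ▹ p⁻) ⊞ ν (δ f) ▹ p⁻
      -- The -1 from x ↦ -x and the -1 from (f(-t))′ = -f′(-t) coincide, so `m` factors out of both
      -- terms.
      ≈⟨ P.+-cong (P.+-cong (∷-cong (R.*-congʳ (R.sym (R.*-identityˡ (f 0)))) P.refl) (P.*-assoc m X (ν f ▹ p⁻))) twist ⟩
    const (ν f 0 R.* a) ⊞ m ⊠ (X ⊠ (ν f ▹ p⁻)) ⊞ m ⊠ (δ (ν f) ▹ p⁻)
      ≈⟨ P.trans (P.+-assoc _ _ _) (P.+-congˡ (P.sym (P.distribˡ m _ _))) ⟩
    const (ν f 0 R.* a) ⊞ m ⊠ (X ⊠ (ν f ▹ p⁻) ⊞ δ (ν f) ▹ p⁻)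
      ≈⟨ P.sym (P.+-cong (▹-const (ν f) a) (P.*-congˡ (▹-X (ν f) p⁻))) ⟩
    ν f ▹ const a ⊞ m ⊠ (ν f ▹ (X ⊠ p⁻))
      ≈⟨ P.+-congˡ (P.trans (P.*-congʳ (P.sym (const-neg R.1#))) (P.trans (P.sym (▹-const⊠ (ν f) (R.- R.1#) (X ⊠ p⁻)))
           (▹-cong (ν f) (P.trans (P.*-congʳ (const-neg R.1#)) (P.trans (P.sym (P.*-assoc m X p⁻)) (P.*-congʳ (P.-1*x≈-x X))))))) ⟩
    ν f ▹ const a ⊞ ν f ▹ (⊟ X ⊠ p⁻)
      ≈⟨ P.trans (P.sym (▹-⊞ (ν f) (const a) (⊟ X ⊠ p⁻))) (▹-cong (ν f) (P.sym (∷⟨⟩≋ a p (⊟ X)))) ⟩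
    ν f ▹ (a ∷ p) ⟨ ⊟ X ⟩ ∎
    where
    m = ⊟ const R.1#
    p⁻ = p ⟨ ⊟ X ⟩

    m⊠m : m ⊠ m ≋ const R.1#
    m⊠m = P.trans (P.-1*x≈-x m) (P.-‿involutive (const R.1#))

    twist : ν (δ f) ▹ p⁻ ≋ m ⊠ (δ (ν f) ▹ p⁻)
    twist = P.sym (P.trans (P.*-congˡ (P.trans (▹-congʳ p⁻ (δ-ν f)) (P.trans (⊗-▹ (K (R.- R.1#)) (ν (δ f)) p⁻)
      (P.trans (K-▹ (R.- R.1#) _) (P.*-congʳ (const-neg R.1#))))))
      (P.trans (P.sym (P.*-assoc m m _)) (P.trans (P.*-congʳ m⊠m) (P.*-identityˡ _))))

-- Factorials and binomial coefficients.

nCk*k!*[n∸k]!≡n! : ∀ {n k} → k ≤ n → (n C k) ℕ.* ((k !) ℕ.* ((n ∸ k) !)) ≡ n !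
nCk*k!*[n∸k]!≡n! {n} {k} k≤n = ≡.trans (≡.cong (ℕ._* ((k !) ℕ.* ((n ∸ k) !))) (nCk≡n!/k![n-k]! k≤n))
  (ℕ.m/n*n≡m (k![n∸k]!∣n! k≤n))
  where instance _ = k ℕ.!* (n ∸ k) !≢0

[m+r]Cr*r!*m!≡[m+r]! : ∀ m r → ((m ℕ.+ r) C r) ℕ.* ((r !) ℕ.* (m !)) ≡ (m ℕ.+ r) !
[m+r]Cr*r!*m!≡[m+r]! m r = ≡.trans
  (≡.cong (λ k → ((m ℕ.+ r) C r) ℕ.* ((r !) ℕ.* (k !))) (≡.sym (ℕ.m+n∸n≡m m r)))
  (nCk*k!*[n∸k]!≡n! (ℕ.m≤n+m r m))

-- The step from the r-th to the (r + 1)-st derivative of x^{m+r+1}. Multiplied by m!, both sides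
-- are (m + r + 1)!.
r!*[1+m+r]Cr*[1+m]≡[1+r]!*[m+1+r]C[1+r] : ∀ m r →
  ((r !) ℕ.* ((suc m ℕ.+ r) C r)) ℕ.* suc m ≡ (suc r !) ℕ.* ((m ℕ.+ suc r) C suc r)
r!*[1+m+r]Cr*[1+m]≡[1+r]!*[m+1+r]C[1+r] m r = ℕ.*-cancelʳ-≡ _ _ (m !) {{m ℕ.!≢0}} (begin
  (r !) ℕ.* c ℕ.* suc m ℕ.* (m !)
    ≡⟨ solve 4 (λ x c s y → x :* c :* s :* y := c :* (x :* (s :* y))) ≡.refl (r !) c (suc m) (m !) ⟩
  c ℕ.* ((r !) ℕ.* (suc m !))
    ≡⟨ [m+r]Cr*r!*m!≡[m+r]! (suc m) r ⟩
  (suc m ℕ.+ r) !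
    ≡⟨ ≡.cong _! (≡.sym (ℕ.+-suc m r)) ⟩
  (m ℕ.+ suc r) !
    ≡⟨ ≡.sym ([m+r]Cr*r!*m!≡[m+r]! m (suc r)) ⟩
  c′ ℕ.* ((suc r !) ℕ.* (m !))
    ≡⟨ solve 3 (λ x c y → c :* (x :* y) := x :* c :* y) ≡.refl (suc r !) c′ (m !) ⟩
  (suc r !) ℕ.* c′ ℕ.* (m !) ∎)
  where
  open ≡.≡-Reasoning
  open Data.Nat.Solver.+-*-Solver
  c = (suc m ℕ.+ r) C r
  c′ = (m ℕ.+ suc r) C suc r

module Identities {a ℓ} (R : RawRing a ℓ) (fromℚ : ℚ → RawRing.Carrier R) where
  private module R = RingOps R
  open Polynomials R using (Poly; const; X)

  operations : (Poly → Poly → Set ℓ) → (Poly → Poly → Poly) → (Poly → Poly → Poly) → (Poly → Poly) → RawRing a ℓ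
  operations _≈_ _+_ _*_ -_ = record
    { Carrier = Poly ; _≈_ = _≈_ ; _+_ = _+_ ; _*_ = _*_ ; -_ = -_ ; 0# = [] ; 1# = const R.1# }

  -- The identity as a function of the operations, so that it can be transported
  -- from the opaque operations to the ones they stand for, one operation at a time.
  opaque
    Identity : (Poly → Poly → Set ℓ) → (Poly → Poly → Poly) → (Poly → Poly → Poly) → (Poly → Poly) →
               (Poly → Poly → Poly) → (R.Carrier → ℕ → Poly) → (R.Carrier → Poly → Poly) → (ℕ → Poly → Poly) →
               R.Carrier → R.Carrier → ℕ → ℕ → ℕ → ℕ → Set ℓ
    Identity _≈′_ _+′_ _*′_ -′_ _[_] E Ψ D^ α λ′ ℓ n r s =
      (∑[ k < suc (n ℕ.+ r) ]
        const (λ′ R.^ (n ℕ.+ r ∸ k)) *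
        (((n ℕ.+ r) C k) ℕ.* ((ℓ ℕ.+ k ℕ.+ r) C r)) × E α (ℓ ℕ.+ k))
      + (- 1#) ^ (ℓ ℕ.+ n ℕ.+ r ℕ.+ s ℕ.+ 1) *
        (∑[ k < suc (ℓ ℕ.+ r) ]
          const (λ′ R.^ (ℓ ℕ.+ r ∸ k)) *
          (((ℓ ℕ.+ r) C k) ℕ.* ((n ℕ.+ k ℕ.+ r) C r)) ×
          (E α (n ℕ.+ k) [ const (α R.- s R.× R.1# R.- λ′) - X ]))
      ≈ 2 × Ψ (α R.- R.1#)
          (const (fromℚ (1/ r !)) * D^ r
            (∑[ k < s ]
              (- 1#) ^ k *
              (X + const (k R.× R.1#)) ^ (ℓ ℕ.+ r) *
              (X + const (λ′ R.+ k R.× R.1#)) ^ (n ℕ.+ r)))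
      where
      open RingOps (operations _≈′_ _+′_ _*′_ -′_)
        using (_≈_; _+_; _*_; -_; _-_; 1#; _×_; _^_; ∑<)

-- Euler polynomials and Ψ as values of the action.

module EulerPolynomials {a ℓ} (R : CommutativeRing a ℓ) (fromℚ : ℚ → CommutativeRing.Carrier R)
  (inverse-! : ∀ n → CommutativeRing._≈_ R
    (RingOps._×_ (CommutativeRing.rawRing R) (n !) (fromℚ (1/ n !))) (CommutativeRing.1# R)) where

  open PolynomialRing R fromℚ inverse-!
  private
    module R where
      open CommutativeRing R public
      open RingOps rawRing public using (_×_; _^_)
      open Algebra.Solver.Ring.NaturalCoefficients.Default commutativeSemiring public
        using (solve; con; _:+_; _:*_; _:=_)
    module S = CommutativeRing seriesRing
    module GE = GeneralizedEuler R.rawRing fromℚ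
  open P using (_×_; _^_; ∑<)
  open import Relation.Binary.Reasoning.Setoid P.setoid

  const-cong : ∀ {c d} → c R.≈ d → const c ≋ const d
  const-cong p = ∷-cong p P.refl

  const-× : ∀ n c → const (n R.× c) ≋ n × const c
  const-× zero    c = const-0
  const-× (suc n) c = P.trans (const-+ c (n R.× c)) (P.+-congˡ (const-× n c))

  const-^ : ∀ n c → const (c R.^ n) ≋ const c ^ n
  const-^ zero    c = P.refl
  const-^ (suc n) c = P.trans (const-* c (c R.^ n)) (P.*-congˡ (const-^ n c))

  -- Power series over R[x]

  private
    const-inverse-! : ∀ n → (n !) × const (fromℚ (1/ n !)) ≋ const R.1#
    const-inverse-! n = P.trans (P.sym (const-× (n !) _)) (const-cong (inverse-! n))

    module T where
      private module Q = Calculus polynomialRing (const ∘ fromℚ) const-inverse-!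
      open Q public
      open CommutativeRing Q.seriesRing public using (*-congˡ; *-congʳ; *-commutativeSemigroup)
      open Algebra.Properties.CommutativeSemigroup *-commutativeSemigroup public using (x∙yz≈y∙xz)

  -- The link from the generating function to the action: n! [t^n] f(t) e^{xt} = f(D) x^n. The
  -- t-derivative f′ e^{xt} + x f e^{xt} matches the commutation relation f(D) x = x f(D) + f′(D)
  -- applied to x^n.
  e^xt-coeff : ∀ n f → (n !) × ((const ∘ f) T.⊗ T.exp X) n ≋ f ▹ (X ^ n)
  e^xt-coeff zero    f = P.trans (P.+-identityʳ _) (P.trans (T.⊗-zero (const ∘ f) (T.exp X))
    (P.trans (P.*-congˡ (T.exp-zero X)) (P.trans (P.*-identityʳ (const (f 0)))
    (P.trans (const-cong (R.sym (R.*-identityʳ (f 0)))) (P.sym (▹-const f R.1#))))))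
  e^xt-coeff (suc n) f = begin
    (suc n ℕ.* n !) × (f′ T.⊗ e) (suc n)
      ≈⟨ P.trans (P.×-congˡ (ℕ.*-comm (suc n) (n !))) (P.sym (P.×-assocˡ _ (n !) (suc n))) ⟩
    (n !) × T.δ (f′ T.⊗ e) n
      ≈⟨ P.×-congʳ (n !) (T.δ-⊗ f′ e n) ⟩
    (n !) × ((T.δ f′ T.⊗ e) n ⊞ (f′ T.⊗ T.δ e) n)
      ≈⟨ P.×-distrib-+ _ _ (n !) ⟩
    (n !) × (T.δ f′ T.⊗ e) n ⊞ (n !) × (f′ T.⊗ T.δ e) n
      -- For a series with constant coefficients, the derivative over R[x] is the one over R; on
      -- e^{xt} it multiplies by x.
      ≈⟨ P.+-cong
           (P.×-congʳ (n !) (T.*-congʳ {e} (λ k → P.sym (const-× (suc k) (f (suc k)))) n))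
           (P.×-congʳ (n !) (swap n)) ⟩
    (n !) × ((const ∘ δ f) T.⊗ e) n ⊞ (n !) × (X ⊠ (f′ T.⊗ e) n)
      ≈⟨ P.+-cong (e^xt-coeff n (δ f)) (P.trans (P.sym (P.×-comm-* (n !) X _)) (P.*-congˡ (e^xt-coeff n f))) ⟩
    δ f ▹ (X ^ n) ⊞ X ⊠ (f ▹ (X ^ n))
      ≈⟨ P.trans (P.+-comm _ _) (P.sym (▹-X f (X ^ n))) ⟩
    f ▹ (X ^ suc n) ∎
    where
    f′ = const ∘ f
    e = T.exp X

    swap : ∀ n → (f′ T.⊗ T.δ e) n ≋ X ⊠ (f′ T.⊗ e) n
    swap n = P.trans (T.*-congˡ {f′} (T.δ-exp X) n) (P.trans (T.x∙yz≈y∙xz f′ (T.K X) e n) (T.K-⊗ X (f′ T.⊗ e) n))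

  2/[e^t+1]^_ : R.Carrier → Series
  2/[e^t+1]^ α = 2/[e^t+1] ^^ α

  -- Opaque for the sake of conversion checking only.
  opaque
    E : R.Carrier → ℕ → Poly
    E = GE.E

    Ψ : R.Carrier → Poly → Poly
    Ψ = GE.Ψ

    D^ : ℕ → Poly → Poly
    D^ = GE.D^

  opaque
    unfolding _≋_ SeriesRing._⊗_ E

    E-▹ : ∀ α n → E α n ≋ (2/[e^t+1]^ α) ▹ (X ^ n)
    E-▹ α n = e^xt-coeff n (2/[e^t+1]^ α)

  -- `q` holds the power of X already peeled off the list, so that the induction can shift the
  -- index; `Ψ` is the case q = 1.
  ∑-▹ : ∀ f q p (e : ℕ → Poly) → (∀ n → e n ≋ f ▹ (q ⊠ X ^ n)) →
        ∑< (length p) (λ n → coeff p n • e n) ≋ f ▹ (q ⊠ p)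
  ∑-▹ f q []      e e≋ = P.sym (▹-zero f (q ⊠ []) (P.zeroʳ q))
  ∑-▹ f q (c ∷ p) e e≋ = begin
    c • e 0 ⊞ ∑< (length p) (λ n → coeff p n • e (suc n))
      ≈⟨ P.+-cong (P.trans (•≋const c (e 0)) (P.*-congˡ (e≋ 0)))
           (∑-▹ f (q ⊠ X) p (e ∘ suc) (λ n → P.trans (e≋ (suc n)) (▹-cong f (P.sym (P.*-assoc q X (X ^ n)))))) ⟩
    const c ⊠ (f ▹ (q ⊠ const R.1#)) ⊞ f ▹ (q ⊠ X ⊠ p)
      ≈⟨ P.+-congʳ (P.sym (▹-const⊠ f c (q ⊠ const R.1#))) ⟩
    f ▹ (const c ⊠ (q ⊠ const R.1#)) ⊞ f ▹ (q ⊠ X ⊠ p)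
      ≈⟨ P.sym (▹-⊞ f _ _) ⟩
    f ▹ (const c ⊠ (q ⊠ const R.1#) ⊞ q ⊠ X ⊠ p)
      ≈⟨ ▹-cong f (P.trans (P.+-congʳ (P.*-congˡ (P.*-identityʳ q)))
           (P.trans (P.solve 4 (λ c q x p → c P.:* q P.:+ q P.:* x P.:* p P.:= q P.:* (c P.:+ x P.:* p)) P.refl (const c) q X p)
             (P.*-congˡ (P.sym (∷≋ c p))))) ⟩
    f ▹ (q ⊠ (c ∷ p)) ∎

  opaque
    unfolding _≋_ E

    Ψ≋∑ : ∀ α p → Ψ α p ≋ ∑[ n < length p ] coeff p n • E α n
    Ψ≋∑ α p n = R.refl

  Ψ-▹ : ∀ α p → Ψ α p ≋ (2/[e^t+1]^ α) ▹ p
  Ψ-▹ α p = P.trans (Ψ≋∑ α p) (P.trans (∑-▹ (2/[e^t+1]^ α) (const R.1#) p (E α)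
    (λ n → P.trans (E-▹ α n) (▹-cong _ (P.sym (P.*-identityˡ (X ^ n))))))
    (▹-cong _ (P.*-identityˡ p)))

  2×Ψ-▹ : ∀ α p → 2 × Ψ (α R.- R.1#) p ≋ (2/[e^t+1]^ α) ▹ (exp R.1# ▹ p ⊞ p)
  2×Ψ-▹ α p = begin
    2 × Ψ (α R.- R.1#) p
      ≈⟨ P.trans (P.×-congʳ 2 (Ψ-▹ (α R.- R.1#) p)) (P.+-congˡ (P.+-identityʳ _)) ⟩
    H′ ▹ p ⊞ H′ ▹ p
      ≈⟨ P.trans (P.sym (⊕-▹ H′ H′ p)) (▹-congʳ p (S.sym (F^^-shift α))) ⟩
    (H ⊗ (exp R.1# ⊕ 1#)) ▹ p
      ≈⟨ P.trans (⊗-▹ H (exp R.1# ⊕ 1#) p) (▹-cong H (P.trans (⊕-▹ (exp R.1#) 1# p) (P.+-congˡ (1-▹ p)))) ⟩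
    H ▹ (exp R.1# ▹ p ⊞ p) ∎
    where
    H = 2/[e^t+1]^ α
    H′ = 2/[e^t+1]^ (α R.- R.1#)

  -- R-linear endomorphisms of R[x]

  record IsLinear (Φ : Poly → Poly) : Set (a ⊔ ℓ) where
    field
      cong    : ∀ {p q} → p ≋ q → Φ p ≋ Φ q
      ⊞-homo  : ∀ p q → Φ (p ⊞ q) ≋ Φ p ⊞ Φ q
      const-⊠ : ∀ c p → Φ (const c ⊠ p) ≋ const c ⊠ Φ p

    0-homo : Φ [] ≋ []
    0-homo = P.trans (cong (P.sym (P.zeroʳ (const R.0#)))) (P.trans (const-⊠ R.0# [])
      (P.trans (P.*-congʳ const-0) (P.zeroˡ (Φ []))))

    ×-homo : ∀ n p → Φ (n × p) ≋ n × Φ p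
    ×-homo zero    p = 0-homo
    ×-homo (suc n) p = P.trans (⊞-homo p (n × p)) (P.+-congˡ (×-homo n p))

    ∑-homo : ∀ n (t : ℕ → Poly) → Φ (∑< n t) ≋ ∑< n (Φ ∘ t)
    ∑-homo zero    t = 0-homo
    ∑-homo (suc n) t = P.trans (⊞-homo (t 0) _) (P.+-congˡ (∑-homo n (t ∘ suc)))

    -- The signs of the theorem are powers of the negated polynomial `⊟ const 1#`, not of
    -- `const (- 1#)`, so they need a passage to `const-⊠` of their own.
    ⊟1-⊠ : ∀ p → Φ (⊟ const R.1# ⊠ p) ≋ ⊟ const R.1# ⊠ Φ p
    ⊟1-⊠ p = P.trans (cong (P.*-congʳ (P.sym (const-neg R.1#))))
      (P.trans (const-⊠ (R.- R.1#) p) (P.*-congʳ (const-neg R.1#)))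

    ⊟-homo : ∀ p → Φ (⊟ p) ≋ ⊟ Φ p
    ⊟-homo p = P.trans (cong (P.sym (P.-1*x≈-x p))) (P.trans (⊟1-⊠ p) (P.-1*x≈-x (Φ p)))

    ⊟1^-⊠ : ∀ n p → Φ ((⊟ const R.1#) ^ n ⊠ p) ≋ (⊟ const R.1#) ^ n ⊠ Φ p
    ⊟1^-⊠ zero    p = P.trans (cong (P.*-identityˡ p)) (P.sym (P.*-identityˡ (Φ p)))
    ⊟1^-⊠ (suc n) p = P.trans (cong (P.*-assoc (⊟ const R.1#) _ p)) (P.trans (⊟1-⊠ _)
      (P.trans (P.*-congˡ (⊟1^-⊠ n p)) (P.sym (P.*-assoc (⊟ const R.1#) _ (Φ p)))))

    -- The common shape of both sums of the theorem, with `e k` an Euler polynomial, reflected or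
    -- not, and Φ the operator that makes it from a power of X.
    ∑-weighted : ∀ n (c : ℕ → R.Carrier) (m : ℕ → ℕ) (e x : ℕ → Poly) → (∀ k → e k ≋ Φ (x k)) →
                 ∑[ k < n ] const (c k) ⊠ m k × e k ≋ Φ (∑[ k < n ] const (c k) ⊠ m k × x k)
    ∑-weighted n c m e x e≋ = P.sym (P.trans (∑-homo n (λ k → const (c k) ⊠ m k × x k))
      (P.∑-cong n _ (λ k → const (c k) ⊠ m k × e k) (λ k → P.trans (const-⊠ (c k) _)
        (P.*-congˡ (P.trans (×-homo (m k) (x k)) (P.×-congʳ (m k) (P.sym (e≋ k))))))))

  ▹-linear : ∀ f → IsLinear (f ▹_)
  ▹-linear f = record { cong = ▹-cong f ; ⊞-homo = ▹-⊞ f ; const-⊠ = ▹-const⊠ f }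

  ⟨⟩-linear : ∀ q → IsLinear (_⟨ q ⟩)
  ⟨⟩-linear q = record { cong = ⟨⟩-congʳ q ; ⊞-homo = λ p p′ → ⟨⟩-⊞ p p′ q ; const-⊠ = λ c p → ⟨⟩-const⊠ c p q }

  ⊠-linear : ∀ q → IsLinear (q ⊠_)
  ⊠-linear q = record
    { cong = P.*-congˡ
    ; ⊞-homo = P.distribˡ q
    ; const-⊠ = λ c p → P.solve 3 (λ q c p → q P.:* (c P.:* p) P.:= c P.:* (q P.:* p)) P.refl q (const c) p
    }

  ∘-linear : ∀ {Φ Θ} → IsLinear Φ → IsLinear Θ → IsLinear (Φ ∘ Θ)
  ∘-linear {Φ} {Θ} φ θ = record
    { cong = λ p → Φ.cong (Θ.cong p)
    ; ⊞-homo = λ p q → P.trans (Φ.cong (Θ.⊞-homo p q)) (Φ.⊞-homo (Θ p) (Θ q))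
    ; const-⊠ = λ c p → P.trans (Φ.cong (Θ.const-⊠ c p)) (Φ.const-⊠ c (Θ p))
    }
    where
    module Φ = IsLinear φ
    module Θ = IsLinear θ

  ≗-linear : ∀ {Φ Θ} → (∀ p → Φ p ≡ Θ p) → IsLinear Φ → IsLinear Θ
  ≗-linear {Φ} {Θ} e φ = record
    { cong = λ {p} {q} p≋q → P.trans (P.sym (e≋ p)) (P.trans (Φ.cong p≋q) (e≋ q))
    ; ⊞-homo = λ p q → P.trans (P.sym (e≋ (p ⊞ q))) (P.trans (Φ.⊞-homo p q) (P.+-cong (e≋ p) (e≋ q)))
    ; const-⊠ = λ c p → P.trans (P.sym (e≋ (const c ⊠ p))) (P.trans (Φ.const-⊠ c p) (P.*-congˡ (e≋ p)))
    }
    where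
    module Φ = IsLinear φ

    e≋ : ∀ p → Φ p ≋ Θ p
    e≋ p = P.reflexive (e p)

  opaque
    unfolding _≋_ E

    D^-zero : ∀ p → D^ 0 p ≡ p
    D^-zero p = ≡.refl

    D^-suc : ∀ r p → D^ (suc r) p ≡ D (D^ r p)
    D^-suc r p = ≡.refl

  D-linear : IsLinear D
  D-linear = record { cong = D-cong ; ⊞-homo = D-⊞ ; const-⊠ = D-const⊠ }

  D^-linear : ∀ r → IsLinear (D^ r)
  D^-linear zero    = ≗-linear (λ p → ≡.sym (D^-zero p))
    (record { cong = λ p → p ; ⊞-homo = λ _ _ → P.refl ; const-⊠ = λ _ _ → P.refl })
  D^-linear (suc r) = ≗-linear (λ p → ≡.sym (D^-suc r p)) (∘-linear D-linear (D^-linear r))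

  ▹-D^ : ∀ f r p → f ▹ D^ r p ≋ D^ r (f ▹ p)
  ▹-D^ f zero    p = P.reflexive (≡.trans (≡.cong (f ▹_) (D^-zero p)) (≡.sym (D^-zero (f ▹ p))))
  ▹-D^ f (suc r) p = P.trans (▹-cong f (P.reflexive (D^-suc r p))) (P.trans (P.sym (▹-D f (D^ r p)))
    (P.trans (D-cong (▹-D^ f r p)) (P.reflexive (≡.sym (D^-suc r (f ▹ p))))))

  -- Divided derivatives D^r / r!.

  D-X^ : ∀ m → D (X ^ suc m) ≋ suc m × X ^ m
  D-X^ zero    = P.trans (D-cong (P.*-identityʳ X)) (P.trans D-X (P.sym (P.+-identityʳ _)))
  D-X^ (suc m) = P.trans (D-X⊠ (X ^ suc m)) (P.+-congˡ (P.trans (P.*-congˡ (D-X^ m)) (P.×-comm-* (suc m) X (X ^ m))))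

  D^-X^ : ∀ r m → D^ r (X ^ (m ℕ.+ r)) ≋ ((r !) ℕ.* ((m ℕ.+ r) C r)) × X ^ m
  D^-X^ zero    m = P.trans (P.reflexive (D^-zero _)) (P.trans (P.reflexive (≡.cong (X ^_) (ℕ.+-identityʳ m))) (P.sym (P.+-identityʳ (X ^ m))))
  D^-X^ (suc r) m = begin
    D^ (suc r) (X ^ (m ℕ.+ suc r))
      ≈⟨ P.reflexive (D^-suc r _) ⟩
    D (D^ r (X ^ (m ℕ.+ suc r)))
      ≈⟨ D-cong (P.reflexive (≡.cong (λ k → D^ r (X ^ k)) (ℕ.+-suc m r))) ⟩
    D (D^ r (X ^ (suc m ℕ.+ r)))
      ≈⟨ D-cong (D^-X^ r (suc m)) ⟩
    D (c × X ^ suc m)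
      ≈⟨ P.trans (IsLinear.×-homo D-linear c (X ^ suc m)) (P.×-congʳ c (D-X^ m)) ⟩
    c × (suc m × X ^ m)
      ≈⟨ P.trans (P.×-assocˡ (X ^ m) c (suc m)) (P.×-congˡ (r!*[1+m+r]Cr*[1+m]≡[1+r]!*[m+1+r]C[1+r] m r)) ⟩
    ((suc r !) ℕ.* ((m ℕ.+ suc r) C suc r)) × X ^ m ∎
    where c = (r !) ℕ.* ((suc m ℕ.+ r) C r)

  D^/! : ℕ → Poly → Poly
  D^/! r p = const (fromℚ (1/ r !)) ⊠ D^ r p

  D^/!-linear : ∀ r → IsLinear (D^/! r)
  D^/!-linear r = ∘-linear (⊠-linear (const (fromℚ (1/ r !)))) (D^-linear r)

  D^/!-X^ : ∀ r m → D^/! r (X ^ (m ℕ.+ r)) ≋ ((m ℕ.+ r) C r) × X ^ m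
  D^/!-X^ r m = begin
    κ ⊠ D^ r (X ^ (m ℕ.+ r))             ≈⟨ P.*-congˡ (D^-X^ r m) ⟩
    κ ⊠ ((r !) ℕ.* c) × X ^ m            ≈⟨ P.*-congˡ (P.sym (P.×-assocˡ (X ^ m) (r !) c)) ⟩
    κ ⊠ (r !) × (c × X ^ m)              ≈⟨ P.×-comm-* (r !) κ (c × X ^ m) ⟩
    (r !) × (κ ⊠ c × X ^ m)              ≈⟨ P.sym (P.×-assoc-* (r !) κ (c × X ^ m)) ⟩
    ((r !) × κ) ⊠ c × X ^ m              ≈⟨ P.*-congʳ (const-inverse-! r) ⟩
    const R.1# ⊠ c × X ^ m               ≈⟨ P.*-identityˡ (c × X ^ m) ⟩
    c × X ^ m                            ∎
    where
    κ = const (fromℚ (1/ r !))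
    c = (m ℕ.+ r) C r

  -- One binomial coefficient comes from expanding (x + c)^N, the other from D^r / r! applied to
  -- x^{ℓ+k+r}. Both sums of the theorem are cases of this, the second with ℓ and n exchanged.
  D^/!-binomial : ∀ ℓ N r c →
    ∑[ k < suc N ] const (c R.^ (N ∸ k)) ⊠ ((N C k) ℕ.* ((ℓ ℕ.+ k ℕ.+ r) C r)) × X ^ (ℓ ℕ.+ k)
      ≋ D^/! r (X ^ (ℓ ℕ.+ r) ⊠ (X ⊞ const c) ^ N)
  D^/!-binomial ℓ N r c = P.sym (begin
    Φ ((X ⊞ const c) ^ N)
      ≈⟨ Φ.cong (Algebra.Properties.CommutativeSemiring.Binomial.theorem P.commutativeSemiring N X (const c)) ⟩
    Φ (∑[ k < suc N ] (N C k) × (X ^ k ⊠ const c ^ (N ∸ k)))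
      ≈⟨ Φ.∑-homo (suc N) (λ k → (N C k) × (X ^ k ⊠ const c ^ (N ∸ k))) ⟩
    ∑[ k < suc N ] Φ ((N C k) × (X ^ k ⊠ const c ^ (N ∸ k)))
      ≈⟨ P.∑-cong (suc N) (λ k → Φ ((N C k) × (X ^ k ⊠ const c ^ (N ∸ k))))
           (λ k → const (c R.^ (N ∸ k)) ⊠ ((N C k) ℕ.* ((ℓ ℕ.+ k ℕ.+ r) C r)) × X ^ (ℓ ℕ.+ k)) summand ⟩
    ∑[ k < suc N ] const (c R.^ (N ∸ k)) ⊠ ((N C k) ℕ.* ((ℓ ℕ.+ k ℕ.+ r) C r)) × X ^ (ℓ ℕ.+ k) ∎)
    where
    Φ : Poly → Poly
    Φ p = D^/! r (X ^ (ℓ ℕ.+ r) ⊠ p)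

    module Φ = IsLinear (∘-linear (D^/!-linear r) (⊠-linear (X ^ (ℓ ℕ.+ r))))

    Φ-X^ : ∀ k → Φ (X ^ k) ≋ ((ℓ ℕ.+ k ℕ.+ r) C r) × X ^ (ℓ ℕ.+ k)
    Φ-X^ k = P.trans (IsLinear.cong (D^/!-linear r) (P.trans (P.sym (P.^-homo-* X (ℓ ℕ.+ r) k))
      (P.reflexive (≡.cong (X ^_) (ℓ+r+k≡ℓ+k+r)))))
      (D^/!-X^ r (ℓ ℕ.+ k))
      where
      ℓ+r+k≡ℓ+k+r : ℓ ℕ.+ r ℕ.+ k ≡ ℓ ℕ.+ k ℕ.+ r
      ℓ+r+k≡ℓ+k+r = ≡.trans (ℕ.+-assoc ℓ r k) (≡.trans (≡.cong (ℓ ℕ.+_) (ℕ.+-comm r k)) (≡.sym (ℕ.+-assoc ℓ k r)))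

    summand : ∀ k → Φ ((N C k) × (X ^ k ⊠ const c ^ (N ∸ k)))
                    ≋ const (c R.^ (N ∸ k)) ⊠ ((N C k) ℕ.* ((ℓ ℕ.+ k ℕ.+ r) C r)) × X ^ (ℓ ℕ.+ k)
    summand k = begin
      Φ ((N C k) × (X ^ k ⊠ const c ^ (N ∸ k)))
        ≈⟨ Φ.×-homo (N C k) _ ⟩
      (N C k) × Φ (X ^ k ⊠ const c ^ (N ∸ k))
        ≈⟨ P.×-congʳ (N C k) (P.trans (Φ.cong (P.trans (P.*-comm _ _) (P.*-congʳ (P.sym (const-^ (N ∸ k) c)))))
             (Φ.const-⊠ (c R.^ (N ∸ k)) (X ^ k))) ⟩
      (N C k) × (const (c R.^ (N ∸ k)) ⊠ Φ (X ^ k))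
        ≈⟨ P.sym (P.×-comm-* (N C k) _ _) ⟩
      const (c R.^ (N ∸ k)) ⊠ (N C k) × Φ (X ^ k)
        ≈⟨ P.*-congˡ (P.trans (P.×-congʳ (N C k) (Φ-X^ k)) (P.×-assocˡ _ (N C k) _)) ⟩
      const (c R.^ (N ∸ k)) ⊠ ((N C k) ℕ.* ((ℓ ℕ.+ k ℕ.+ r) C r)) × X ^ (ℓ ℕ.+ k) ∎

  -- With d = 0 and p = x^n this is E_n(α - x) = (-1)^n E_n(x).
  ▹-reflect : ∀ α c d → c R.+ d R.≈ α → ∀ p →
    ((2/[e^t+1]^ α) ▹ p) ⟨ const c ⊞ ⊟ X ⟩ ≋ (2/[e^t+1]^ α) ▹ p ⟨ ⊟ (X ⊞ const d) ⟩
  ▹-reflect α c d c+d≈α p = begin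
    (H ▹ p) ⟨ const c ⊞ ⊟ X ⟩
      -- c - x = -(x - c), so the substitution is x ↦ -x followed by x ↦ x - c. The first turns `H`
      -- into `ν H`, the second is the action of `exp (- c)`.
      ≈⟨ ⟨⟩-congˡ (H ▹ p) (P.sym (P.trans (neg (R.- c)) (P.trans (P.+-comm _ _)
           (P.+-congʳ (P.trans (P.-‿cong (const-neg c)) (P.-‿involutive (const c))))))) ⟩
    (H ▹ p) ⟨ (⊟ X) ⟨ X ⊞ const (R.- c) ⟩ ⟩
      ≈⟨ P.sym (⟨⟩-assoc (H ▹ p) (⊟ X) (X ⊞ const (R.- c))) ⟩
    (H ▹ p) ⟨ ⊟ X ⟩ ⟨ X ⊞ const (R.- c) ⟩
      ≈⟨ P.trans (⟨⟩-congʳ _ (▹-⟨-X⟩ H p)) (P.sym (exp-▹ (R.- c) _)) ⟩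
    exp (R.- c) ▹ ν H ▹ p ⟨ ⊟ X ⟩
      ≈⟨ P.sym (⊗-▹ (exp (R.- c)) (ν H) _) ⟩
    (exp (R.- c) ⊗ ν H) ▹ p ⟨ ⊟ X ⟩
      ≈⟨ ▹-congʳ _ (S.trans (S.*-congˡ (ν-F^^ α)) (S.trans (S.sym (S.*-assoc _ _ H))
           (S.trans (S.*-congʳ (S.trans (exp-+ (R.- c) α) (exp-cong -c+α≈d))) (S.*-comm (exp d) H)))) ⟩
    (H ⊗ exp d) ▹ p ⟨ ⊟ X ⟩
      ≈⟨ P.trans (⊗-▹ H (exp d) _) (▹-cong H (exp-▹ d (p ⟨ ⊟ X ⟩))) ⟩
    H ▹ p ⟨ ⊟ X ⟩ ⟨ X ⊞ const d ⟩
      ≈⟨ ▹-cong H (P.trans (⟨⟩-assoc p (⊟ X) (X ⊞ const d)) (⟨⟩-congˡ p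
           (P.trans (IsLinear.⊟-homo (⟨⟩-linear (X ⊞ const d)) X) (P.-‿cong (⟨⟩-X (X ⊞ const d)))))) ⟩
    H ▹ p ⟨ ⊟ (X ⊞ const d) ⟩ ∎
    where
    H = 2/[e^t+1]^ α

    -c+α≈d : R.- c R.+ α R.≈ d
    -c+α≈d = R.trans (R.+-congˡ (R.sym c+d≈α)) (R.trans (R.sym (R.+-assoc (R.- c) c d))
      (R.trans (R.+-congʳ (R.-‿inverseˡ c)) (R.+-identityˡ d)))

    neg : ∀ b → (⊟ X) ⟨ X ⊞ const b ⟩ ≋ ⊟ X ⊞ ⊟ const b
    neg b = P.trans (IsLinear.⊟-homo (⟨⟩-linear (X ⊞ const b)) X)
      (P.trans (P.-‿cong (⟨⟩-X (X ⊞ const b))) (P.sym (P.-‿+-comm X (const b))))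

  -- Signs, and derivatives under reflection.

  private
    m : Poly
    m = ⊟ const R.1#

    m⊠m⊠ : ∀ p → m ⊠ (m ⊠ p) ≋ p
    m⊠m⊠ p = P.trans (P.-1*x≈-x (m ⊠ p)) (P.trans (P.-‿cong (P.-1*x≈-x p)) (P.-‿involutive p))

    m^⊠m^ : ∀ n → m ^ n ⊠ m ^ n ≋ const R.1#
    m^⊠m^ zero    = P.*-identityˡ _
    m^⊠m^ (suc n) = P.trans (P.solve 2 (λ m x → (m P.:* x) P.:* (m P.:* x) P.:= m P.:* (m P.:* (x P.:* x))) P.refl m (m ^ n))
      (P.trans (m⊠m⊠ _) (m^⊠m^ n))

  ⟨⟩-^ : ∀ n p q → (p ^ n) ⟨ q ⟩ ≋ p ⟨ q ⟩ ^ n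
  ⟨⟩-^ zero    p q = ⟨⟩-const R.1# q
  ⟨⟩-^ (suc n) p q = P.trans (⟨⟩-⊠ p (p ^ n) q) (P.*-congˡ (⟨⟩-^ n p q))

  ⟨⟩-X⊞const : ∀ c q → (X ⊞ const c) ⟨ q ⟩ ≋ q ⊞ const c
  ⟨⟩-X⊞const c q = P.trans (⟨⟩-⊞ X (const c) q) (P.+-cong (⟨⟩-X q) (⟨⟩-const c q))

  -- By the chain rule each derivative contributes one factor D q = -1, which is its own inverse and
  -- so may stand on either side.
  D^-reflect : ∀ r p q → D q ≋ m → D^ r p ⟨ q ⟩ ≋ m ^ r ⊠ D^ r (p ⟨ q ⟩)
  D^-reflect zero    p q Dq = P.trans (⟨⟩-congʳ q (P.reflexive (D^-zero p)))
    (P.sym (P.trans (P.*-identityˡ _) (P.reflexive (D^-zero (p ⟨ q ⟩)))))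
  D^-reflect (suc r) p q Dq = begin
    D^ (suc r) p ⟨ q ⟩
      ≈⟨ ⟨⟩-congʳ q (P.reflexive (D^-suc r p)) ⟩
    D (D^ r p) ⟨ q ⟩
      ≈⟨ P.sym (P.trans (P.*-congˡ (P.*-congʳ Dq)) (m⊠m⊠ _)) ⟩
    m ⊠ (D q ⊠ D (D^ r p) ⟨ q ⟩)
      ≈⟨ P.*-congˡ (P.trans (P.*-comm _ _) (P.sym (D-⟨⟩ (D^ r p) q))) ⟩
    m ⊠ D (D^ r p ⟨ q ⟩)
      ≈⟨ P.*-congˡ (P.trans (D-cong (D^-reflect r p q Dq)) (IsLinear.⊟1^-⊠ D-linear r _)) ⟩
    m ⊠ (m ^ r ⊠ D (D^ r (p ⟨ q ⟩)))
      ≈⟨ P.trans (P.sym (P.*-assoc m (m ^ r) _)) (P.*-congˡ (P.reflexive (≡.sym (D^-suc r _)))) ⟩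
    m ^ suc r ⊠ D^ (suc r) (p ⟨ q ⟩) ∎

  alternating : ℕ → (ℕ → Poly) → Poly
  alternating s q = ∑[ k < s ] m ^ k ⊠ q k

  -- Sums are unrolled from the front, so the induction is on `s` with the sequence shifted by one;
  -- the two copies of `q 1` have opposite signs.
  telescope : ∀ s q → alternating s (q ∘ suc) ⊞ alternating s q ≋ q 0 ⊞ m ⊠ (m ^ s ⊠ q s)
  telescope zero    q = P.sym (P.trans (P.+-congˡ (P.trans (P.*-congˡ (P.*-identityˡ (q 0))) (P.-1*x≈-x (q 0))))
    (P.trans (P.-‿inverseʳ (q 0)) (P.sym (P.+-identityˡ []))))
  telescope (suc s) q = begin
    alternating (suc s) (q ∘ suc) ⊞ alternating (suc s) q
      ≈⟨ P.+-cong (unroll (q ∘ suc)) (unroll q) ⟩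
    (q 1 ⊞ m ⊠ alternating s (q ∘ suc ∘ suc)) ⊞ (q 0 ⊞ m ⊠ alternating s (q ∘ suc))
      ≈⟨ P.solve 5 (λ u m x v y → (u P.:+ m P.:* x) P.:+ (v P.:+ m P.:* y) P.:= v P.:+ (u P.:+ m P.:* (x P.:+ y))) P.refl
           (q 1) m (alternating s (q ∘ suc ∘ suc)) (q 0) (alternating s (q ∘ suc)) ⟩
    q 0 ⊞ (q 1 ⊞ m ⊠ (alternating s (q ∘ suc ∘ suc) ⊞ alternating s (q ∘ suc)))
      ≈⟨ P.+-congˡ (P.+-congˡ (P.*-congˡ (telescope s (q ∘ suc)))) ⟩
    q 0 ⊞ (q 1 ⊞ m ⊠ (q 1 ⊞ m ⊠ (m ^ s ⊠ q (suc s))))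
      ≈⟨ P.+-congˡ (P.trans (P.+-congˡ (P.distribˡ m _ _)) (P.trans (P.sym (P.+-assoc _ _ _))
           (P.trans (P.+-congʳ (P.trans (P.+-congˡ (P.-1*x≈-x (q 1))) (P.-‿inverseʳ (q 1)))) (P.+-identityˡ _)))) ⟩
    q 0 ⊞ m ⊠ (m ⊠ (m ^ s ⊠ q (suc s)))
      ≈⟨ P.+-congˡ (P.*-congˡ (P.sym (P.*-assoc m (m ^ s) (q (suc s))))) ⟩
    q 0 ⊞ m ⊠ (m ^ suc s ⊠ q (suc s)) ∎
    where
    unroll : ∀ (q : ℕ → Poly) → alternating (suc s) q ≋ q 0 ⊞ m ⊠ alternating s (q ∘ suc)
    unroll q = P.+-cong (P.*-identityˡ (q 0)) (P.trans
      (P.∑-cong s (λ k → m ^ suc k ⊠ q (suc k)) (λ k → m ⊠ (m ^ k ⊠ q (suc k))) (λ k → P.*-assoc m (m ^ k) (q (suc k))))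
      (P.sym (P.*-∑ s m (λ k → m ^ k ⊠ q (suc k)))))

  -- The identity for fixed parameters.

  module _ (α λ′ : R.Carrier) (ℓ n r s : ℕ) where
    private
      N L : ℕ
      N = n ℕ.+ r
      L = ℓ ℕ.+ r

      H : Series
      H = 2/[e^t+1]^ α

      A B q : ℕ → Poly
      A k = X ⊞ const (k R.× R.1#)
      B k = X ⊞ const (λ′ R.+ k R.× R.1#)
      q k = A k ^ L ⊠ B k ^ N

      W : Poly → Poly
      W p = H ▹ D^/! r p

      module W = IsLinear (∘-linear (▹-linear H) (D^/!-linear r))

      A-0 : A 0 ≋ X
      A-0 = P.trans (P.+-congˡ const-0) (P.+-identityʳ X)

      B-0 : B 0 ≋ X ⊞ const λ′
      B-0 = P.+-congˡ (const-cong (R.+-identityʳ λ′))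

      shift : ∀ c d → c R.+ R.1# R.≈ d → (X ⊞ const c) ⟨ X ⊞ const R.1# ⟩ ≋ X ⊞ const d
      shift c d c+1≈d = P.trans (⟨⟩-X⊞const c (X ⊞ const R.1#)) (P.trans (P.+-assoc X _ _)
        (P.+-congˡ (P.trans (P.+-comm _ _) (P.trans (P.sym (const-+ c R.1#)) (const-cong c+1≈d)))))

      q-shift : ∀ k → q k ⟨ X ⊞ const R.1# ⟩ ≋ q (suc k)
      q-shift k = P.trans (⟨⟩-⊠ (A k ^ L) (B k ^ N) (X ⊞ const R.1#)) (P.*-cong
        (P.trans (⟨⟩-^ L (A k) _) (P.^-congˡ L (shift _ _ (R.+-comm _ R.1#))))
        (P.trans (⟨⟩-^ N (B k) _) (P.^-congˡ N (shift _ _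
          (R.trans (R.+-assoc λ′ _ R.1#) (R.+-congˡ (R.+-comm _ R.1#)))))))

    first-sum :
      ∑[ k < suc N ] const (λ′ R.^ (N ∸ k)) ⊠ ((N C k) ℕ.* ((ℓ ℕ.+ k ℕ.+ r) C r)) × E α (ℓ ℕ.+ k) ≋ W (q 0)
    first-sum = P.trans
      (IsLinear.∑-weighted (▹-linear H) (suc N) (λ k → λ′ R.^ (N ∸ k)) (λ k → (N C k) ℕ.* ((ℓ ℕ.+ k ℕ.+ r) C r))
        (λ k → E α (ℓ ℕ.+ k)) (λ k → X ^ (ℓ ℕ.+ k)) (λ k → E-▹ α (ℓ ℕ.+ k)))
      (▹-cong H (P.trans (D^/!-binomial ℓ N r λ′) (IsLinear.cong (D^/!-linear r)
        (P.*-cong (P.^-congˡ L (P.sym A-0)) (P.^-congˡ N (P.sym B-0))))))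

    private
      c d : R.Carrier
      c = α R.- s R.× R.1# R.- λ′
      d = λ′ R.+ s R.× R.1#

      c+d≈α : c R.+ d R.≈ α
      c+d≈α = let σ = s R.× R.1# in
        R.trans (R.solve 5 (λ α σ⁻ λ⁻ λ′ σ → (α R.:+ σ⁻ R.:+ λ⁻) R.:+ (λ′ R.:+ σ) R.:= α R.:+ ((σ⁻ R.:+ σ) R.:+ (λ⁻ R.:+ λ′))) R.refl
          α (R.- σ) (R.- λ′) λ′ σ)
        (R.trans (R.+-congˡ (R.trans (R.+-cong (R.-‿inverseˡ σ) (R.-‿inverseˡ λ′)) (R.+-identityˡ R.0#))) (R.+-identityʳ α))

      -- What x ↦ `c` - x becomes inside F^α(D): -(x + `d`) with `d` = α - `c`. It sends x to -`B s`
      -- and x + λ to -`A s`, so x^N (x + λ)^L turns into `q s` up to sign.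
      q⁻ : Poly
      q⁻ = ⊟ B s

      D-q⁻ : D q⁻ ≋ m
      D-q⁻ = P.trans (IsLinear.⊟-homo D-linear (B s)) (P.-‿cong (P.trans (D-⊞ X (const d))
        (P.trans (P.+-cong D-X (D-const d)) (P.+-identityʳ _))))

      q⁻+λ′ : q⁻ ⊞ const λ′ ≋ m ⊠ A s
      q⁻+λ′ = let σ = s R.× R.1# in begin
        ⊟ B s ⊞ const λ′
          ≈⟨ P.+-congʳ (P.-‿cong (P.trans (P.+-congˡ (P.trans (const-+ λ′ σ) (P.+-comm _ _))) (P.sym (P.+-assoc X _ _)))) ⟩
        ⊟ (A s ⊞ const λ′) ⊞ const λ′
          ≈⟨ P.+-congʳ (P.sym (P.-‿+-comm (A s) (const λ′))) ⟩
        (⊟ A s ⊞ ⊟ const λ′) ⊞ const λ′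
          ≈⟨ P.trans (P.+-assoc _ _ _) (P.trans (P.+-congˡ (P.-‿inverseˡ (const λ′))) (P.+-identityʳ _)) ⟩
        ⊟ A s
          ≈⟨ P.sym (P.-1*x≈-x (A s)) ⟩
        m ⊠ A s ∎

      reflected : (X ^ N ⊠ (X ⊞ const λ′) ^ L) ⟨ q⁻ ⟩ ≋ (m ^ N ⊠ m ^ L) ⊠ q s
      reflected = begin
        (X ^ N ⊠ (X ⊞ const λ′) ^ L) ⟨ q⁻ ⟩
          ≈⟨ ⟨⟩-⊠ (X ^ N) ((X ⊞ const λ′) ^ L) q⁻ ⟩
        (X ^ N) ⟨ q⁻ ⟩ ⊠ ((X ⊞ const λ′) ^ L) ⟨ q⁻ ⟩
          ≈⟨ P.*-cong (P.trans (⟨⟩-^ N X q⁻) (P.^-congˡ N (P.trans (⟨⟩-X q⁻) (P.sym (P.-1*x≈-x (B s))))))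
               (P.trans (⟨⟩-^ L (X ⊞ const λ′) q⁻) (P.^-congˡ L (P.trans (⟨⟩-X⊞const λ′ q⁻) q⁻+λ′))) ⟩
        (m ⊠ B s) ^ N ⊠ (m ⊠ A s) ^ L
          ≈⟨ P.*-cong (P.^-distrib-* m (B s) N) (P.^-distrib-* m (A s) L) ⟩
        (m ^ N ⊠ B s ^ N) ⊠ (m ^ L ⊠ A s ^ L)
          ≈⟨ P.solve 4 (λ x b y a → (x P.:* b) P.:* (y P.:* a) P.:= (x P.:* y) P.:* (a P.:* b)) P.refl
               (m ^ N) (B s ^ N) (m ^ L) (A s ^ L) ⟩
        (m ^ N ⊠ m ^ L) ⊠ q s ∎

      -- Reflection contributes r signs from D^r and N + L from the two powers. With the prefactor
      -- the exponent is 2ℓ + 2n + 4r + s + 1, of the parity of s + 1.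
      sign : m ^ (ℓ ℕ.+ n ℕ.+ r ℕ.+ s ℕ.+ 1) ⊠ (m ^ r ⊠ (m ^ N ⊠ m ^ L)) ≋ m ⊠ m ^ s
      sign = begin
        m ^ (ℓ ℕ.+ n ℕ.+ r ℕ.+ s ℕ.+ 1) ⊠ (m ^ r ⊠ (m ^ N ⊠ m ^ L))
          ≈⟨ P.*-cong
               (P.trans (P.^-homo-* m (ℓ ℕ.+ n ℕ.+ r ℕ.+ s) 1) (P.*-cong
                 (P.trans (P.^-homo-* m (ℓ ℕ.+ n ℕ.+ r) s) (P.*-congʳ
                   (P.trans (P.^-homo-* m (ℓ ℕ.+ n) r) (P.*-congʳ (P.^-homo-* m ℓ n)))))
                 (P.*-identityʳ m)))
               (P.*-congˡ (P.*-cong (P.^-homo-* m n r) (P.^-homo-* m ℓ r))) ⟩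
        (m ^ ℓ ⊠ m ^ n ⊠ m ^ r ⊠ m ^ s ⊠ m) ⊠ (m ^ r ⊠ ((m ^ n ⊠ m ^ r) ⊠ (m ^ ℓ ⊠ m ^ r)))
          ≈⟨ P.solve 5 (λ l n r s m → (l P.:* n P.:* r P.:* s P.:* m) P.:* (r P.:* ((n P.:* r) P.:* (l P.:* r)))
               P.:= ((l P.:* l) P.:* (n P.:* n) P.:* ((r P.:* r) P.:* (r P.:* r))) P.:* (m P.:* s)) P.refl
               (m ^ ℓ) (m ^ n) (m ^ r) (m ^ s) m ⟩
        ((m ^ ℓ ⊠ m ^ ℓ) ⊠ (m ^ n ⊠ m ^ n) ⊠ ((m ^ r ⊠ m ^ r) ⊠ (m ^ r ⊠ m ^ r))) ⊠ (m ⊠ m ^ s)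
          ≈⟨ P.*-congʳ (P.*-cong (P.*-cong (m^⊠m^ ℓ) (m^⊠m^ n)) (P.*-cong (m^⊠m^ r) (m^⊠m^ r))) ⟩
        (1ₚ ⊠ 1ₚ ⊠ (1ₚ ⊠ 1ₚ)) ⊠ (m ⊠ m ^ s)
          ≈⟨ P.trans (P.*-congʳ (P.trans (P.*-cong (P.*-identityˡ 1ₚ) (P.*-identityˡ 1ₚ)) (P.*-identityˡ 1ₚ))) (P.*-identityˡ _) ⟩
        m ⊠ m ^ s ∎
        where 1ₚ = const R.1#

    second-sum :
      m ^ (ℓ ℕ.+ n ℕ.+ r ℕ.+ s ℕ.+ 1) ⊠
        ∑< (suc L) (λ k → const (λ′ R.^ (L ∸ k)) ⊠ ((L C k) ℕ.* ((n ℕ.+ k ℕ.+ r) C r)) ×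
          E α (n ℕ.+ k) ⟨ const c ⊞ ⊟ X ⟩)
      ≋ m ⊠ (m ^ s ⊠ W (q s))
    second-sum = begin
      m ^ e ⊠ ∑< (suc L) (λ k → const (λ′ R.^ (L ∸ k)) ⊠ ((L C k) ℕ.* ((n ℕ.+ k ℕ.+ r) C r)) × E α (n ℕ.+ k) ⟨ const c ⊞ ⊟ X ⟩)
        -- Reflection is moved inside F^α(D) term by term, which makes the sum one linear operator
        -- applied to an expansion in powers of X.
        ≈⟨ P.*-congˡ (IsLinear.∑-weighted (∘-linear (▹-linear H) (⟨⟩-linear q⁻)) (suc L) (λ k → λ′ R.^ (L ∸ k))
             (λ k → (L C k) ℕ.* ((n ℕ.+ k ℕ.+ r) C r)) (λ k → E α (n ℕ.+ k) ⟨ const c ⊞ ⊟ X ⟩) (λ k → X ^ (n ℕ.+ k))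
             (λ k → P.trans (⟨⟩-congʳ _ (E-▹ α (n ℕ.+ k))) (▹-reflect α c d c+d≈α (X ^ (n ℕ.+ k))))) ⟩
      m ^ e ⊠ (H ▹ (∑< (suc L) (λ k → const (λ′ R.^ (L ∸ k)) ⊠ ((L C k) ℕ.* ((n ℕ.+ k ℕ.+ r) C r)) × X ^ (n ℕ.+ k))) ⟨ q⁻ ⟩)
        ≈⟨ P.*-congˡ (▹-cong H (⟨⟩-congʳ q⁻ (D^/!-binomial n L r λ′))) ⟩
      m ^ e ⊠ (H ▹ (κ ⊠ D^ r p) ⟨ q⁻ ⟩)
        ≈⟨ P.*-congˡ (▹-cong H (P.trans (⟨⟩-const⊠ _ (D^ r p) q⁻) (P.*-congˡ (D^-reflect r p q⁻ D-q⁻)))) ⟩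
      m ^ e ⊠ (H ▹ (κ ⊠ (m ^ r ⊠ D^ r (p ⟨ q⁻ ⟩))))
        ≈⟨ P.*-congˡ (P.trans (▹-cong H (P.solve 3 (λ k x y → k P.:* (x P.:* y) P.:= x P.:* (k P.:* y)) P.refl κ (m ^ r) _))
             (IsLinear.⊟1^-⊠ (▹-linear H) r _)) ⟩
      m ^ e ⊠ (m ^ r ⊠ W (p ⟨ q⁻ ⟩))
        ≈⟨ P.*-congˡ (P.*-congˡ (P.trans (W.cong (P.trans reflected (P.*-assoc _ _ (q s))))
             (P.trans (W.⊟1^-⊠ N _) (P.trans (P.*-congˡ (W.⊟1^-⊠ L (q s))) (P.sym (P.*-assoc _ _ (W (q s)))))))) ⟩
      m ^ e ⊠ (m ^ r ⊠ ((m ^ N ⊠ m ^ L) ⊠ W (q s)))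
        ≈⟨ P.trans (P.*-congˡ (P.sym (P.*-assoc _ _ _))) (P.trans (P.sym (P.*-assoc _ _ _)) (P.trans (P.*-congʳ sign) (P.*-assoc m (m ^ s) _))) ⟩
      m ⊠ (m ^ s ⊠ W (q s)) ∎
      where
      e = ℓ ℕ.+ n ℕ.+ r ℕ.+ s ℕ.+ 1
      κ = const (fromℚ (1/ r !))
      p = X ^ N ⊠ (X ⊞ const λ′) ^ L

    private
      Σq p : Poly
      Σq = ∑[ k < s ] m ^ k ⊠ A k ^ L ⊠ B k ^ N
      p = D^/! r Σq

      Σq≋ : Σq ≋ alternating s q
      Σq≋ = P.∑-cong s (λ k → m ^ k ⊠ A k ^ L ⊠ B k ^ N) (λ k → m ^ k ⊠ q k) (λ k → P.*-assoc _ _ _)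

      module τ = IsLinear (⟨⟩-linear (X ⊞ const R.1#))

      shifted : exp R.1# ▹ Σq ≋ alternating s (q ∘ suc)
      shifted = P.trans (exp-▹ R.1# Σq) (P.trans (τ.cong Σq≋) (P.trans (τ.∑-homo s (λ k → m ^ k ⊠ q k))
        (P.∑-cong s (λ k → (m ^ k ⊠ q k) ⟨ X ⊞ const R.1# ⟩) (λ k → m ^ k ⊠ q (suc k))
          (λ k → P.trans (τ.⊟1^-⊠ k (q k)) (P.*-congˡ (q-shift k))))))

      exp-D^/! : exp R.1# ▹ p ≋ D^/! r (exp R.1# ▹ Σq)
      exp-D^/! = P.trans (▹-const⊠ (exp R.1#) _ (D^ r Σq)) (P.*-congˡ (▹-D^ (exp R.1#) r Σq))

    right-hand-side :
      2 × Ψ (α R.- R.1#) (D^/! r (∑[ k < s ] m ^ k ⊠ A k ^ L ⊠ B k ^ N)) ≋ W (q 0) ⊞ m ⊠ (m ^ s ⊠ W (q s))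
    right-hand-side = begin
      2 × Ψ (α R.- R.1#) p
        ≈⟨ 2×Ψ-▹ α p ⟩
      H ▹ (exp R.1# ▹ p ⊞ p)
        -- e^D commutes with D^r / r!, so both summands come under one `W`.
        ≈⟨ ▹-cong H (P.trans (P.+-congʳ exp-D^/!) (P.sym (IsLinear.⊞-homo (D^/!-linear r) (exp R.1# ▹ Σq) Σq))) ⟩
      W (exp R.1# ▹ Σq ⊞ Σq)
        ≈⟨ W.cong (P.trans (P.+-cong shifted Σq≋) (telescope s q)) ⟩
      W (q 0 ⊞ m ⊠ (m ^ s ⊠ q s))
        ≈⟨ P.trans (W.⊞-homo (q 0) _) (P.+-congˡ (P.trans (W.⊟1-⊠ _) (P.*-congˡ (W.⊟1^-⊠ s (q s))))) ⟩
      W (q 0) ⊞ m ⊠ (m ^ s ⊠ W (q s)) ∎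

    identity :
      ∑< (suc N) (λ k → const (λ′ R.^ (N ∸ k)) ⊠ ((N C k) ℕ.* ((ℓ ℕ.+ k ℕ.+ r) C r)) × E α (ℓ ℕ.+ k))
      ⊞ m ^ (ℓ ℕ.+ n ℕ.+ r ℕ.+ s ℕ.+ 1) ⊠
        ∑< (suc L) (λ k → const (λ′ R.^ (L ∸ k)) ⊠ ((L C k) ℕ.* ((n ℕ.+ k ℕ.+ r) C r)) ×
          E α (n ℕ.+ k) ⟨ const c ⊞ ⊟ X ⟩)
      ≋ 2 × Ψ (α R.- R.1#) (D^/! r (∑[ k < s ] m ^ k ⊠ A k ^ L ⊠ B k ^ N))
    identity = P.trans (P.+-cong first-sum second-sum) (P.sym right-hand-side)

  -- From the opaque operations back to the original ones.

  open Identities R.rawRing fromℚ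

  private
    transport : ∀ {≈₁ ≈₂ +₁ +₂ *₁ *₂ -₁ -₂ sub₁ sub₂ E₁ E₂ Ψ₁ Ψ₂ D₁ D₂} →
      ≈₁ ≡ ≈₂ → +₁ ≡ +₂ → *₁ ≡ *₂ → -₁ ≡ -₂ → sub₁ ≡ sub₂ → E₁ ≡ E₂ → Ψ₁ ≡ Ψ₂ → D₁ ≡ D₂ →
      ∀ {α λ′ ℓ n r s} → Identity ≈₁ +₁ *₁ -₁ sub₁ E₁ Ψ₁ D₁ α λ′ ℓ n r s → Identity ≈₂ +₂ *₂ -₂ sub₂ E₂ Ψ₂ D₂ α λ′ ℓ n r s
    transport ≡.refl ≡.refl ≡.refl ≡.refl ≡.refl ≡.refl ≡.refl ≡.refl i = i

    opaque
      unfolding _≋_ E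

      ≋-raw : _≋_ ≡ GE._≈_
      ≋-raw = ≡.refl

      ⊞-raw : _⊞_ ≡ GE._+_
      ⊞-raw = ≡.refl

      ⊠-raw : _⊠_ ≡ GE._*_
      ⊠-raw = ≡.refl

      ⊟-raw : ⊟_ ≡ GE.-_
      ⊟-raw = ≡.refl

      ⟨⟩-raw : _⟨_⟩ ≡ GE._[_]
      ⟨⟩-raw = ≡.refl

      E-raw : E ≡ GE.E
      E-raw = ≡.refl

      Ψ-raw : Ψ ≡ GE.Ψ
      Ψ-raw = ≡.refl

      D^-raw : D^ ≡ GE.D^
      D^-raw = ≡.refl

  opaque
    unfolding Identity

    opaque-identity : ∀ α λ′ ℓ n r s → Identity _≋_ _⊞_ _⊠_ ⊟_ _⟨_⟩ E Ψ D^ α λ′ ℓ n r s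
    opaque-identity = identity

  raw-identity : ∀ α λ′ ℓ n r s → Identity GE._≈_ GE._+_ GE._*_ GE.-_ GE._[_] GE.E GE.Ψ GE.D^ α λ′ ℓ n r s
  raw-identity α λ′ ℓ n r s =
    transport ≋-raw ⊞-raw ⊠-raw ⊟-raw ⟨⟩-raw E-raw Ψ-raw D^-raw (opaque-identity α λ′ ℓ n r s)

-- Inverses of factorials among the rational and the complex numbers.

module ℚ-ops = RingOps (CommutativeRing.rawRing ℚ.+-*-commutativeRing)

toℚᵘ-/ : ∀ i n → toℚᵘ (i ℚ./ suc n) ℚᵘ.≃ ℚᵘ.mkℚᵘ i n
toℚᵘ-/ i n = ℚ.toℚᵘ-fromℚᵘ (ℚᵘ.mkℚᵘ i n)

-- The addition is done on unnormalised fractions, where no common factor is cancelled and equality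
-- is cross multiplication.
×-1/ : ∀ k n → k ℚ-ops.× (+ 1 ℚ./ suc n) ≡ + k ℚ./ suc n
×-1/ zero    n = ≡.sym (ℚ.0/n≡0 (suc n))
×-1/ (suc k) n = ≡.trans (≡.cong ((+ 1 ℚ./ suc n) ℚ.+_) (×-1/ k n)) (ℚ.toℚᵘ-injective (begin
  toℚᵘ ((+ 1 ℚ./ suc n) ℚ.+ (+ k ℚ./ suc n))           ≈⟨ ℚ.toℚᵘ-homo-+ (+ 1 ℚ./ suc n) (+ k ℚ./ suc n) ⟩
  toℚᵘ (+ 1 ℚ./ suc n) ℚᵘ.+ toℚᵘ (+ k ℚ./ suc n)       ≈⟨ ℚᵘ.+-cong (toℚᵘ-/ (+ 1) n) (toℚᵘ-/ (+ k) n) ⟩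
  ℚᵘ.mkℚᵘ (+ 1) n ℚᵘ.+ ℚᵘ.mkℚᵘ (+ k) n                 ≈⟨ ℚᵘ.*≡* (solve 2 (λ k m → (con (+ 1) :* m :+ k :* m) :* m := (con (+ 1) :+ k) :* (m :* m)) ≡.refl (+ k) (+ suc n)) ⟩
  ℚᵘ.mkℚᵘ (+ suc k) n                                  ≈⟨ ℚᵘ.≃-sym (toℚᵘ-/ (+ suc k) n) ⟩
  toℚᵘ (+ suc k ℚ./ suc n)                             ∎))
  where
  open Data.Integer.Solver.+-*-Solver
  open import Relation.Binary.Reasoning.Setoid ℚᵘ.≃-setoid

n/n≡1 : ∀ n → + suc n ℚ./ suc n ≡ 1ℚ
n/n≡1 n = ℚ.toℚᵘ-injective (ℚᵘ.≃-trans (toℚᵘ-/ (+ suc n) n) (ℚᵘ.*≡* (ℤ.*-comm (+ suc n) (+ 1))))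

!-×-1/! : ∀ n → (n !) ℚ-ops.× (1/ n !) ≡ 1ℚ
!-×-1/! n = go (n !) {{n ℕ.!≢0}}
  where
  -- `n !` does not compute to a successor, so it is generalised to any nonzero d.
  go : ∀ d .{{_ : NonZero d}} → d ℚ-ops.× (+ 1 ℚ./ d) ≡ 1ℚ
  go (suc d) = ≡.trans (×-1/ (suc d) d) (n/n≡1 d)

ℂ-inverse-! : ∀ n → CommutativeRing._≈_ Complexes.commutativeRing
  (RingOps._×_ (CommutativeRing.rawRing Complexes.commutativeRing) (n !) (Complexes.fromℚ (1/ n !)))
  (CommutativeRing.1# Complexes.commutativeRing)
ℂ-inverse-! n = trans (sym (×-homo (n !) (1/ n !))) (⟦⟧-cong (!-×-1/! n))
  where
  open CommutativeRing Complexes.commutativeRing using (_≈_; trans; sym; +-congˡ; rawRing)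
  open RingOps rawRing using (_×_)
  open RingMorphisms.IsRingHomomorphism Complexes.fromℚ-isRingHomomorphism using (⟦⟧-cong; +-homo; 0#-homo)

  ×-homo : ∀ k q → Complexes.fromℚ (k ℚ-ops.× q) ≈ k × Complexes.fromℚ q
  ×-homo zero    q = 0#-homo
  ×-homo (suc k) q = trans (+-homo q (k ℚ-ops.× q)) (+-congˡ (×-homo k q))

-- Specialisation to the complex numbers.

module OverComplexNumbers where
  open ℂ[x] hiding (E; Ψ; D^; _[_])
  open Identities (CommutativeRing.rawRing Complexes.commutativeRing) Complexes.fromℚ

  opaque
    unfolding Identity

    -- Composition, E, Ψ and D^ are left variable: with their definitions in sight,
    -- comparing the two forms of the identity is infeasible.
    fromIdentity : (_[_] : Poly → Poly → Poly) (E : ℂ → ℕ → Poly) (Ψ : ℂ → Poly → Poly) (D^ : ℕ → Poly → Poly) →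
      (α λ′ : ℂ) (ℓ n r s : ℕ) →
      Identity _≈_ _+_ _*_ -_ _[_] E Ψ D^ α λ′ ℓ n r s →
      (∑[ k < suc (n ℕ.+ r) ]
      const (λ′ ^ᶜ (n ℕ.+ r ∸ k)) *
      (((n ℕ.+ r) C k) ℕ.* ((ℓ ℕ.+ k ℕ.+ r) C r)) × E α (ℓ ℕ.+ k))
      + (- 1#) ^ (ℓ ℕ.+ n ℕ.+ r ℕ.+ s ℕ.+ 1) *
      (∑[ k < suc (ℓ ℕ.+ r) ]
      const (λ′ ^ᶜ (ℓ ℕ.+ r ∸ k)) *
      (((ℓ ℕ.+ r) C k) ℕ.* ((n ℕ.+ k ℕ.+ r) C r)) ×
      (E α (n ℕ.+ k) [ const (α -ᶜ s ×ᶜ 1ᶜ -ᶜ λ′) - X ]))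
      ≈ 2 × Ψ (α -ᶜ 1ᶜ)
      (const (Complexes.fromℚ 1/ r !) * D^ r
      (∑[ k < s ]
      (- 1#) ^ k *
      (X + const (k ×ᶜ 1ᶜ)) ^ (ℓ ℕ.+ r) *
      (X + const (λ′ +ᶜ k ×ᶜ 1ᶜ)) ^ (n ℕ.+ r)))
    fromIdentity _[_] E Ψ D^ α λ′ ℓ n r s i = i

theorem3 : let open ℂ[x] in
    (α λ′ : ℂ) (ℓ n r s : ℕ) →
    (∑[ k < suc (n ℕ.+ r) ]
    const (λ′ ^ᶜ (n ℕ.+ r ∸ k)) *
    (((n ℕ.+ r) C k) ℕ.* ((ℓ ℕ.+ k ℕ.+ r) C r)) × E α (ℓ ℕ.+ k))
    + (- 1#) ^ (ℓ ℕ.+ n ℕ.+ r ℕ.+ s ℕ.+ 1) *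
    (∑[ k < suc (ℓ ℕ.+ r) ]
    const (λ′ ^ᶜ (ℓ ℕ.+ r ∸ k)) *
    (((ℓ ℕ.+ r) C k) ℕ.* ((n ℕ.+ k ℕ.+ r) C r)) ×
    E α (n ℕ.+ k) [ const (α -ᶜ s ×ᶜ 1ᶜ -ᶜ λ′) - X ])
    ≈ 2 × Ψ (α -ᶜ 1ᶜ)
    (const (Complexes.fromℚ 1/ r !) * D^ r
    (∑[ k < s ]
    (- 1#) ^ k *
    (X + const (k ×ᶜ 1ᶜ)) ^ (ℓ ℕ.+ r) *
    (X + const (λ′ +ᶜ k ×ᶜ 1ᶜ)) ^ (n ℕ.+ r)))
theorem3 α λ′ ℓ n r s = OverComplexNumbers.fromIdentity ℂ[x]._[_] ℂ[x].E ℂ[x].Ψ ℂ[x].D^ α λ′ ℓ n r s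
  (EulerPolynomials.raw-identity Complexes.commutativeRing Complexes.fromℚ ℂ-inverse-! α λ′ ℓ n r s)
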